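{- Let $\mathcal{T}$ be a tree on $k$ vertices, let $G_1,\dots,G_k$ be connected graphs, and let $G$ be a chain of $G_1,\dots,G_k$ with respect to $\mathcal{T}$, where $G$ has at least one edge. Then $$\kappa(G)=\sum_{i=1}^k\kappa(G_i)+\sum_{x\sim y\in\mathcal{B}_G}\left(\frac{\overline{W}_x}{m_G}\alpha_{G_x}(x)+\frac{\overline{W}_y}{m_G}\alpha_{G_y}(y)\right)+\sum_{i=1}^{k}\sum_{(z_1,z_2)\in\widetilde{V}_i\times\widetilde{V}_i}\frac{\overline{W}_{z_1}\overline{W}_{z_2}}{2m_Gm_{G_i}}\left(m^{(G_i)}_{z_1,z_2}+m^{(G_i)}_{z_2,z_1}\right)+\sum_{x\sim y\in\mathcal{B}_G}\frac{(2\overline{W}_x-1)(2\overline{W}_y-1)}{2m_G},$$ where $m^{(G_i)}_{z_1,z_2}$ is the mean first passage time from $z_1$ to $z_2$ for the simple random walk on $G_i$, and terms of the third sum in which $z_1$ and $z_2$ are the same vertex are $0$.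
   Context: All graphs are finite, simple and undirected. For a graph $H$, $m_H$ is the number of edges. For a connected graph $H$, consider the simple random walk on $H$ (from a vertex, move to a uniformly random neighbour), with stationary distribution $\pi_j=\deg_H(j)/(2m_H)$ and mean first passage times $m_{i,j}$ from $i$ to $j$ ($i\ne j$). Kemeny's constant is $\kappa(H)=\sum_{j\neq i}\pi_jm_{i,j}$, which does not depend on the choice of the vertex $i$. The accessibility index of a vertex $v$ in $H$ is $\alpha_H(v)=\sum_{i\neq v}\pi_i m_{i,v}$. For a single-vertex graph both are $0$ (empty sums). Chain: let $\mathcal{T}$ be a tree with vertex set $\{1,\dots,k\}$ and $G_1,\dots,G_k$ connected graphs (on disjoint vertex sets). A chain of $G_1,\dots,G_k$ with respect to $\mathcal{T}$ is a graph $G$ obtained from the disjoint union of $G_1,\dots,G_k$ by choosing, for each edge $i\sim j$ of $\mathcal{T}$, some vertex $v_i\in V(G_i)$ and some vertex $v_j\in V(G_j)$ and adding the edge $v_i\sim v_j$ (the choices for different edges of $\mathcal{T}$ are independent; the same vertex may be chosen several times). $\mathcal{B}_G$ is the set of the $k-1$ added edges; each is a bridge of $G$. For a vertex $z$ of $G$, $G_z$ denotes the graph $G_j$ with $z\in V(G_j)$. $\widetilde{V}_i$ is the collection of ends in $V(G_i)$ of bridges in $\mathcal{B}_G$, one element for each bridge in $\mathcal{B}_G$ having an end in $G_i$; so $|\widetilde{V}_i|=\deg_{\mathcal{T}}(i)$, and a vertex incident to several bridges of $\mathcal{B}_G$ occurs once for each of them. For an end $x$ of a bridge $x\sim y\in\mathcal{B}_G$,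 $W_x$ is the number of edges of the component containing $x$ of $G$ with the edge $x\sim y$ removed, and $\overline{W}_x=m_G-W_x$ (so these numbers depend on the end together with its bridge); in particular $\overline{W}_x=W_y+1$. -}

module Defs where

open import Data.Bool.Base using (Bool; true; false; T; not; _∧_; _∨_; if_then_else_)
open import Data.Bool.Properties using (∧-comm; ∨-comm)
open import Data.Integer.Base using (+_)
open import Data.List.Base using (List; []; _∷_; _++_; _∷ʳ_; map; foldr; filter; concatMap; length)
open import Data.List.Membership.Propositional using (_∈_)
open import Data.List.Membership.Propositional.Properties using (∈-concatMap⁺; ∈-map⁺; ∈-map⁻)
import Data.List.Relation.Unary.All as All
import Data.List.Relation.Unary.All.Properties as Allₚ
import Data.List.Relation.Unary.AllPairs as AllPairs
import Data.List.Relation.Unary.AllPairs.Properties as AllPairsₚ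
open import Data.List.Relation.Unary.Any using (here; there)
import Data.List.Relation.Unary.Any as Any
open import Data.List.Relation.Unary.Linked using (Linked)
open import Data.List.Relation.Unary.Unique.Propositional using (Unique)
import Data.List.Relation.Unary.Unique.Propositional.Properties as Uniqueₚ
open import Data.Nat.Base as ℕ using (ℕ; zero; suc)
open import Data.Product.Base using (Σ; ∃-syntax; _×_; _,_)
open import Data.Product.Properties using (≡-dec; ,-injectiveˡ)
open import Data.Rational.Base using (ℚ; 0ℚ; 1ℚ; _/_; _+_; _-_; _*_; _<_; ∣_∣)
open import Data.Sum.Base using (_⊎_; inj₁; inj₂)
open import Relation.Binary.Construct.Closure.ReflexiveTransitive using (Star; ε; _◅_; _◅◅_)
open import Relation.Binary.Definitions using (DecidableEquality)
open import Relation.Binary.PropositionalEquality using (_≡_; _≢_; refl; cong; cong₂)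
open import Relation.Nullary using (¬_; Dec; yes; no; does; contradiction)
open import Relation.Nullary.Decidable using (map′; ¬?; _×-dec_; _⊎-dec_; T?)

------------------------------------------------------------------------
-- Rational arithmetic

fromℕ : ℕ → ℚ
fromℕ n = + n / 1

-- Division by a natural number. The value at 0 is a convention; it is only
-- reached in degenerate cases (graphs without edges), where the quotient is
-- never used.
infixl 7 _÷ℕ_
_÷ℕ_ : ℚ → ℕ → ℚ
q ÷ℕ zero    = 0ℚ
q ÷ℕ (suc d) = q * (+ 1 / suc d)

∑ : {A : Set} → List A → (A → ℚ) → ℚ
∑ xs f = foldr (λ x s → f x + s) 0ℚ xs

infix 4 _⟶_
_⟶_ : (ℕ → ℚ) → ℚ → Set
s ⟶ q = ∀ ε → 0ℚ < ε → ∃[ N ] (∀ n → N ℕ.≤ n → ∣ s n - q ∣ < ε)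

------------------------------------------------------------------------
-- Finite simple graphs

record Graph : Set₁ where
  infix 4 _~_ _≟_
  field
    Vertex     : Set
    _≟_        : DecidableEquality Vertex
    vertices   : List Vertex
    complete   : ∀ v → v ∈ vertices
    unique     : Unique vertices
    adj        : Vertex → Vertex → Bool
    adj-sym    : ∀ u v → adj u v ≡ adj v u
    adj-irrefl : ∀ v → adj v v ≡ false

  _~_ : Vertex → Vertex → Set
  u ~ v = T (adj u v)

  neighbours : Vertex → List Vertex
  neighbours v = filter (λ u → T? (adj v u)) vertices

  degree : Vertex → ℕ
  degree v = length (neighbours v)

  others : Vertex → List Vertex
  others v = filter (λ u → ¬? (u ≟ v)) vertices

open Graph public using (Vertex; vertices)

-- All (x , y) with x occurring strictly before y.
pairs : {A : Set} → List A → List (A × A)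
pairs []       = []
pairs (x ∷ xs) = map (x ,_) xs ++ pairs xs

-- Every edge is listed exactly once, with its ends in an arbitrary order
-- (that of the enumeration of the vertices).
edges : (H : Graph) → List (Vertex H × Vertex H)
edges H = filter (λ (u , v) → T? (Graph.adj H u v)) (pairs (vertices H))

size : Graph → ℕ
size H = length (edges H)

Reachable : (H : Graph) → Vertex H → Vertex H → Set
Reachable H = Star (Graph._~_ H)

Connected : Graph → Set
Connected H = Vertex H × (∀ u v → Reachable H u v)

-- No cycle x, z, …, y, x: distinct vertices, at least three of them.
Acyclic : Graph → Set
Acyclic H = ∀ x z zs y → let c = x ∷ z ∷ (zs ∷ʳ y) in
            Unique c → Linked _~_ c → ¬ (y ~ x)
  where open Graph H

IsTree : Graph → Set
IsTree H = Connected H × Acyclic H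

module _ (H : Graph) where
  open Graph H using (_≟_; adj; adj-sym; adj-irrefl; complete)

  -- Floyd–Warshall: u and v are joined by a walk of length at most one, or
  -- by one whose interior vertices all lie in the list.
  Via : List (Vertex H) → Vertex H → Vertex H → Set
  Via []       u v = u ≡ v ⊎ T (adj u v)
  Via (x ∷ xs) u v = Via xs u v ⊎ (Via xs u x × Via xs x v)

  via? : ∀ xs u v → Dec (Via xs u v)
  via? []       u v = (u ≟ v) ⊎-dec T? (adj u v)
  via? (x ∷ xs) u v = via? xs u v ⊎-dec (via? xs u x ×-dec via? xs x v)

  via⇒reachable : ∀ xs {u v} → Via xs u v → Reachable H u v
  via⇒reachable []       (inj₁ refl)    = ε
  via⇒reachable []       (inj₂ e)       = e ◅ ε
  via⇒reachable (x ∷ xs) (inj₁ p)       = via⇒reachable xs p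
  via⇒reachable (x ∷ xs) (inj₂ (p , q)) = via⇒reachable xs p ◅◅ via⇒reachable xs q

  via-base : ∀ xs {u v} → Via [] u v → Via xs u v
  via-base []       p = p
  via-base (x ∷ xs) p = inj₁ (via-base xs p)

  via-trans : ∀ xs {u m v} → m ∈ xs → Via xs u m → Via xs m v → Via xs u v
  via-trans (x ∷ xs) (here refl) p q = inj₂ (to p , from q)
    where
    to : ∀ {u} → Via (x ∷ xs) u x → Via xs u x
    to (inj₁ p)       = p
    to (inj₂ (p , _)) = p
    from : ∀ {v} → Via (x ∷ xs) x v → Via xs x v
    from (inj₁ q)       = q
    from (inj₂ (_ , q)) = q
  via-trans (x ∷ xs) (there m∈) (inj₁ p)       (inj₁ q)       = inj₁ (via-trans xs m∈ p q)
  via-trans (x ∷ xs) (there m∈) (inj₁ p)       (inj₂ (q , r)) = inj₂ (via-trans xs m∈ p q , r)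
  via-trans (x ∷ xs) (there m∈) (inj₂ (p , q)) (inj₁ r)       = inj₂ (p , via-trans xs m∈ q r)
  via-trans (x ∷ xs) (there m∈) (inj₂ (p , _)) (inj₂ (_ , r)) = inj₂ (p , r)

  reachable⇒via : ∀ {u v} → Reachable H u v → Via (vertices H) u v
  reachable⇒via ε       = via-base (vertices H) (inj₁ refl)
  reachable⇒via (e ◅ p) =
    via-trans (vertices H) (complete _) (via-base (vertices H) (inj₂ e)) (reachable⇒via p)

  reachable? : ∀ u v → Dec (Reachable H u v)
  reachable? u v = map′ (via⇒reachable (vertices H)) reachable⇒via (via? (vertices H) u v)

  deleteEdge : Vertex H → Vertex H → Graph
  deleteEdge x y = record
    { Vertex     = Vertex H
    ; _≟_        = _≟_
    ; vertices   = vertices H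
    ; complete   = complete
    ; unique     = Graph.unique H
    ; adj        = λ u v → adj u v ∧ not (xy u v ∨ xy v u)
    ; adj-sym    = λ u v → cong₂ (λ a b → a ∧ not b) (adj-sym u v) (∨-comm (xy u v) (xy v u))
    ; adj-irrefl = λ v → cong (_∧ not (xy v v ∨ xy v v)) (adj-irrefl v)
    }
    where
    xy : Vertex H → Vertex H → Bool
    xy u v = does (u ≟ x) ∧ does (v ≟ y)

-- Number of edges of the component of H containing x.
componentSize : (H : Graph) → Vertex H → ℕ
componentSize H x =
  length (filter (λ (u , v) → reachable? H x u ×-dec reachable? H x v) (edges H))

------------------------------------------------------------------------
-- Simple random walk

module _ (H : Graph) where
  open Graph H using (_≟_; adj; degree; others)

  stationary : Vertex H → ℚ
  stationary j = fromℕ (degree j) ÷ℕ (2 ℕ.* size H)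

  transition : Vertex H → Vertex H → ℚ
  transition i j = if adj i j then 1ℚ ÷ℕ degree i else 0ℚ

  -- Probability that the walk started at i visits j at time n and at none
  -- of the times 1, …, n - 1.
  firstPassage : ℕ → Vertex H → Vertex H → ℚ
  firstPassage 0             i j = 0ℚ
  firstPassage 1             i j = transition i j
  firstPassage (suc (suc n)) i j = ∑ (others j) λ k → transition i k * firstPassage (suc n) k j

  -- ∑_{n ≤ N} n · P(first passage time from i to j is n)
  partialMean : Vertex H → Vertex H → ℕ → ℚ
  partialMean i j zero    = 0ℚ
  partialMean i j (suc N) = partialMean i j N + fromℕ (suc N) * firstPassage (suc N) i j

  -- The mean first passage times m_{i,j} for i ≢ j, that is, the expected
  -- first passage times, as sums of convergent series. Limits being unique,
  -- the off-diagonal values of `time` are determined by H; its diagonal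
  -- values are arbitrary, and nothing below depends on them.
  record MeanFirstPassage : Set where
    field
      time   : Vertex H → Vertex H → ℚ
      isMean : ∀ i j → i ≢ j → partialMean i j ⟶ time i j

open MeanFirstPassage public using (time)

-- The sum defining Kemeny's constant, computed from the starting vertex i.
kemeny : (H : Graph) → MeanFirstPassage H → Vertex H → ℚ
kemeny H m i = ∑ (Graph.others H i) λ j → stationary H j * time m i j

accessibility : (H : Graph) → MeanFirstPassage H → Vertex H → ℚ
accessibility H m v = ∑ (Graph.others H v) λ i → stationary H i * time m i v

------------------------------------------------------------------------
-- Chains of graphs

-- For an edge i ~ j of the tree, `at i j` is the end in G i (and `at j i` the
-- end in G j) of the bridge added for it. Values of `at` at non-adjacent i, j
-- are never used.
module Chain (𝒯 : Graph) (G : Vertex 𝒯 → Graph) (at : (i j : Vertex 𝒯) → Vertex (G i)) where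

  module 𝒯 = Graph 𝒯
  module G i = Graph (G i)

  V : Set
  V = Σ (Vertex 𝒯) λ i → Vertex (G i)

  internal : V → V → Bool
  internal (i , u) (j , v) with i 𝒯.≟ j
  ... | yes refl = G.adj i u v
  ... | no  _    = false

  bridge : V → V → Bool
  bridge (i , u) (j , v) =
    𝒯.adj i j ∧ (does (G._≟_ i u (at i j)) ∧ does (G._≟_ j v (at j i)))

  internal-sym : ∀ x y → internal x y ≡ internal y x
  internal-sym (i , u) (j , v) with i 𝒯.≟ j | j 𝒯.≟ i
  ... | yes refl | yes refl = G.adj-sym i u v
  ... | yes refl | no  i≢i  = contradiction refl i≢i
  ... | no  i≢i  | yes refl = contradiction refl i≢i
  ... | no  _    | no  _    = refl

  internal-irrefl : ∀ x → internal x x ≡ false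
  internal-irrefl (i , u) with i 𝒯.≟ i
  ... | yes refl = G.adj-irrefl i u
  ... | no  _    = refl

  bridge-sym : ∀ x y → bridge x y ≡ bridge y x
  bridge-sym (i , u) (j , v) = cong₂ _∧_ (𝒯.adj-sym i j) (∧-comm (does (G._≟_ i u (at i j))) _)

  bridge-irrefl : ∀ x → bridge x x ≡ false
  bridge-irrefl (i , u) = cong (_∧ _) (𝒯.adj-irrefl i)

  block : Vertex 𝒯 → List V
  block i = map (i ,_) (vertices (G i))

  blocks-unique : Unique (concatMap block (vertices 𝒯))
  blocks-unique = Uniqueₚ.concat⁺
    (Allₚ.map⁺ (All.universal
      (λ i → Uniqueₚ.map⁺ (λ { refl → refl }) (G.unique i)) (vertices 𝒯)))
    (AllPairsₚ.map⁺ (AllPairs.map disjoint 𝒯.unique))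
    where
    disjoint : ∀ {i j} → i ≢ j → ∀ {x} → ¬ (x ∈ block i × x ∈ block j)
    disjoint i≢j (x∈i , x∈j) with ∈-map⁻ _ x∈i | ∈-map⁻ _ x∈j
    ... | _ , _ , refl | _ , _ , eq = i≢j (,-injectiveˡ eq)

  chain : Graph
  chain = record
    { Vertex     = V
    ; _≟_        = ≡-dec 𝒯._≟_ (λ {i} → G._≟_ i)
    ; vertices   = concatMap block (vertices 𝒯)
    ; complete   = λ (i , u) → ∈-concatMap⁺ block
                     (Any.map (λ { refl → ∈-map⁺ (i ,_) (G.complete i u) }) (𝒯.complete i))
    ; unique     = blocks-unique
    ; adj        = λ x y → internal x y ∨ bridge x y
    ; adj-sym    = λ x y → cong₂ _∨_ (internal-sym x y) (bridge-sym x y)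
    ; adj-irrefl = λ x → cong₂ _∨_ (internal-irrefl x) (bridge-irrefl x)
    }

  -- Here x = (i , at i j) and y = (j , at j i) are the ends of the bridge of
  -- the edge i ~ j. Since x may also be an end of other bridges, W_x and its
  -- complement are indexed by the pair i, j rather than by x.
  W : Vertex 𝒯 → Vertex 𝒯 → ℕ
  W i j = componentSize (deleteEdge chain (i , at i j) (j , at j i)) (i , at i j)

  W̄ : Vertex 𝒯 → Vertex 𝒯 → ℚ
  W̄ i j = fromℕ (size chain) - fromℕ (W i j)

  -- The bridge with ends (i , at i j) and (j , at j i) is represented by the
  -- edge (i , j) of the tree.
  bridges : List (Vertex 𝒯 × Vertex 𝒯)
  bridges = edges 𝒯

  -- The ends in G i of bridges, one for each bridge: j stands for the end
  -- `at i j` of the bridge of i ~ j.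
  ends : Vertex 𝒯 → List (Vertex 𝒯)
  ends = Graph.neighbours 𝒯

{-# OPTIONS --safe #-}

-- The hitting times h_v(u) = m_{u,v}, with h_v(v) = 0, satisfy Lh_v = d − 2m·δ_v, where L is the graph
-- Laplacian and d the degree function. As L has only constant kernel on a connected graph, the
-- effective resistance R(u,v) = (m_{u,v} + m_{v,u})/2m equals ψ(u) − ψ(v) for every solution of
-- Lψ = δ_u − δ_v, and ∑ d(u) d(v) R(u,v) = 4m·κ.
--
-- In a chain every vertex u has a gate p_i(u) in each block G_i, and a potential of the chain is
-- obtained from potentials of the blocks, extended along the gates, and from the indicators of the
-- sides of the bridges. Hence R(u,v) is the sum of the R_i(p_i(u), p_i(v)) and of the number of
-- bridges separating u from v. The theorem results from summing this against d(u) d(v): the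
-- push-forward of d along p_i is d_i plus a mass 2W̄ at each end of a bridge, and the two sides of a
-- bridge have volumes 2W̄_x − 1 and 2W̄_y − 1.
module Submission where

open import Data.Bool.Base using (Bool; true; false; T; not; _∧_; _∨_; if_then_else_)
open import Data.Empty using (⊥-elim)
open import Data.Integer.Base as ℤ using () renaming (+_ to pos)
import Data.Integer.Properties as ℤₚ
open import Data.List.Base using (List; []; _∷_; _++_; _∷ʳ_; map; filter; concatMap; length)
open import Data.List.Membership.Propositional using (_∈_)
open import Data.List.Membership.Propositional.Properties using (∈-filter⁻; ∈-filter⁺)
open import Data.List.Relation.Unary.All as All using ([]; _∷_)
open import Data.List.Relation.Unary.All.Properties using (¬Any⇒All¬)
open import Data.List.Relation.Unary.AllPairs using ([]; _∷_)
open import Data.List.Relation.Unary.Any using (here; there; any?)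
open import Data.List.Relation.Unary.Linked as Linked using (Linked; [-]; _∷_)
open import Data.List.Relation.Unary.Unique.Propositional using (Unique)
open import Data.Nat.Base as ℕ using (ℕ; zero; suc)
import Data.Nat.Properties as ℕₚ
open import Data.Product.Base using (∃-syntax; _×_; _,_; proj₁; proj₂)
open import Data.Rational.Base hiding (*≡*; pos)
open import Data.Rational.Properties as ℚₚ using (+-*-commutativeRing)
open import Data.Rational.Unnormalised.Base as ℚᵘ using (mkℚᵘ; *≡*)
import Data.Rational.Unnormalised.Properties as ℚᵘₚ
open import Data.Sum.Base using (_⊎_; inj₁; inj₂)
open import Function.Base using (_∘_; case_of_)
open import Level using (0ℓ)
open import Relation.Binary.Construct.Closure.ReflexiveTransitive using (ε; _◅_; _◅◅_)
open import Relation.Binary.PropositionalEquality hiding ([_])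
open import Relation.Nullary using (¬_; Dec; yes; no; does; contradiction)
open import Relation.Nullary.Decidable
  using (T?; ¬?; _×-dec_; _⊎-dec_; dec-true; dec-false; dec⇒maybe; decidable-stable)
open import Relation.Unary using (Decidable)
open import Tactic.RingSolver using (solve-∀)
open import Tactic.RingSolver.Core.AlmostCommutativeRing using (AlmostCommutativeRing; fromCommutativeRing)
open import Defs

open ≡-Reasoning

-- Hitting times are available only as limits of series, so their Laplacian equation has to be
-- extracted from convergence. Conditioning the partial means on the first step brings in P(T ≤ n)
-- for the passage time T. Convergence of the means forces these probabilities to converge; their
-- limit is harmonic away from the target, and the triviality of the kernel makes it 1. This yields
-- the first-step equation away from the target, and at the target the equation is forced because
-- every Laplacian sums to 0. That the kernel is trivial follows from the energy, a sum of squares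
-- over the edges. Resistance replaces hitting times because any solution of the potential equation
-- computes it: a potential of the chain can be written down and verified instead of being solved
-- for. Gates enter through the functional taking φ to φ(p_i(u)), written with the indicators of the
-- sides of the bridges. In this form it is linear in φ, can be summed against degrees and has a
-- computable Laplacian; the vertex p_i(u) itself is found by carrying it along a walk.

ℚ-ring : AlmostCommutativeRing 0ℓ 0ℓ
ℚ-ring = fromCommutativeRing +-*-commutativeRing (λ p → dec⇒maybe (0ℚ ℚₚ.≟ p))

-- Indicators as rational numbers

𝟙 : Bool → ℚ
𝟙 b = if b then 1ℚ else 0ℚ

𝟙-∧ : ∀ b c → 𝟙 (b ∧ c) ≡ 𝟙 b * 𝟙 c
𝟙-∧ true  c = sym (ℚₚ.*-identityˡ (𝟙 c))
𝟙-∧ false c = sym (ℚₚ.*-zeroˡ (𝟙 c))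

𝟙-idem : ∀ b → 𝟙 b * 𝟙 b ≡ 𝟙 b
𝟙-idem true  = refl
𝟙-idem false = refl

-- Lets a fact about adjacent vertices be used under a sum over all pairs, where adjacency appears
-- only as a factor 0 or 1.
𝟙-cong : ∀ b {p q} → (T b → p ≡ q) → 𝟙 b * p ≡ 𝟙 b * q
𝟙-cong true  p≡q = cong (1ℚ *_) (p≡q _)
𝟙-cong false {p} {q} _ = trans (ℚₚ.*-zeroˡ p) (sym (ℚₚ.*-zeroˡ q))

𝟙-nonNeg : ∀ b → 0ℚ ≤ 𝟙 b
𝟙-nonNeg true  = ℚₚ.<⇒≤ (ℚₚ.positive⁻¹ 1ℚ)
𝟙-nonNeg false = ℚₚ.≤-refl

if-𝟙 : ∀ b p → (if b then p else 0ℚ) ≡ 𝟙 b * p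
if-𝟙 true  p = sym (ℚₚ.*-identityˡ p)
if-𝟙 false p = sym (ℚₚ.*-zeroˡ p)

⟦_⟧ : {P : Set} → Dec P → ℚ
⟦ p? ⟧ = 𝟙 (does p?)

⟦⟧-yes : {P : Set} (p? : Dec P) → P → ⟦ p? ⟧ ≡ 1ℚ
⟦⟧-yes p? p = cong 𝟙 (dec-true p? p)

⟦⟧-no : {P : Set} (p? : Dec P) → ¬ P → ⟦ p? ⟧ ≡ 0ℚ
⟦⟧-no p? ¬p = cong 𝟙 (dec-false p? ¬p)

⟦⟧-⇔ : {P Q : Set} (p? : Dec P) (q? : Dec Q) → (P → Q) → (Q → P) → ⟦ p? ⟧ ≡ ⟦ q? ⟧
⟦⟧-⇔ (yes p) q? f g = sym (⟦⟧-yes q? (f p))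
⟦⟧-⇔ (no ¬p) q? f g = sym (⟦⟧-no q? (¬p ∘ g))

⟦⟧-cong : {P : Set} (p? : Dec P) {x y : ℚ} → (P → x ≡ y) → ⟦ p? ⟧ * x ≡ ⟦ p? ⟧ * y
⟦⟧-cong (yes p) x≡y = cong (1ℚ *_) (x≡y p)
⟦⟧-cong (no _) {x} {y} _ = trans (ℚₚ.*-zeroˡ x) (sym (ℚₚ.*-zeroˡ y))

x-y≡0⇒x≡y : ∀ {x y} → x - y ≡ 0ℚ → x ≡ y
x-y≡0⇒x≡y {x} {y} eq = trans (lemma x y) (trans (cong (_+ y) eq) (ℚₚ.+-identityˡ y))
  where
  lemma : ∀ x y → x ≡ (x - y) + y
  lemma = solve-∀ ℚ-ring

-- Finite sums

module _ {A : Set} where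

  ∑-cong : ∀ (xs : List A) {f g : A → ℚ} → (∀ x → f x ≡ g x) → ∑ xs f ≡ ∑ xs g
  ∑-cong []       f≡g = refl
  ∑-cong (x ∷ xs) f≡g = cong₂ _+_ (f≡g x) (∑-cong xs f≡g)

  ∑-zero : ∀ (xs : List A) → ∑ xs (λ _ → 0ℚ) ≡ 0ℚ
  ∑-zero []       = refl
  ∑-zero (x ∷ xs) = trans (ℚₚ.+-identityˡ _) (∑-zero xs)

  ∑-+ : ∀ (xs : List A) (f g : A → ℚ) → ∑ xs (λ x → f x + g x) ≡ ∑ xs f + ∑ xs g
  ∑-+ []       f g = refl
  ∑-+ (x ∷ xs) f g = trans (cong ((f x + g x) +_) (∑-+ xs f g)) (lemma (f x) (g x) (∑ xs f) (∑ xs g))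
    where
    lemma : ∀ a b c d → (a + b) + (c + d) ≡ (a + c) + (b + d)
    lemma = solve-∀ ℚ-ring

  ∑-*ˡ : ∀ (xs : List A) c (f : A → ℚ) → ∑ xs (λ x → c * f x) ≡ c * ∑ xs f
  ∑-*ˡ []       c f = sym (ℚₚ.*-zeroʳ c)
  ∑-*ˡ (x ∷ xs) c f = trans (cong (c * f x +_) (∑-*ˡ xs c f)) (sym (ℚₚ.*-distribˡ-+ c _ _))

  ∑-*ʳ : ∀ (xs : List A) c (f : A → ℚ) → ∑ xs (λ x → f x * c) ≡ ∑ xs f * c
  ∑-*ʳ xs c f = trans (∑-cong xs (λ x → ℚₚ.*-comm (f x) c)) (trans (∑-*ˡ xs c f) (ℚₚ.*-comm c _))

  ∑-neg : ∀ (xs : List A) (f : A → ℚ) → ∑ xs (λ x → - f x) ≡ - ∑ xs f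
  ∑-neg []       f = refl
  ∑-neg (x ∷ xs) f = trans (cong (- f x +_) (∑-neg xs f)) (sym (ℚₚ.neg-distrib-+ (f x) _))

  ∑-sub : ∀ (xs : List A) (f g : A → ℚ) → ∑ xs (λ x → f x - g x) ≡ ∑ xs f - ∑ xs g
  ∑-sub xs f g = trans (∑-+ xs f (λ x → - g x)) (cong (_+_ (∑ xs f)) (∑-neg xs g))

  ∑-++ : ∀ (xs ys : List A) (f : A → ℚ) → ∑ (xs ++ ys) f ≡ ∑ xs f + ∑ ys f
  ∑-++ []       ys f = sym (ℚₚ.+-identityˡ _)
  ∑-++ (x ∷ xs) ys f = trans (cong (f x +_) (∑-++ xs ys f)) (sym (ℚₚ.+-assoc (f x) _ _))

  ∑-filter : ∀ {P : A → Set} (P? : Decidable P) (xs : List A) (f : A → ℚ) →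
             ∑ (filter P? xs) f ≡ ∑ xs (λ x → ⟦ P? x ⟧ * f x)
  ∑-filter P? []       f = refl
  ∑-filter P? (x ∷ xs) f with P? x
  ... | yes _ = cong₂ _+_ (sym (ℚₚ.*-identityˡ (f x))) (∑-filter P? xs f)
  ... | no  _ = trans (∑-filter P? xs f)
                  (sym (trans (cong (_+ _) (ℚₚ.*-zeroˡ (f x))) (ℚₚ.+-identityˡ _)))

  ∑-vanish : ∀ (xs : List A) {f : A → ℚ} → (∀ {x} → x ∈ xs → f x ≡ 0ℚ) → ∑ xs f ≡ 0ℚ
  ∑-vanish []       f≡0 = refl
  ∑-vanish (x ∷ xs) f≡0 =
    trans (cong₂ _+_ (f≡0 (here refl)) (∑-vanish xs (f≡0 ∘ there))) (ℚₚ.+-identityˡ 0ℚ)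

  ∑-single : ∀ {xs : List A} {v} {f : A → ℚ} → Unique xs → v ∈ xs →
             (∀ {x} → x ≢ v → f x ≡ 0ℚ) → ∑ xs f ≡ f v
  ∑-single {x ∷ xs} {f = f} (x∉ ∷ _) (here refl) f≡0 =
    trans (cong (f x +_) (∑-vanish xs (λ y∈ → f≡0 (λ { refl → All.lookup x∉ y∈ refl }))))
          (ℚₚ.+-identityʳ _)
  ∑-single {x ∷ xs} (x∉ ∷ u) (there v∈) f≡0 =
    trans (cong₂ _+_ (f≡0 (All.lookup x∉ v∈)) (∑-single u v∈ f≡0)) (ℚₚ.+-identityˡ _)

  ∑-nonNeg : ∀ (xs : List A) {f : A → ℚ} → (∀ x → 0ℚ ≤ f x) → 0ℚ ≤ ∑ xs f
  ∑-nonNeg []       f≥0 = ℚₚ.≤-refl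
  ∑-nonNeg (x ∷ xs) f≥0 = ℚₚ.+-mono-≤ (f≥0 x) (∑-nonNeg xs f≥0)

  term≤∑ : ∀ {xs : List A} {v} {f : A → ℚ} → (∀ x → 0ℚ ≤ f x) → v ∈ xs → f v ≤ ∑ xs f
  term≤∑ {x ∷ xs} {f = f} f≥0 (here refl) =
    ℚₚ.≤-trans (ℚₚ.≤-reflexive (sym (ℚₚ.+-identityʳ (f x)))) (ℚₚ.+-monoʳ-≤ (f x) (∑-nonNeg xs f≥0))
  term≤∑ {x ∷ xs} {f = f} f≥0 (there v∈) =
    ℚₚ.≤-trans (term≤∑ f≥0 v∈)
      (ℚₚ.≤-trans (ℚₚ.≤-reflexive (sym (ℚₚ.+-identityˡ _))) (ℚₚ.+-monoˡ-≤ _ (f≥0 x)))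

  ∑≡0⇒term≡0 : ∀ {xs : List A} {v} {f : A → ℚ} → (∀ x → 0ℚ ≤ f x) → ∑ xs f ≡ 0ℚ →
               v ∈ xs → f v ≡ 0ℚ
  ∑≡0⇒term≡0 {v = v} f≥0 ∑≡0 v∈ =
    ℚₚ.≤-antisym (ℚₚ.≤-trans (term≤∑ f≥0 v∈) (ℚₚ.≤-reflexive ∑≡0)) (f≥0 v)

∑-swap : {A B : Set} (xs : List A) (ys : List B) (f : A → B → ℚ) →
         ∑ xs (λ x → ∑ ys (f x)) ≡ ∑ ys (λ y → ∑ xs (λ x → f x y))
∑-swap []       ys f = sym (∑-zero ys)
∑-swap (x ∷ xs) ys f =
  trans (cong (∑ ys (f x) +_) (∑-swap xs ys f)) (sym (∑-+ ys (f x) _))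

∑-map : {A B : Set} (g : A → B) (xs : List A) (f : B → ℚ) → ∑ (map g xs) f ≡ ∑ xs (f ∘ g)
∑-map g []       f = refl
∑-map g (x ∷ xs) f = cong (f (g x) +_) (∑-map g xs f)

∑-concatMap : {A B : Set} (g : A → List B) (xs : List A) (f : B → ℚ) →
              ∑ (concatMap g xs) f ≡ ∑ xs (λ x → ∑ (g x) f)
∑-concatMap g []       f = refl
∑-concatMap g (x ∷ xs) f =
  trans (∑-++ (g x) (concatMap g xs) f) (cong (∑ (g x) f +_) (∑-concatMap g xs f))

∑-pairs : {A : Set} (xs : List A) (f : A → A → ℚ) →
          ∑ xs (λ x → ∑ xs (f x)) ≡ ∑ (pairs xs) (λ (x , y) → f x y + f y x) + ∑ xs (λ x → f x x)
∑-pairs []       f = refl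
∑-pairs (x ∷ xs) f = begin
  (f x x + ∑ xs (f x)) + ∑ xs (λ y → f y x + ∑ xs (f y))
    ≡⟨ cong (_+_ (f x x + ∑ xs (f x)))
         (trans (∑-+ xs (λ y → f y x) (λ y → ∑ xs (f y))) (cong (∑ xs (λ y → f y x) +_) (∑-pairs xs f))) ⟩
  (f x x + ∑ xs (f x)) + (∑ xs (λ y → f y x) + (P + D))
    ≡⟨ lemma (f x x) (∑ xs (f x)) (∑ xs (λ y → f y x)) P D ⟩
  ((∑ xs (f x) + ∑ xs (λ y → f y x)) + P) + (f x x + D)
    ≡⟨ cong (λ z → (z + P) + (f x x + D)) (∑-+ xs (f x) (λ y → f y x)) ⟨
  (∑ xs (λ y → f x y + f y x) + P) + (f x x + D)
    ≡⟨ cong (λ z → (z + P) + (f x x + D)) (∑-map (x ,_) xs g) ⟨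
  (∑ (map (x ,_) xs) g + P) + (f x x + D)
    ≡⟨ cong (_+ (f x x + D)) (∑-++ (map (x ,_) xs) (pairs xs) g) ⟨
  ∑ (pairs (x ∷ xs)) g + (f x x + D) ∎
  where
  g = λ (x , y) → f x y + f y x
  P = ∑ (pairs xs) g
  D = ∑ xs (λ y → f y y)
  lemma : ∀ a b c p d → (a + b) + (c + (p + d)) ≡ ((b + c) + p) + (a + d)
  lemma = solve-∀ ℚ-ring

-- Natural numbers and quotients

-- `fromℕ n` unfolds to `fromℚᵘ` of the fraction n/1, so identities about it can be checked on
-- unnormalised fractions, where they are integer equations free of gcds.
fromℚᵘ-homo-+ : ∀ p q → fromℚᵘ (p ℚᵘ.+ q) ≡ fromℚᵘ p + fromℚᵘ q
fromℚᵘ-homo-+ p q = ℚₚ.toℚᵘ-injective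
  (ℚᵘₚ.≃-trans (ℚₚ.toℚᵘ-fromℚᵘ (p ℚᵘ.+ q))
    (ℚᵘₚ.≃-sym (ℚᵘₚ.≃-trans (ℚₚ.toℚᵘ-homo-+ (fromℚᵘ p) (fromℚᵘ q))
      (ℚᵘₚ.+-cong (ℚₚ.toℚᵘ-fromℚᵘ p) (ℚₚ.toℚᵘ-fromℚᵘ q)))))

fromℚᵘ-homo-* : ∀ p q → fromℚᵘ (p ℚᵘ.* q) ≡ fromℚᵘ p * fromℚᵘ q
fromℚᵘ-homo-* p q = ℚₚ.toℚᵘ-injective
  (ℚᵘₚ.≃-trans (ℚₚ.toℚᵘ-fromℚᵘ (p ℚᵘ.* q))
    (ℚᵘₚ.≃-sym (ℚᵘₚ.≃-trans (ℚₚ.toℚᵘ-homo-* (fromℚᵘ p) (fromℚᵘ q))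
      (ℚᵘₚ.*-cong (ℚₚ.toℚᵘ-fromℚᵘ p) (ℚₚ.toℚᵘ-fromℚᵘ q)))))

fromℕ-+ : ∀ m n → fromℕ (m ℕ.+ n) ≡ fromℕ m + fromℕ n
fromℕ-+ m n = trans
  (ℚₚ.fromℚᵘ-cong {mkℚᵘ (pos (m ℕ.+ n)) 0} {mkℚᵘ (pos m) 0 ℚᵘ.+ mkℚᵘ (pos n) 0}
    (*≡* (cong (ℤ._* pos 1) (sym (cong₂ ℤ._+_ (ℤₚ.*-identityʳ (pos m)) (ℤₚ.*-identityʳ (pos n)))))))
  (fromℚᵘ-homo-+ (mkℚᵘ (pos m) 0) (mkℚᵘ (pos n) 0))

fromℕ-length : ∀ {A : Set} (xs : List A) → fromℕ (length xs) ≡ ∑ xs (λ _ → 1ℚ)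
fromℕ-length []       = refl
fromℕ-length (x ∷ xs) = trans (fromℕ-+ 1 (length xs)) (cong (_+_ 1ℚ) (fromℕ-length xs))

fromℕ-* : ∀ m n → fromℕ (m ℕ.* n) ≡ fromℕ m * fromℕ n
fromℕ-* m n = trans
  (ℚₚ.fromℚᵘ-cong {mkℚᵘ (pos (m ℕ.* n)) 0} {mkℚᵘ (pos m) 0 ℚᵘ.* mkℚᵘ (pos n) 0}
    (*≡* (cong (ℤ._* pos 1) (ℤₚ.pos-* m n))))
  (fromℚᵘ-homo-* (mkℚᵘ (pos m) 0) (mkℚᵘ (pos n) 0))

÷ℕ-* : ∀ q n → q ÷ℕ n ≡ q * (1ℚ ÷ℕ n)
÷ℕ-* q zero    = sym (ℚₚ.*-zeroʳ q)
÷ℕ-* q (suc n) = cong (q *_) (sym (ℚₚ.*-identityˡ _))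

fromℕ-inverse : ∀ n → 1 ℕ.≤ n → fromℕ n * (1ℚ ÷ℕ n) ≡ 1ℚ
fromℕ-inverse (suc n) _ = begin
  fromℕ (suc n) * (1ℚ * (pos 1 / suc n))  ≡⟨ cong (fromℕ (suc n) *_) (ℚₚ.*-identityˡ (pos 1 / suc n)) ⟩
  fromℕ (suc n) * (pos 1 / suc n)         ≡⟨ fromℚᵘ-homo-* (mkℚᵘ (pos (suc n)) 0) (mkℚᵘ (pos 1) n) ⟨
  fromℚᵘ (mkℚᵘ (pos (suc n)) 0 ℚᵘ.* mkℚᵘ (pos 1) n)
    ≡⟨ ℚₚ.fromℚᵘ-cong {mkℚᵘ (pos (suc n)) 0 ℚᵘ.* mkℚᵘ (pos 1) n} {mkℚᵘ (pos 1) 0} (*≡* (trans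
         (ℤₚ.*-identityʳ _)
         (trans (ℤₚ.*-identityʳ (pos (suc n)))
           (sym (trans (ℤₚ.*-identityˡ (pos (suc n ℕ.+ 0))) (cong pos (ℕₚ.+-identityʳ (suc n)))))))) ⟩
  1ℚ ∎

-- The zero cases follow the convention for division by 0, so the weights in the formula can be
-- factored without knowing that a block has an edge.
1÷ℕ-* : ∀ m n → 1ℚ ÷ℕ (m ℕ.* n) ≡ (1ℚ ÷ℕ m) * (1ℚ ÷ℕ n)
1÷ℕ-* zero        n       = sym (ℚₚ.*-zeroˡ (1ℚ ÷ℕ n))
1÷ℕ-* m@(suc _)   zero    = trans (cong (1ℚ ÷ℕ_) (ℕₚ.*-zeroʳ m)) (sym (ℚₚ.*-zeroʳ (1ℚ ÷ℕ m)))
1÷ℕ-* m@(suc _) n@(suc _) = begin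
  1/mn                                           ≡⟨ lemma₁ 1/mn ⟩
  1ℚ * 1ℚ * 1/mn
    ≡⟨ cong₂ (λ x y → x * y * 1/mn) (fromℕ-inverse m (ℕ.s≤s ℕ.z≤n)) (fromℕ-inverse n (ℕ.s≤s ℕ.z≤n)) ⟨
  (fromℕ m * 1/m) * (fromℕ n * 1/n) * 1/mn       ≡⟨ lemma₂ (fromℕ m) 1/m (fromℕ n) 1/n 1/mn ⟩
  1/m * 1/n * ((fromℕ m * fromℕ n) * 1/mn)
    ≡⟨ cong (λ x → 1/m * 1/n * (x * 1/mn)) (fromℕ-* m n) ⟨
  1/m * 1/n * (fromℕ (m ℕ.* n) * 1/mn)
    ≡⟨ cong (1/m * 1/n *_) (fromℕ-inverse (m ℕ.* n) (ℕ.s≤s ℕ.z≤n)) ⟩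
  1/m * 1/n * 1ℚ                                 ≡⟨ ℚₚ.*-identityʳ (1/m * 1/n) ⟩
  1/m * 1/n                                      ∎
  where
  1/m 1/n 1/mn : ℚ
  1/m  = 1ℚ ÷ℕ m
  1/n  = 1ℚ ÷ℕ n
  1/mn = 1ℚ ÷ℕ (m ℕ.* n)
  lemma₁ : ∀ x → x ≡ 1ℚ * 1ℚ * x
  lemma₁ = solve-∀ ℚ-ring
  lemma₂ : ∀ a b c d e → (a * b) * (c * d) * e ≡ b * d * ((a * c) * e)
  lemma₂ = solve-∀ ℚ-ring

-- Limits

-- Convergence as a record: _⟶_ unfolds, so that its arguments would not be inferred.
record _⇢_ (s : ℕ → ℚ) (q : ℚ) : Set where
  constructor lim
  field
    limit : s ⟶ q

open _⇢_

⇢-ext : ∀ {s t q} → (∀ n → s n ≡ t n) → s ⇢ q → t ⇢ q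
⇢-ext {q = q} s≡t (lim s⟶q) = lim λ η η>0 →
  let N , P = s⟶q η η>0 in
  N , λ n N≤n → subst (λ x → ∣ x - q ∣ < η) (s≡t n) (P n N≤n)

⇢-const : ∀ q → (λ _ → q) ⇢ q
⇢-const q = lim λ η η>0 → 0 , λ _ _ → subst (λ x → ∣ x ∣ < η) (sym (ℚₚ.+-inverseʳ q)) η>0

⇢-+ : ∀ {s t p q} → s ⇢ p → t ⇢ q → (λ n → s n + t n) ⇢ (p + q)
⇢-+ {s} {t} {p} {q} (lim s⟶p) (lim t⟶q) = lim λ η η>0 →
  let M , P = s⟶p (½ * η) (½η>0 η>0)
      N , Q = t⟶q (½ * η) (½η>0 η>0)
  in M ℕ.⊔ N , λ n MN≤n →
    subst₂ _<_ (cong ∣_∣ (sym (regroup (s n) (t n) p q))) (halves η)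
      (ℚₚ.≤-<-trans (ℚₚ.∣p+q∣≤∣p∣+∣q∣ (s n - p) (t n - q))
        (ℚₚ.+-mono-< (P n (ℕₚ.≤-trans (ℕₚ.m≤m⊔n M N) MN≤n))
                     (Q n (ℕₚ.≤-trans (ℕₚ.m≤n⊔m M N) MN≤n))))
  where
  ½η>0 : ∀ {η} → 0ℚ < η → 0ℚ < ½ * η
  ½η>0 {η} η>0 = subst (_< ½ * η) (ℚₚ.*-zeroʳ ½) (ℚₚ.*-monoʳ-<-pos ½ η>0)
  regroup : ∀ a b c d → (a + b) - (c + d) ≡ (a - c) + (b - d)
  regroup = solve-∀ ℚ-ring
  halves : ∀ x → ½ * x + ½ * x ≡ x
  halves x = trans (sym (ℚₚ.*-distribʳ-+ x ½ ½)) (ℚₚ.*-identityˡ x)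

⇢-* : ∀ c {s q} → s ⇢ q → (λ n → c * s n) ⇢ (c * q)
⇢-* c {s} {q} (lim s⟶q) = lim λ η η>0 →
  let N , P = s⟶q (1/b * η) (η′>0 η>0) in N , λ n N≤n → step n (P n N≤n)
  where
  -- The added 1 keeps the divisor positive when `c` is 0; the tolerance used for `s` is η / (1 +
  -- ∣c∣).
  b = 1ℚ + ∣ c ∣
  b>0 : 0ℚ < b
  b>0 = ℚₚ.<-≤-trans (ℚₚ.positive⁻¹ 1ℚ)
    (subst (_≤ b) (ℚₚ.+-identityʳ 1ℚ) (ℚₚ.+-monoʳ-≤ 1ℚ (ℚₚ.0≤∣p∣ c)))
  instance
    b-pos : Positive b
    b-pos = positive b>0
    b-nonZero : NonZero b
    b-nonZero = ℚₚ.pos⇒nonZero b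
  1/b = 1/ b
  η′>0 : ∀ {η} → 0ℚ < η → 0ℚ < 1/b * η
  η′>0 {η} η>0 = subst (_< 1/b * η) (ℚₚ.*-zeroʳ 1/b)
    (ℚₚ.*-monoʳ-<-pos 1/b {{ℚₚ.1/pos⇒pos b}} η>0)
  step : ∀ {η} n → ∣ s n - q ∣ < 1/b * η → ∣ c * s n - c * q ∣ < η
  step {η} n d<η′ = ℚₚ.≤-<-trans
    (subst₂ _≤_ (trans (sym (ℚₚ.∣p*q∣≡∣p∣*∣q∣ c (s n - q))) (cong ∣_∣ (distr c (s n) q))) refl
      (ℚₚ.*-monoʳ-≤-nonNeg ∣ s n - q ∣ {{ℚₚ.∣-∣-nonNeg (s n - q)}} ∣c∣≤b))
    (subst (b * ∣ s n - q ∣ <_) (trans (sym (ℚₚ.*-assoc b 1/b η))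
        (trans (cong (_* η) (ℚₚ.*-inverseʳ b)) (ℚₚ.*-identityˡ η)))
      (ℚₚ.*-monoʳ-<-pos b d<η′))
    where
    distr : ∀ x y z → x * (y - z) ≡ x * y - x * z
    distr = solve-∀ ℚ-ring
    ∣c∣≤b : ∣ c ∣ ≤ b
    ∣c∣≤b = subst (_≤ b) (ℚₚ.+-identityˡ ∣ c ∣) (ℚₚ.+-monoˡ-≤ ∣ c ∣ (𝟙-nonNeg true))

⇢-sub : ∀ {s t p q} → s ⇢ p → t ⇢ q → (λ n → s n - t n) ⇢ (p - q)
⇢-sub {s} {t} {p} {q} s⇢p t⇢q =
  subst ((λ n → s n - t n) ⇢_) (lemma p q)
    (⇢-ext (λ n → lemma (s n) (t n)) (⇢-+ s⇢p (⇢-* (- 1ℚ) t⇢q)))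
  where
  lemma : ∀ x y → x + - 1ℚ * y ≡ x - y
  lemma = solve-∀ ℚ-ring

⇢-∑ : ∀ {A : Set} (xs : List A) {s : A → ℕ → ℚ} {q} → (∀ {x} → x ∈ xs → s x ⇢ q x) →
      (λ n → ∑ xs (λ x → s x n)) ⇢ ∑ xs q
⇢-∑ []       _   = ⇢-const 0ℚ
⇢-∑ (x ∷ xs) s⇢q = ⇢-+ (s⇢q (here refl)) (⇢-∑ xs (s⇢q ∘ there))

⇢-tail : ∀ {s q} → s ⇢ q → (s ∘ suc) ⇢ q
⇢-tail (lim s⟶q) = lim λ η η>0 → let N , P = s⟶q η η>0 in N , λ n N≤n → P (suc n) (ℕₚ.m≤n⇒m≤1+n N≤n)

⇢-untail : ∀ {s q} → (s ∘ suc) ⇢ q → s ⇢ q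
⇢-untail (lim s⟶q) = lim λ η η>0 → let N , P = s⟶q η η>0 in suc N , λ { (suc n) (ℕ.s≤s N≤n) → P n N≤n }

-- The constant sequence 0 converges to p - q; were p - q nonzero, the tolerance ∣p - q∣ would give
-- ∣p - q∣ < ∣p - q∣. Equality of rationals is decidable, so refuting p - q ≢ 0 suffices.
⇢-unique : ∀ {s p q} → s ⇢ p → s ⇢ q → p ≡ q
⇢-unique {s} {p} {q} s⇢p s⇢q = x-y≡0⇒x≡y (decidable-stable (p - q ℚₚ.≟ 0ℚ) λ d≢0 →
  let N , P = limit 0⇢d ∣ p - q ∣ (ℚₚ.≰⇒> λ ∣d∣≤0 →
        d≢0 (ℚₚ.∣p∣≡0⇒p≡0 _ (ℚₚ.≤-antisym ∣d∣≤0 (ℚₚ.0≤∣p∣ (p - q)))))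
  in ℚₚ.<-irrefl (trans (cong ∣_∣ (ℚₚ.+-identityˡ (- (p - q)))) (ℚₚ.∣-p∣≡∣p∣ (p - q)))
       (P N ℕₚ.≤-refl))
  where
  0⇢d : (λ _ → 0ℚ) ⇢ (p - q)
  0⇢d = ⇢-ext (λ n → ℚₚ.+-inverseʳ (s n)) (⇢-sub s⇢p s⇢q)

-- The Laplacian

*-nonNeg : ∀ {x y} → 0ℚ ≤ x → 0ℚ ≤ y → 0ℚ ≤ x * y
*-nonNeg {x} {y} x≥0 y≥0 =
  subst (_≤ x * y) (ℚₚ.*-zeroʳ x) (ℚₚ.*-monoˡ-≤-nonNeg x {{nonNegative x≥0}} y≥0)

x*x≥0 : ∀ x → 0ℚ ≤ x * x
x*x≥0 x with ℚₚ.≤-total 0ℚ x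
... | inj₁ x≥0 = *-nonNeg x≥0 x≥0
... | inj₂ x≤0 = subst (0ℚ ≤_) (lemma x) (*-nonNeg (ℚₚ.neg-antimono-≤ x≤0) (ℚₚ.neg-antimono-≤ x≤0))
  where
  lemma : ∀ x → - x * - x ≡ x * x
  lemma = solve-∀ ℚ-ring

x*x≡0⇒x≡0 : ∀ {x} → x * x ≡ 0ℚ → x ≡ 0ℚ
x*x≡0⇒x≡0 {x} x*x≡0 = decidable-stable (x ℚₚ.≟ 0ℚ) λ x≢0 →
  let instance _ = ≢-nonZero x≢0 in
  x≢0 (begin
    x                ≡⟨ ℚₚ.*-identityˡ x ⟨
    1ℚ * x           ≡⟨ cong (_* x) (ℚₚ.*-inverseˡ x) ⟨
    1/ x * x * x     ≡⟨ ℚₚ.*-assoc (1/ x) x x ⟩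
    1/ x * (x * x)   ≡⟨ cong (1/ x *_) x*x≡0 ⟩
    1/ x * 0ℚ        ≡⟨ ℚₚ.*-zeroʳ (1/ x) ⟩
    0ℚ               ∎)

module Network (H : Graph) where
  open Graph H using (_≟_; adj; adj-sym; adj-irrefl; complete; unique; _~_; degree; others)

  infix 5 ∑ᵥ
  ∑ᵥ : (Vertex H → ℚ) → ℚ
  ∑ᵥ = ∑ (vertices H)

  A : Vertex H → Vertex H → ℚ
  A u v = 𝟙 (adj u v)

  δ : Vertex H → Vertex H → ℚ
  δ u v = ⟦ u ≟ v ⟧

  deg : Vertex H → ℚ
  deg u = ∑ᵥ (A u)

  vol : ℚ
  vol = ∑ᵥ deg

  Lap : (Vertex H → ℚ) → Vertex H → ℚ
  Lap f u = ∑ᵥ λ v → A u v * (f u - f v)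

  A-sym : ∀ u v → A u v ≡ A v u
  A-sym u v = cong 𝟙 (adj-sym u v)

  δ-sym : ∀ u v → δ u v ≡ δ v u
  δ-sym u v = ⟦⟧-⇔ (u ≟ v) (v ≟ u) sym sym

  δ-refl : ∀ u → δ u u ≡ 1ℚ
  δ-refl u = ⟦⟧-yes (u ≟ u) refl

  ∑ᵥ-single : ∀ v {f} → (∀ {u} → u ≢ v → f u ≡ 0ℚ) → ∑ᵥ f ≡ f v
  ∑ᵥ-single v = ∑-single unique (complete v)

  ∑ᵥ-δ : ∀ v (f : Vertex H → ℚ) → ∑ᵥ (λ u → δ u v * f u) ≡ f v
  ∑ᵥ-δ v f = begin
    ∑ᵥ (λ u → δ u v * f u) ≡⟨ ∑ᵥ-single v (λ {u} u≢v →
                                trans (cong (_* f u) (⟦⟧-no (u ≟ v) u≢v)) (ℚₚ.*-zeroˡ (f u))) ⟩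
    δ v v * f v            ≡⟨ cong (_* f v) (δ-refl v) ⟩
    1ℚ * f v               ≡⟨ ℚₚ.*-identityˡ (f v) ⟩
    f v                    ∎

  ∑-neighbours : ∀ v f → ∑ (Graph.neighbours H v) f ≡ ∑ᵥ (λ u → A v u * f u)
  ∑-neighbours v f = ∑-filter (λ u → T? (adj v u)) (vertices H) f

  ∑-others : ∀ v {f g} → g v ≡ 0ℚ → (∀ {u} → u ≢ v → f u ≡ g u) → ∑ (others v) f ≡ ∑ᵥ g
  ∑-others v {f} {g} gv≡0 f≡g =
    trans (∑-filter (λ u → ¬? (u ≟ v)) (vertices H) f) (∑-cong (vertices H) step)
    where
    step : ∀ u → ⟦ ¬? (u ≟ v) ⟧ * f u ≡ g u
    step u with u ≟ v
    ... | yes refl = trans (ℚₚ.*-zeroˡ (f u)) (sym gv≡0)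
    ... | no u≢v   = trans (ℚₚ.*-identityˡ (f u)) (f≡g u≢v)

  fromℕ-degree : ∀ v → fromℕ (degree v) ≡ deg v
  fromℕ-degree v = begin
    fromℕ (degree v)                      ≡⟨ fromℕ-length (Graph.neighbours H v) ⟩
    ∑ (Graph.neighbours H v) (λ _ → 1ℚ)   ≡⟨ ∑-neighbours v (λ _ → 1ℚ) ⟩
    ∑ᵥ (λ u → A v u * 1ℚ)                 ≡⟨ ∑-cong (vertices H) (λ u → ℚₚ.*-identityʳ (A v u)) ⟩
    deg v                                 ∎

  -- `edges` lists an edge in one orientation, a double sum over adjacency meets both, and the
  -- diagonal disappears by irreflexivity. This links edge counts with volumes and, in the tree,
  -- bridges with ordered pairs of adjacent blocks.
  ∑-edges : ∀ (f : Vertex H → Vertex H → ℚ) → ∑ᵥ (λ u → ∑ᵥ (λ v → A u v * f u v)) ≡ ∑ (edges H) (λ (u , v) → f u v + f v u)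
  ∑-edges f = begin
    ∑ᵥ (λ u → ∑ᵥ (λ v → A u v * f u v))
      ≡⟨ ∑-pairs (vertices H) (λ u v → A u v * f u v) ⟩
    ∑ (pairs (vertices H)) (λ (u , v) → A u v * f u v + A v u * f v u) + ∑ᵥ (λ u → A u u * f u u)
      ≡⟨ cong₂ _+_ (∑-cong (pairs (vertices H)) (λ (u , v) → off-diagonal u v))
           (trans (∑-cong (vertices H) diagonal) (∑-zero (vertices H))) ⟩
    ∑ (pairs (vertices H)) (λ (u , v) → A u v * (f u v + f v u)) + 0ℚ
      ≡⟨ ℚₚ.+-identityʳ _ ⟩
    ∑ (pairs (vertices H)) (λ (u , v) → A u v * (f u v + f v u))
      ≡⟨ ∑-filter (λ (u , v) → T? (adj u v)) (pairs (vertices H)) (λ (u , v) → f u v + f v u) ⟨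
    ∑ (edges H) (λ (u , v) → f u v + f v u) ∎
    where
    diagonal : ∀ u → A u u * f u u ≡ 0ℚ
    diagonal u = trans (cong (λ b → 𝟙 b * f u u) (adj-irrefl u)) (ℚₚ.*-zeroˡ (f u u))
    off-diagonal : ∀ u v → A u v * f u v + A v u * f v u ≡ A u v * (f u v + f v u)
    off-diagonal u v = trans (cong (λ a → A u v * f u v + a * f v u) (A-sym v u))
      (sym (ℚₚ.*-distribˡ-+ (A u v) (f u v) (f v u)))

  ∑-edges-cong : ∀ (f g : Vertex H → Vertex H → ℚ) → (∀ {u v} → u ~ v → f u v ≡ g u v) →
                 ∑ (edges H) (λ (u , v) → f u v) ≡ ∑ (edges H) (λ (u , v) → g u v)
  ∑-edges-cong f g f≡g = begin
    ∑ (edges H) (λ (u , v) → f u v)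
      ≡⟨ ∑-filter (λ (u , v) → T? (adj u v)) (pairs (vertices H)) (λ (u , v) → f u v) ⟩
    ∑ (pairs (vertices H)) (λ (u , v) → A u v * f u v)
      ≡⟨ ∑-cong (pairs (vertices H)) (λ (u , v) → 𝟙-cong (adj u v) f≡g) ⟩
    ∑ (pairs (vertices H)) (λ (u , v) → A u v * g u v)
      ≡⟨ ∑-filter (λ (u , v) → T? (adj u v)) (pairs (vertices H)) (λ (u , v) → g u v) ⟨
    ∑ (edges H) (λ (u , v) → g u v) ∎

  -- The quadratic form of the kernel K at the degree vector.
  D : (Vertex H → Vertex H → ℚ) → ℚ
  D K = ∑ᵥ λ v → deg v * (∑ᵥ λ u → deg u * K u v)

  D-cong : ∀ {K L} → (∀ u v → K u v ≡ L u v) → D K ≡ D L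
  D-cong K≡L = ∑-cong (vertices H) λ v → cong (deg v *_)
    (∑-cong (vertices H) λ u → cong (deg u *_) (K≡L u v))

  D-+ : ∀ K L → D (λ u v → K u v + L u v) ≡ D K + D L
  D-+ K L = trans
    (∑-cong (vertices H) λ v → trans
      (cong (deg v *_) (trans
        (∑-cong (vertices H) λ u → ℚₚ.*-distribˡ-+ (deg u) (K u v) (L u v))
        (∑-+ (vertices H) (λ u → deg u * K u v) (λ u → deg u * L u v))))
      (ℚₚ.*-distribˡ-+ (deg v) _ _))
    (∑-+ (vertices H) (λ v → deg v * ∑ᵥ (λ u → deg u * K u v)) (λ v → deg v * ∑ᵥ (λ u → deg u * L u v)))

  D-∑ : ∀ {I : Set} (is : List I) (K : I → Vertex H → Vertex H → ℚ) →
        D (λ u v → ∑ is (λ i → K i u v)) ≡ ∑ is (λ i → D (K i))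
  D-∑ []       K = ∑-vanish (vertices H) λ {v} _ → trans
    (cong (deg v *_) (∑-vanish (vertices H) λ {u} _ → ℚₚ.*-zeroʳ (deg u))) (ℚₚ.*-zeroʳ (deg v))
  D-∑ (i ∷ is) K = trans (D-+ (K i) (λ u v → ∑ is (λ j → K j u v))) (cong (D (K i) +_) (D-∑ is K))

  D-⊗ : ∀ (f g : Vertex H → ℚ) → D (λ u v → f u * g v) ≡ ∑ᵥ (λ u → deg u * f u) * ∑ᵥ (λ v → deg v * g v)
  D-⊗ f g = begin
    ∑ᵥ (λ v → deg v * ∑ᵥ (λ u → deg u * (f u * g v)))
      ≡⟨ ∑-cong (vertices H) (λ v → trans (cong (deg v *_) (trans
           (∑-cong (vertices H) λ u → sym (ℚₚ.*-assoc (deg u) (f u) (g v)))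
           (∑-*ʳ (vertices H) (g v) (λ u → deg u * f u)))) (lemma (deg v) (∑ᵥ (λ u → deg u * f u)) (g v))) ⟩
    ∑ᵥ (λ v → ∑ᵥ (λ u → deg u * f u) * (deg v * g v))
      ≡⟨ ∑-*ˡ (vertices H) (∑ᵥ (λ u → deg u * f u)) (λ v → deg v * g v) ⟩
    ∑ᵥ (λ u → deg u * f u) * ∑ᵥ (λ v → deg v * g v) ∎
    where
    lemma : ∀ d x y → d * (x * y) ≡ x * (d * y)
    lemma = solve-∀ ℚ-ring

  fromℕ-2*size : fromℕ (2 ℕ.* size H) ≡ vol
  fromℕ-2*size = begin
    fromℕ (2 ℕ.* size H)                ≡⟨ fromℕ-* 2 (size H) ⟩
    fromℕ 2 * fromℕ (size H)            ≡⟨ cong (fromℕ 2 *_) (fromℕ-length (edges H)) ⟩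
    fromℕ 2 * ∑ (edges H) (λ _ → 1ℚ)    ≡⟨ ∑-*ˡ (edges H) (fromℕ 2) (λ _ → 1ℚ) ⟨
    ∑ (edges H) (λ _ → 1ℚ + 1ℚ)         ≡⟨ ∑-edges (λ _ _ → 1ℚ) ⟨
    ∑ᵥ (λ u → ∑ᵥ (λ v → A u v * 1ℚ))    ≡⟨ ∑-cong (vertices H) (λ u →
                                             ∑-cong (vertices H) (λ v → ℚₚ.*-identityʳ (A u v))) ⟩
    vol                                 ∎

  Lap-deg : ∀ f u → Lap f u ≡ deg u * f u - ∑ᵥ (λ v → A u v * f v)
  Lap-deg f u = begin
    ∑ᵥ (λ v → A u v * (f u - f v))
      ≡⟨ ∑-cong (vertices H) (λ v → distr (A u v) (f u) (f v)) ⟩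
    ∑ᵥ (λ v → A u v * f u - A u v * f v)
      ≡⟨ ∑-sub (vertices H) (λ v → A u v * f u) (λ v → A u v * f v) ⟩
    ∑ᵥ (λ v → A u v * f u) - ∑ᵥ (λ v → A u v * f v)
      ≡⟨ cong (_- ∑ᵥ (λ v → A u v * f v)) (∑-*ʳ (vertices H) (f u) (A u)) ⟩
    deg u * f u - ∑ᵥ (λ v → A u v * f v) ∎
    where
    distr : ∀ a x y → a * (x - y) ≡ a * x - a * y
    distr = solve-∀ ℚ-ring

  Lap-cong : ∀ {f g} → (∀ u → f u ≡ g u) → ∀ u → Lap f u ≡ Lap g u
  Lap-cong f≡g u = ∑-cong (vertices H) λ v → cong (A u v *_) (cong₂ _-_ (f≡g u) (f≡g v))

  Lap-const : ∀ c u → Lap (λ _ → c) u ≡ 0ℚ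
  Lap-const c u = ∑-vanish (vertices H) λ {v} _ →
    trans (cong (A u v *_) (ℚₚ.+-inverseʳ c)) (ℚₚ.*-zeroʳ (A u v))

  Lap-+ : ∀ f g u → Lap (λ w → f w + g w) u ≡ Lap f u + Lap g u
  Lap-+ f g u = trans (∑-cong (vertices H) λ v → lemma (A u v) (f u) (g u) (f v) (g v))
    (∑-+ (vertices H) (λ v → A u v * (f u - f v)) (λ v → A u v * (g u - g v)))
    where
    lemma : ∀ a x y z w → a * ((x + y) - (z + w)) ≡ a * (x - z) + a * (y - w)
    lemma = solve-∀ ℚ-ring

  Lap-* : ∀ c f u → Lap (λ w → c * f w) u ≡ c * Lap f u
  Lap-* c f u = trans (∑-cong (vertices H) λ v → lemma (A u v) c (f u) (f v))
    (∑-*ˡ (vertices H) c (λ v → A u v * (f u - f v)))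
    where
    lemma : ∀ a c x y → a * (c * x - c * y) ≡ c * (a * (x - y))
    lemma = solve-∀ ℚ-ring

  Lap-sub : ∀ f g u → Lap (λ w → f w - g w) u ≡ Lap f u - Lap g u
  Lap-sub f g u = trans (∑-cong (vertices H) λ v → lemma (A u v) (f u) (g u) (f v) (g v))
    (∑-sub (vertices H) (λ v → A u v * (f u - f v)) (λ v → A u v * (g u - g v)))
    where
    lemma : ∀ a x y z w → a * ((x - y) - (z - w)) ≡ a * (x - z) - a * (y - w)
    lemma = solve-∀ ℚ-ring

  Lap-∑ : ∀ {I : Set} (is : List I) (f : I → Vertex H → ℚ) u →
          Lap (λ w → ∑ is (λ i → f i w)) u ≡ ∑ is (λ i → Lap (f i) u)
  Lap-∑ []       f u = Lap-const 0ℚ u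
  Lap-∑ (i ∷ is) f u = trans (Lap-+ (f i) (λ w → ∑ is (λ j → f j w)) u)
    (cong (Lap (f i) u +_) (Lap-∑ is f u))

  ∑∑-swap : ∀ (f : Vertex H → Vertex H → ℚ) → ∑ᵥ (λ u → ∑ᵥ (λ v → A u v * f u v)) ≡ ∑ᵥ (λ u → ∑ᵥ (λ v → A u v * f v u))
  ∑∑-swap f = trans (∑-swap (vertices H) (vertices H) (λ u v → A u v * f u v))
    (∑-cong (vertices H) λ u → ∑-cong (vertices H) λ v → cong (_* f v u) (A-sym v u))

  ∑-Lap : ∀ f → ∑ᵥ (Lap f) ≡ 0ℚ
  ∑-Lap f = begin
    ∑ᵥ (λ u → ∑ᵥ (λ v → A u v * (f u - f v)))
      ≡⟨ ∑-edges (λ u v → f u - f v) ⟩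
    ∑ (edges H) (λ (u , v) → (f u - f v) + (f v - f u))
      ≡⟨ ∑-vanish (edges H) (λ {(u , v)} _ → lemma (f u) (f v)) ⟩
    0ℚ ∎
    where
    lemma : ∀ x y → (x - y) + (y - x) ≡ 0ℚ
    lemma = solve-∀ ℚ-ring

  -- The Dirichlet form. The square splits as f u (f u - f v) + f v (f v - f u), and the two parts
  -- have equal sums by the symmetry of `A`.
  energy : ∀ f → ∑ᵥ (λ u → ∑ᵥ (λ v → A u v * ((f u - f v) * (f u - f v))))
               ≡ ∑ᵥ (λ u → f u * Lap f u) + ∑ᵥ (λ u → f u * Lap f u)
  energy f = begin
    ∑ᵥ (λ u → ∑ᵥ (λ v → A u v * ((f u - f v) * (f u - f v))))
      ≡⟨ ∑-cong (vertices H) (λ u → trans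
           (∑-cong (vertices H) (λ v → lemma (A u v) (f u) (f v)))
           (∑-+ (vertices H) (λ v → A u v * (f u * (f u - f v))) (λ v → A u v * (f v * (f v - f u))))) ⟩
    ∑ᵥ (λ u → ∑ᵥ (λ v → A u v * (f u * (f u - f v))) + ∑ᵥ (λ v → A u v * (f v * (f v - f u))))
      ≡⟨ ∑-+ (vertices H) (λ u → ∑ᵥ (λ v → A u v * (f u * (f u - f v)))) (λ u → ∑ᵥ (λ v → A u v * (f v * (f v - f u)))) ⟩
    ∑ᵥ (λ u → ∑ᵥ (λ v → A u v * (f u * (f u - f v))))
      + ∑ᵥ (λ u → ∑ᵥ (λ v → A u v * (f v * (f v - f u))))
      ≡⟨ cong₂ _+_ inner (trans (∑∑-swap (λ u v → f v * (f v - f u))) inner) ⟩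
    ∑ᵥ (λ u → f u * Lap f u) + ∑ᵥ (λ u → f u * Lap f u) ∎
    where
    lemma : ∀ a x y → a * ((x - y) * (x - y)) ≡ a * (x * (x - y)) + a * (y * (y - x))
    lemma = solve-∀ ℚ-ring
    lemma′ : ∀ a x y → a * (x * y) ≡ x * (a * y)
    lemma′ = solve-∀ ℚ-ring
    inner : ∑ᵥ (λ u → ∑ᵥ (λ v → A u v * (f u * (f u - f v)))) ≡ ∑ᵥ (λ u → f u * Lap f u)
    inner = ∑-cong (vertices H) λ u → trans
      (∑-cong (vertices H) λ v → lemma′ (A u v) (f u) (f u - f v))
      (∑-*ˡ (vertices H) (f u) (λ v → A u v * (f u - f v)))

  -- With Lf = 0 the energy vanishes; being a sum of squares with nonnegative weights, it has the
  -- term 0 at every edge.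
  Lap≡0⇒adj : ∀ {f} → (∀ u → Lap f u ≡ 0ℚ) → ∀ {u v} → u ~ v → f u ≡ f v
  Lap≡0⇒adj {f} Lf≡0 {u} {v} u~v = x-y≡0⇒x≡y (x*x≡0⇒x≡0 (begin
    (f u - f v) * (f u - f v)             ≡⟨ ℚₚ.*-identityˡ _ ⟨
    1ℚ * ((f u - f v) * (f u - f v))      ≡⟨ cong (λ a → a * ((f u - f v) * (f u - f v))) (A≡1 u~v) ⟨
    A u v * ((f u - f v) * (f u - f v))   ≡⟨ ∑≡0⇒term≡0 (term≥0 u) (∑≡0⇒term≡0 row≥0 total≡0 (complete u)) (complete v) ⟩
    0ℚ                                    ∎))
    where
    A≡1 : T (adj u v) → A u v ≡ 1ℚ
    A≡1 with adj u v
    ... | true = λ _ → refl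
    term≥0 : ∀ u v → 0ℚ ≤ A u v * ((f u - f v) * (f u - f v))
    term≥0 u v = *-nonNeg (𝟙-nonNeg (adj u v)) (x*x≥0 (f u - f v))
    row≥0 : ∀ u → 0ℚ ≤ ∑ᵥ (λ v → A u v * ((f u - f v) * (f u - f v)))
    row≥0 u = ∑-nonNeg (vertices H) (term≥0 u)
    vanish : ∑ᵥ (λ u → f u * Lap f u) ≡ 0ℚ
    vanish = ∑-vanish (vertices H) λ {u} _ → trans (cong (f u *_) (Lf≡0 u)) (ℚₚ.*-zeroʳ (f u))
    total≡0 : ∑ᵥ (λ u → ∑ᵥ (λ v → A u v * ((f u - f v) * (f u - f v)))) ≡ 0ℚ
    total≡0 = trans (energy f) (cong₂ _+_ vanish vanish)

  harmonic⇒const : Connected H → ∀ {f} → (∀ u → Lap f u ≡ 0ℚ) → ∀ u v → f u ≡ f v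
  harmonic⇒const connected {f} Lf≡0 u v = along (proj₂ connected u v)
    where
    along : ∀ {u} → Reachable H u v → f u ≡ f v
    along ε         = refl
    along (e ◅ u⇝v) = trans (Lap≡0⇒adj Lf≡0 e) (along u⇝v)

  -- Every Laplacian sums to 0, so an equation for it whose other side has total 0 only has to be
  -- verified away from one vertex. That vertex will be the target of the walk, where first-step
  -- analysis says nothing.
  ∑≡0⇒vanishes-at : ∀ {f} v → ∑ᵥ f ≡ 0ℚ → (∀ {u} → u ≢ v → f u ≡ 0ℚ) → ∀ u → f u ≡ 0ℚ
  ∑≡0⇒vanishes-at v ∑f≡0 f≡0 u with u ≟ v
  ... | yes refl = trans (sym (∑ᵥ-single u f≡0)) ∑f≡0
  ... | no u≢v   = f≡0 u≢v

  degree≥1 : ∀ {u v} → u ~ v → 1 ℕ.≤ degree u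
  degree≥1 {u} {v} u~v = positive-length (∈-filter⁺ (λ w → T? (adj u w)) (complete v) u~v)
    where

    positive-length : ∀ {xs : List (Vertex H)} → v ∈ xs → 1 ℕ.≤ length xs
    positive-length (here _)  = ℕ.s≤s ℕ.z≤n
    positive-length (there _) = ℕ.s≤s ℕ.z≤n

-- Hitting times, Kemeny's constant and effective resistance

module RandomWalk (H : Graph) (connected : Connected H) (m : MeanFirstPassage H) where
  open Graph H using (_≟_; adj; adj-sym; adj-irrefl; complete; unique; _~_; degree; others)
  open Network H

  step-from : ∀ {u v} → u ≢ v → 1 ℕ.≤ degree u
  step-from {u} {v} u≢v with proj₂ connected u v
  ... | ε     = contradiction refl u≢v
  ... | e ◅ _ = degree≥1 e

  deg*transition : ∀ {u v} w → u ≢ v → deg u * transition H u w ≡ A u w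
  deg*transition {u} w u≢v = begin
    deg u * (if adj u w then 1ℚ ÷ℕ degree u else 0ℚ)
      ≡⟨ cong₂ _*_ (sym (fromℕ-degree u)) (if-𝟙 (adj u w) (1ℚ ÷ℕ degree u)) ⟩
    fromℕ (degree u) * (A u w * (1ℚ ÷ℕ degree u))
      ≡⟨ lemma (fromℕ (degree u)) (A u w) (1ℚ ÷ℕ degree u) ⟩
    A u w * (fromℕ (degree u) * (1ℚ ÷ℕ degree u))
      ≡⟨ cong (A u w *_) (fromℕ-inverse (degree u) (step-from u≢v)) ⟩
    A u w * 1ℚ
      ≡⟨ ℚₚ.*-identityʳ (A u w) ⟩
    A u w ∎
    where
    lemma : ∀ x y z → x * (y * z) ≡ y * (x * z)
    lemma = solve-∀ ℚ-ring

  ∑-others-split : ∀ v {f g} → (∀ {u} → u ≢ v → f u ≡ g u) → ∑ᵥ f ≡ f v + ∑ (others v) g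
  ∑-others-split v {f} {g} f≡g = begin
    ∑ᵥ f
      ≡⟨ ∑-cong (vertices H) (λ u → lemma (δ u v) (f u)) ⟩
    ∑ᵥ (λ u → δ u v * f u + (1ℚ - δ u v) * f u)
      ≡⟨ ∑-+ (vertices H) (λ u → δ u v * f u) (λ u → (1ℚ - δ u v) * f u) ⟩
    ∑ᵥ (λ u → δ u v * f u) + ∑ᵥ (λ u → (1ℚ - δ u v) * f u)
      ≡⟨ cong₂ _+_ (∑ᵥ-δ v f) (sym (∑-others v at-v off-v)) ⟩
    f v + ∑ (others v) g ∎
    where
    lemma : ∀ d x → x ≡ d * x + (1ℚ - d) * x
    lemma = solve-∀ ℚ-ring
    at-v : (1ℚ - δ v v) * f v ≡ 0ℚ
    at-v = trans (cong (λ d → (1ℚ - d) * f v) (δ-refl v)) (ℚₚ.*-zeroˡ (f v))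
    off-v : ∀ {u} → u ≢ v → g u ≡ (1ℚ - δ u v) * f u
    off-v {u} u≢v = trans (sym (f≡g u≢v)) (sym (trans (cong (λ d → (1ℚ - d) * f u) (⟦⟧-no (u ≟ v) u≢v))
      (ℚₚ.*-identityˡ (f u))))

  -- P(T ≤ n), where T ≥ 1 is the first passage time from u to v.
  passageBy : ℕ → Vertex H → Vertex H → ℚ
  passageBy zero    u v = 0ℚ
  passageBy (suc n) u v = passageBy n u v + firstPassage H (suc n) u v

  ∑A : (u v : Vertex H) → (Vertex H → ℚ) → ℚ
  ∑A u v f = ∑ (others v) (λ w → A u w * f w)

  ∑A-+ : ∀ u v (f g : Vertex H → ℚ) → ∑A u v (λ w → f w + g w) ≡ ∑A u v f + ∑A u v g
  ∑A-+ u v f g = trans (∑-cong (others v) λ w → ℚₚ.*-distribˡ-+ (A u w) (f w) (g w))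
    (∑-+ (others v) (λ w → A u w * f w) (λ w → A u w * g w))

  ∑A-* : ∀ u v c (f : Vertex H → ℚ) → ∑A u v (λ w → c * f w) ≡ c * ∑A u v f
  ∑A-* u v c f = trans (∑-cong (others v) λ w → lemma (A u w) c (f w))
    (∑-*ˡ (others v) c (λ w → A u w * f w))
    where
    lemma : ∀ x y z → x * (y * z) ≡ y * (x * z)
    lemma = solve-∀ ℚ-ring

  ∑A-zero : ∀ u v → ∑A u v (λ _ → 0ℚ) ≡ 0ℚ
  ∑A-zero u v = ∑-vanish (others v) λ {w} _ → ℚₚ.*-zeroʳ (A u w)

  firstPassage-step : ∀ n {u v} → u ≢ v →
    deg u * firstPassage H (suc (suc n)) u v ≡ ∑A u v (λ w → firstPassage H (suc n) w v)
  firstPassage-step n {u} {v} u≢v = begin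
    deg u * ∑ (others v) (λ w → transition H u w * firstPassage H (suc n) w v)
      ≡⟨ ∑-*ˡ (others v) (deg u) (λ w → transition H u w * firstPassage H (suc n) w v) ⟨
    ∑ (others v) (λ w → deg u * (transition H u w * firstPassage H (suc n) w v))
      ≡⟨ ∑-cong (others v) (λ w → trans
           (sym (ℚₚ.*-assoc (deg u) (transition H u w) (firstPassage H (suc n) w v)))
           (cong (_* firstPassage H (suc n) w v) (deg*transition w u≢v))) ⟩
    ∑A u v (λ w → firstPassage H (suc n) w v) ∎

  passageBy-step : ∀ n {u v} → u ≢ v →
    deg u * passageBy (suc n) u v ≡ A u v + ∑A u v (λ w → passageBy n w v)
  passageBy-step zero {u} {v} u≢v = begin
    deg u * (0ℚ + transition H u v)     ≡⟨ cong (deg u *_) (ℚₚ.+-identityˡ _) ⟩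
    deg u * transition H u v            ≡⟨ deg*transition v u≢v ⟩
    A u v                               ≡⟨ ℚₚ.+-identityʳ (A u v) ⟨
    A u v + 0ℚ                          ≡⟨ cong (A u v +_) (∑A-zero u v) ⟨
    A u v + ∑A u v (λ _ → 0ℚ)           ∎
  passageBy-step (suc n) {u} {v} u≢v = begin
    deg u * (passageBy (suc n) u v + f (suc (suc n)) u)
      ≡⟨ ℚₚ.*-distribˡ-+ (deg u) (passageBy (suc n) u v) (f (suc (suc n)) u) ⟩
    deg u * passageBy (suc n) u v + deg u * f (suc (suc n)) u
      ≡⟨ cong₂ _+_ (passageBy-step n u≢v) (firstPassage-step n u≢v) ⟩
    (A u v + ∑A u v (λ w → passageBy n w v)) + ∑A u v (f (suc n))
      ≡⟨ ℚₚ.+-assoc (A u v) (∑A u v (λ w → passageBy n w v)) (∑A u v (f (suc n))) ⟩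
    A u v + (∑A u v (λ w → passageBy n w v) + ∑A u v (f (suc n)))
      ≡⟨ cong (A u v +_) (∑A-+ u v (λ w → passageBy n w v) (f (suc n))) ⟨
    A u v + ∑A u v (λ w → passageBy (suc n) w v) ∎
    where
    f : ℕ → Vertex H → ℚ
    f k w = firstPassage H k w v

  -- Conditioning E[T; T ≤ n + 1] on the first step: that step contributes 1 on the event T ≤ n + 1,
  -- hence the `passageBy` term, and from the new vertex at most n further steps remain.
  partialMean-step : ∀ n {u v} → u ≢ v →
    deg u * partialMean H u v (suc n) ≡ deg u * passageBy (suc n) u v + ∑A u v (λ w → partialMean H w v n)
  partialMean-step zero {u} {v} u≢v = begin
    deg u * (0ℚ + 1ℚ * f 1 u)             ≡⟨ lemma (deg u) (f 1 u) ⟩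
    deg u * (0ℚ + f 1 u) + 0ℚ             ≡⟨ cong (deg u * (0ℚ + f 1 u) +_) (∑A-zero u v) ⟨
    deg u * (0ℚ + f 1 u) + ∑A u v (λ _ → 0ℚ) ∎
    where
    f : ℕ → Vertex H → ℚ
    f k w = firstPassage H k w v
    lemma : ∀ d x → d * (0ℚ + 1ℚ * x) ≡ d * (0ℚ + x) + 0ℚ
    lemma = solve-∀ ℚ-ring
  partialMean-step (suc n) {u} {v} u≢v = begin
    deg u * (M (suc n) u + fromℕ (suc (suc n)) * f (suc (suc n)) u)
      ≡⟨ cong (λ c → deg u * (M (suc n) u + c * f (suc (suc n)) u)) (fromℕ-+ 1 (suc n)) ⟩
    deg u * (M (suc n) u + (1ℚ + fromℕ (suc n)) * f (suc (suc n)) u)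
      ≡⟨ lemma₁ (deg u) (M (suc n) u) (fromℕ (suc n)) (f (suc (suc n)) u) ⟩
    deg u * M (suc n) u + (deg u * f (suc (suc n)) u + fromℕ (suc n) * (deg u * f (suc (suc n)) u))
      ≡⟨ cong₂ _+_ (partialMean-step n u≢v)
           (cong (λ x → deg u * f (suc (suc n)) u + fromℕ (suc n) * x) (firstPassage-step n u≢v)) ⟩
    (deg u * F (suc n) u + ∑A u v (M n)) + (deg u * f (suc (suc n)) u + fromℕ (suc n) * ∑A u v (f (suc n)))
      ≡⟨ lemma₂ (deg u) (F (suc n) u) (∑A u v (M n)) (f (suc (suc n)) u) (fromℕ (suc n) * ∑A u v (f (suc n))) ⟩
    deg u * (F (suc n) u + f (suc (suc n)) u) + (∑A u v (M n) + fromℕ (suc n) * ∑A u v (f (suc n)))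
      ≡⟨ cong (deg u * F (suc (suc n)) u +_) (trans (∑A-+ u v (M n) (λ w → fromℕ (suc n) * f (suc n) w))
           (cong (∑A u v (M n) +_) (∑A-* u v (fromℕ (suc n)) (f (suc n))))) ⟨
    deg u * F (suc (suc n)) u + ∑A u v (M (suc n)) ∎
    where
    f F M : ℕ → Vertex H → ℚ
    f k w = firstPassage H k w v
    F k w = passageBy k w v
    M k w = partialMean H w v k
    lemma₁ : ∀ d x c y → d * (x + (1ℚ + c) * y) ≡ d * x + (d * y + c * (d * y))
    lemma₁ = solve-∀ ℚ-ring
    lemma₂ : ∀ d x a y b → (d * x + a) + (d * y + b) ≡ d * (x + y) + (a + b)
    lemma₂ = solve-∀ ℚ-ring

  module _ (v : Vertex H) where

    private
      -- `L u` is solved from `partialMean-step` in the limit: it is the value that P(T ≤ n) is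
      -- bound to approach once the partial means converge.
      t L : Vertex H → ℚ
      t u = time m u v
      L u = (1ℚ ÷ℕ degree u) * (deg u * t u - ∑A u v t)

    ∈-others⇒≢ : ∀ {w} → w ∈ others v → w ≢ v
    ∈-others⇒≢ w∈ = proj₂ (∈-filter⁻ (λ u → ¬? (u ≟ v)) {xs = vertices H} w∈)

    ∑A-⇢ : ∀ u {s : Vertex H → ℕ → ℚ} {q} → (∀ {w} → w ≢ v → s w ⇢ q w) →
           (λ n → ∑A u v (λ w → s w n)) ⇢ ∑A u v q
    ∑A-⇢ u s⇢q = ⇢-∑ (others v) λ {w} w∈ → ⇢-* (A u w) (s⇢q (∈-others⇒≢ w∈))

    partialMean⇢ : ∀ {u} → u ≢ v → partialMean H u v ⇢ t u
    partialMean⇢ u≢v = lim (MeanFirstPassage.isMean m _ v u≢v)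

    cancel-deg : ∀ {u} → u ≢ v → ∀ x → (1ℚ ÷ℕ degree u) * (deg u * x) ≡ x
    cancel-deg {u} u≢v x = begin
      (1ℚ ÷ℕ degree u) * (deg u * x)             ≡⟨ lemma (1ℚ ÷ℕ degree u) (deg u) x ⟩
      (deg u * (1ℚ ÷ℕ degree u)) * x
        ≡⟨ cong (λ d → (d * (1ℚ ÷ℕ degree u)) * x) (fromℕ-degree u) ⟨
      (fromℕ (degree u) * (1ℚ ÷ℕ degree u)) * x
        ≡⟨ cong (_* x) (fromℕ-inverse (degree u) (step-from u≢v)) ⟩
      1ℚ * x                                     ≡⟨ ℚₚ.*-identityˡ x ⟩
      x                                          ∎
      where
      lemma : ∀ a b x → a * (b * x) ≡ (b * a) * x
      lemma = solve-∀ ℚ-ring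

    deg*passageBy⇢ : ∀ {u} → u ≢ v → (λ n → deg u * passageBy (suc n) u v) ⇢ (deg u * t u - ∑A u v t)
    deg*passageBy⇢ {u} u≢v = ⇢-ext
      (λ n → trans (cong (_- ∑A u v (λ w → partialMean H w v n)) (partialMean-step n u≢v))
                   (lemma (deg u * passageBy (suc n) u v) _))
      (⇢-sub (⇢-* (deg u) (⇢-tail (partialMean⇢ u≢v))) (∑A-⇢ u partialMean⇢))
      where
      lemma : ∀ x y → (x + y) - y ≡ x
      lemma = solve-∀ ℚ-ring

    passageBy⇢ : ∀ {u} → u ≢ v → (λ n → passageBy n u v) ⇢ L u
    passageBy⇢ {u} u≢v = ⇢-untail (⇢-ext (λ n → cancel-deg u≢v (passageBy (suc n) u v))
      (⇢-* (1ℚ ÷ℕ degree u) (deg*passageBy⇢ u≢v)))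

    L-harmonic : ∀ {u} → u ≢ v → deg u * L u ≡ A u v + ∑A u v L
    L-harmonic {u} u≢v = ⇢-unique
      (⇢-* (deg u) (⇢-tail (passageBy⇢ u≢v)))
      (⇢-ext (λ n → sym (passageBy-step n u≢v)) (⇢-+ (⇢-const (A u v)) (∑A-⇢ u passageBy⇢)))

    -- The walk is recurrent: L is the probability of ever reaching v, and extended by 1 at v it is
    -- harmonic.
    L≡1 : ∀ {u} → u ≢ v → L u ≡ 1ℚ
    L≡1 {u} u≢v = trans (sym (g-off u≢v)) (trans (harmonic⇒const connected Lap-g u v) g-at)
      where
      g : Vertex H → ℚ
      g w = if does (w ≟ v) then 1ℚ else L w
      g-at : g v ≡ 1ℚ
      g-at with v ≟ v
      ... | yes _  = refl
      ... | no v≢v = contradiction refl v≢v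
      g-off : ∀ {w} → w ≢ v → g w ≡ L w
      g-off {w} w≢v with w ≟ v
      ... | yes w≡v = contradiction w≡v w≢v
      ... | no _    = refl
      Lap-g-off : ∀ {w} → w ≢ v → Lap g w ≡ 0ℚ
      Lap-g-off {w} w≢v = begin
        Lap g w                                        ≡⟨ Lap-deg g w ⟩
        deg w * g w - ∑ᵥ (λ x → A w x * g x)
          ≡⟨ cong₂ _-_ (cong (deg w *_) (g-off w≢v))
               (∑-others-split v (λ {x} x≢v → cong (A w x *_) (g-off x≢v))) ⟩
        deg w * L w - (A w v * g v + ∑A w v L)
          ≡⟨ cong₂ _-_ (L-harmonic w≢v) (cong (_+ ∑A w v L) (trans (cong (A w v *_) g-at) (ℚₚ.*-identityʳ (A w v)))) ⟩
        (A w v + ∑A w v L) - (A w v + ∑A w v L)        ≡⟨ ℚₚ.+-inverseʳ (A w v + ∑A w v L) ⟩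
        0ℚ                                             ∎
      Lap-g : ∀ w → Lap g w ≡ 0ℚ
      Lap-g = ∑≡0⇒vanishes-at v (∑-Lap g) Lap-g-off

    first-step : ∀ {u} → u ≢ v → deg u * t u - ∑A u v t ≡ deg u
    first-step {u} u≢v = begin
      deg u * t u - ∑A u v t
        ≡⟨ cancel-deg u≢v (deg u * t u - ∑A u v t) ⟨
      (1ℚ ÷ℕ degree u) * (deg u * (deg u * t u - ∑A u v t))
        ≡⟨ lemma (1ℚ ÷ℕ degree u) (deg u) (deg u * t u - ∑A u v t) ⟩
      deg u * L u
        ≡⟨ trans (cong (deg u *_) (L≡1 u≢v)) (ℚₚ.*-identityʳ (deg u)) ⟩
      deg u ∎
      where
      lemma : ∀ a b x → a * (b * x) ≡ b * (a * x)
      lemma = solve-∀ ℚ-ring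

  -- The diagonal of `time` is arbitrary; the value 0 there turns the first-step equation into a
  -- statement about sums over all vertices, that is, about `Lap`.
  hit : Vertex H → Vertex H → ℚ
  hit u v = if does (u ≟ v) then 0ℚ else time m u v

  hit-refl : ∀ v → hit v v ≡ 0ℚ
  hit-refl v with v ≟ v
  ... | yes _  = refl
  ... | no v≢v = contradiction refl v≢v

  hit-≢ : ∀ {u v} → u ≢ v → hit u v ≡ time m u v
  hit-≢ {u} {v} u≢v with u ≟ v
  ... | yes u≡v = contradiction u≡v u≢v
  ... | no _    = refl

  -- Away from v this is `first-step`. At v it is forced: the Laplacian sums to 0, and deg - vol·δ
  -- does so too, which is where the factor `vol` comes from.
  Lap-hit : ∀ v u → Lap (λ w → hit w v) u ≡ deg u - vol * δ u v
  Lap-hit v u = x-y≡0⇒x≡y (∑≡0⇒vanishes-at v ∑defect≡0 defect-off u)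
    where
    defect : Vertex H → ℚ
    defect u = Lap (λ w → hit w v) u - (deg u - vol * δ u v)
    ∑defect≡0 : ∑ᵥ defect ≡ 0ℚ
    ∑defect≡0 = begin
      ∑ᵥ defect
        ≡⟨ ∑-sub (vertices H) (Lap (λ w → hit w v)) (λ u → deg u - vol * δ u v) ⟩
      ∑ᵥ (Lap (λ w → hit w v)) - ∑ᵥ (λ u → deg u - vol * δ u v)
        ≡⟨ cong₂ _-_ (∑-Lap (λ w → hit w v)) (∑-sub (vertices H) deg (λ u → vol * δ u v)) ⟩
      0ℚ - (vol - ∑ᵥ (λ u → vol * δ u v))
        ≡⟨ cong (λ x → 0ℚ - (vol - x)) (trans (∑-cong (vertices H) (λ u → ℚₚ.*-comm vol (δ u v)))
             (∑ᵥ-δ v (λ _ → vol))) ⟩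
      0ℚ - (vol - vol)
        ≡⟨ cong (_-_ 0ℚ) (ℚₚ.+-inverseʳ vol) ⟩
      0ℚ ∎
    defect-off : ∀ {u} → u ≢ v → defect u ≡ 0ℚ
    defect-off {u} u≢v = begin
      Lap (λ w → hit w v) u - (deg u - vol * δ u v)
        ≡⟨ cong₂ (λ x y → x - (deg u - vol * y)) Lap-off (⟦⟧-no (u ≟ v) u≢v) ⟩
      deg u - (deg u - vol * 0ℚ)
        ≡⟨ lemma (deg u) vol ⟩
      0ℚ ∎
      where
      lemma : ∀ d v → d - (d - v * 0ℚ) ≡ 0ℚ
      lemma = solve-∀ ℚ-ring
      Lap-off : Lap (λ w → hit w v) u ≡ deg u
      Lap-off = begin
        Lap (λ w → hit w v) u
          ≡⟨ Lap-deg (λ w → hit w v) u ⟩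
        deg u * hit u v - ∑ᵥ (λ w → A u w * hit w v)
          ≡⟨ cong₂ _-_ (cong (deg u *_) (hit-≢ u≢v))
               (sym (∑-others v (trans (cong (A u v *_) (hit-refl v)) (ℚₚ.*-zeroʳ (A u v)))
                 (λ {w} w≢v → cong (A u w *_) (sym (hit-≢ w≢v))))) ⟩
        deg u * time m u v - ∑A u v (λ w → time m w v)
          ≡⟨ first-step v u≢v ⟩
        deg u ∎

  c : ℚ
  c = 1ℚ ÷ℕ (2 ℕ.* size H)

  stationary≡ : ∀ v → stationary H v ≡ c * deg v
  stationary≡ v = trans (÷ℕ-* (fromℕ (degree v)) (2 ℕ.* size H))
    (trans (cong (_* c) (fromℕ-degree v)) (ℚₚ.*-comm (deg v) c))

  kemeny≡ : ∀ u → kemeny H m u ≡ c * ∑ᵥ (λ v → deg v * hit u v)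
  kemeny≡ u = trans
    (∑-others u (trans (cong (λ x → c * (deg u * x)) (hit-refl u)) (lemma c (deg u)))
      (λ {v} v≢u → trans (cong₂ _*_ (stationary≡ v) (sym (hit-≢ (v≢u ∘ sym))))
        (ℚₚ.*-assoc c (deg v) (hit u v))))
    (∑-*ˡ (vertices H) c (λ v → deg v * hit u v))
    where
    lemma : ∀ c d → c * (d * 0ℚ) ≡ 0ℚ
    lemma = solve-∀ ℚ-ring

  accessibility≡ : ∀ v → accessibility H m v ≡ c * ∑ᵥ (λ u → deg u * hit u v)
  accessibility≡ v = trans
    (∑-others v (trans (cong (λ x → c * (deg v * x)) (hit-refl v)) (lemma c (deg v)))
      (λ {u} u≢v → trans (cong₂ _*_ (stationary≡ u) (sym (hit-≢ u≢v)))
        (ℚₚ.*-assoc c (deg u) (hit u v))))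
    (∑-*ˡ (vertices H) c (λ u → deg u * hit u v))
    where
    lemma : ∀ c d → c * (d * 0ℚ) ≡ 0ℚ
    lemma = solve-∀ ℚ-ring

  -- As a function of the start, κ is harmonic: by `Lap-hit` its Laplacian at u is a multiple of ∑
  -- deg v (deg u - vol·δ u v) = vol·deg u - vol·deg u.
  kemeny-const : ∀ u v → kemeny H m u ≡ kemeny H m v
  kemeny-const = harmonic⇒const connected λ u → begin
    Lap (kemeny H m) u
      ≡⟨ Lap-cong kemeny≡ u ⟩
    Lap (λ w → c * ∑ᵥ (λ v → deg v * hit w v)) u
      ≡⟨ Lap-* c (λ w → ∑ᵥ (λ v → deg v * hit w v)) u ⟩
    c * Lap (λ w → ∑ᵥ (λ v → deg v * hit w v)) u
      ≡⟨ cong (c *_) (Lap-∑ (vertices H) (λ v w → deg v * hit w v) u) ⟩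
    c * ∑ᵥ (λ v → Lap (λ w → deg v * hit w v) u)
      ≡⟨ cong (c *_) (∑-cong (vertices H) (λ v → trans (Lap-* (deg v) (λ w → hit w v) u)
           (trans (cong (deg v *_) (trans (Lap-hit v u) (cong (λ x → deg u - vol * x) (δ-sym u v))))
             (lemma₁ (deg v) (deg u) vol (δ v u))))) ⟩
    c * ∑ᵥ (λ v → deg v * deg u - δ v u * (vol * deg v))
      ≡⟨ cong (c *_) (∑-sub (vertices H) (λ v → deg v * deg u) (λ v → δ v u * (vol * deg v))) ⟩
    c * (∑ᵥ (λ v → deg v * deg u) - ∑ᵥ (λ v → δ v u * (vol * deg v)))
      ≡⟨ cong (c *_) (cong₂ _-_ (∑-*ʳ (vertices H) (deg u) deg) (∑ᵥ-δ u (λ v → vol * deg v))) ⟩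
    c * (vol * deg u - vol * deg u)
      ≡⟨ lemma₂ c (vol * deg u) ⟩
    0ℚ ∎
    where
    lemma₁ : ∀ a b v d → a * (b - v * d) ≡ a * b - d * (v * a)
    lemma₁ = solve-∀ ℚ-ring
    lemma₂ : ∀ c x → c * (x - x) ≡ 0ℚ
    lemma₂ = solve-∀ ℚ-ring

  -- The effective resistance between u and v: by the commute time identity
  -- m_{u,v} + m_{v,u} = 2 m_H R(u,v).
  R : Vertex H → Vertex H → ℚ
  R u v = c * (hit u v + hit v u)

  R-sym : ∀ u v → R u v ≡ R v u
  R-sym u v = cong (c *_) (ℚₚ.+-comm (hit u v) (hit v u))

  R-refl : ∀ v → R v v ≡ 0ℚ
  R-refl v = trans (cong (λ x → c * (x + x)) (hit-refl v)) (ℚₚ.*-zeroʳ c)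

  -- Each half of the commute time averages to one index: arrivals at v give the accessibility,
  -- departures from v give Kemeny's constant.
  ∑-deg-R : ∀ v → ∑ᵥ (λ u → deg u * R u v) ≡ accessibility H m v + kemeny H m v
  ∑-deg-R v = begin
    ∑ᵥ (λ u → deg u * R u v)
      ≡⟨ ∑-cong (vertices H) (λ u → lemma (deg u) c (hit u v) (hit v u)) ⟩
    ∑ᵥ (λ u → c * (deg u * hit u v) + c * (deg u * hit v u))
      ≡⟨ ∑-+ (vertices H) (λ u → c * (deg u * hit u v)) (λ u → c * (deg u * hit v u)) ⟩
    ∑ᵥ (λ u → c * (deg u * hit u v)) + ∑ᵥ (λ u → c * (deg u * hit v u))
      ≡⟨ cong₂ _+_ (∑-*ˡ (vertices H) c (λ u → deg u * hit u v)) (∑-*ˡ (vertices H) c (λ u → deg u * hit v u)) ⟩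
    c * ∑ᵥ (λ u → deg u * hit u v) + c * ∑ᵥ (λ u → deg u * hit v u)
      ≡⟨ cong₂ _+_ (accessibility≡ v) (kemeny≡ v) ⟨
    accessibility H m v + kemeny H m v ∎
    where
    lemma : ∀ d c x y → d * (c * (x + y)) ≡ c * (d * x) + c * (d * y)
    lemma = solve-∀ ℚ-ring

  ∑-deg-kemeny : ∀ o → ∑ᵥ (λ v → deg v * kemeny H m v) ≡ vol * kemeny H m o
  ∑-deg-kemeny o = trans (∑-cong (vertices H) λ v → cong (deg v *_) (kemeny-const v o))
    (∑-*ʳ (vertices H) (kemeny H m o) deg)

  -- Averaging over the target as well makes start and target interchangeable, so exchanging the two
  -- sums leads back to Kemeny's constant.
  ∑-deg-accessibility : ∀ o → ∑ᵥ (λ v → deg v * accessibility H m v) ≡ vol * kemeny H m o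
  ∑-deg-accessibility o = begin
    ∑ᵥ (λ v → deg v * accessibility H m v)
      ≡⟨ ∑-cong (vertices H) (λ v → trans (cong (deg v *_) (accessibility≡ v))
           (trans (cong (deg v *_) (sym (∑-*ˡ (vertices H) c (λ u → deg u * hit u v))))
             (sym (∑-*ˡ (vertices H) (deg v) (λ u → c * (deg u * hit u v)))))) ⟩
    ∑ᵥ (λ v → ∑ᵥ (λ u → deg v * (c * (deg u * hit u v))))
      ≡⟨ ∑-swap (vertices H) (vertices H) (λ v u → deg v * (c * (deg u * hit u v))) ⟩
    ∑ᵥ (λ u → ∑ᵥ (λ v → deg v * (c * (deg u * hit u v))))
      ≡⟨ ∑-cong (vertices H) (λ u → trans (trans
           (∑-cong (vertices H) (λ v → lemma (deg v) c (deg u) (hit u v)))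
           (∑-*ˡ (vertices H) (deg u) (λ v → c * (deg v * hit u v))))
             (cong (deg u *_) (∑-*ˡ (vertices H) c (λ v → deg v * hit u v)))) ⟩
    ∑ᵥ (λ u → deg u * (c * ∑ᵥ (λ v → deg v * hit u v)))
      ≡⟨ ∑-cong (vertices H) (λ u → cong (deg u *_) (kemeny≡ u)) ⟨
    ∑ᵥ (λ u → deg u * kemeny H m u)
      ≡⟨ ∑-deg-kemeny o ⟩
    vol * kemeny H m o ∎
    where
    lemma : ∀ a c b h → a * (c * (b * h)) ≡ b * (c * (a * h))
    lemma = solve-∀ ℚ-ring

  ∑∑-deg-R : ∀ o → ∑ᵥ (λ v → deg v * ∑ᵥ (λ u → deg u * R u v)) ≡ fromℕ 2 * (vol * kemeny H m o)
  ∑∑-deg-R o = begin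
    ∑ᵥ (λ v → deg v * ∑ᵥ (λ u → deg u * R u v))
      ≡⟨ ∑-cong (vertices H) (λ v → trans (cong (deg v *_) (∑-deg-R v))
           (ℚₚ.*-distribˡ-+ (deg v) (accessibility H m v) (kemeny H m v))) ⟩
    ∑ᵥ (λ v → deg v * accessibility H m v + deg v * kemeny H m v)
      ≡⟨ ∑-+ (vertices H) (λ v → deg v * accessibility H m v) (λ v → deg v * kemeny H m v) ⟩
    ∑ᵥ (λ v → deg v * accessibility H m v) + ∑ᵥ (λ v → deg v * kemeny H m v)
      ≡⟨ cong₂ _+_ (∑-deg-accessibility o) (∑-deg-kemeny o) ⟩
    vol * kemeny H m o + vol * kemeny H m o
      ≡⟨ lemma (vol * kemeny H m o) ⟩
    fromℕ 2 * (vol * kemeny H m o) ∎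
    where
    lemma : ∀ x → x + x ≡ fromℕ 2 * x
    lemma = solve-∀ ℚ-ring

  vol*c≡1 : 1 ℕ.≤ size H → vol * c ≡ 1ℚ
  vol*c≡1 1≤m = trans (cong (_* c) (sym fromℕ-2*size))
    (fromℕ-inverse (2 ℕ.* size H) (ℕₚ.≤-trans 1≤m (ℕₚ.m≤m+n (size H) _)))

  edgeless⇒trivial : size H ≡ 0 → ∀ u v → u ≡ v
  edgeless⇒trivial m≡0 u v = decidable-stable (u ≟ v) λ u≢v →
    ℚₚ.<⇒≢ (ℚₚ.positive⁻¹ 1ℚ) (sym (trans (sym (fromℕ-inverse (degree u) (step-from u≢v)))
      (trans (cong (_* (1ℚ ÷ℕ degree u)) (trans (fromℕ-degree u) deg≡0)) (ℚₚ.*-zeroˡ (1ℚ ÷ℕ degree u)))))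
    where
    deg≡0 : deg u ≡ 0ℚ
    deg≡0 = ∑≡0⇒term≡0 (λ w → ∑-nonNeg (vertices H) (λ x → 𝟙-nonNeg (adj w x)))
      (trans (sym fromℕ-2*size) (cong (λ k → fromℕ (2 ℕ.* k)) m≡0)) (complete u)

  -- The degree terms of `Lap-hit` for the targets v and u cancel in the difference, leaving a
  -- source at u and a sink at v of strength `vol`; the factor `c` normalises it.
  potential : Vertex H → Vertex H → Vertex H → ℚ
  potential u v w = c * (hit w v - hit w u)

  Lap-potential : ∀ u v w → Lap (potential u v) w ≡ δ w u - δ w v
  Lap-potential u v w = begin
    Lap (potential u v) w
      ≡⟨ trans (Lap-* c (λ w → hit w v - hit w u) w)
           (cong (c *_) (Lap-sub (λ w → hit w v) (λ w → hit w u) w)) ⟩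
    c * (Lap (λ w → hit w v) w - Lap (λ w → hit w u) w)
      ≡⟨ cong (c *_) (cong₂ _-_ (Lap-hit v w) (Lap-hit u w)) ⟩
    c * ((deg w - vol * δ w v) - (deg w - vol * δ w u))
      ≡⟨ lemma c (deg w) vol (δ w v) (δ w u) ⟩
    (vol * c) * (δ w u - δ w v)
      ≡⟨ scale (size H) refl ⟩
    δ w u - δ w v ∎
    where
    lemma : ∀ c d n x y → c * ((d - n * x) - (d - n * y)) ≡ (n * c) * (y - x)
    lemma = solve-∀ ℚ-ring
    scale : ∀ k → size H ≡ k → (vol * c) * (δ w u - δ w v) ≡ δ w u - δ w v
    -- Without edges `c` is 0 by the convention for division, but then the connected graph has a
    -- single vertex and the right side is 0 too.
    scale zero    m≡0 = trans (cong (vol * c *_) difference≡0)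
      (trans (ℚₚ.*-zeroʳ (vol * c)) (sym difference≡0))
      where
      difference≡0 : δ w u - δ w v ≡ 0ℚ
      difference≡0 = trans (cong (λ x → δ w u - δ w x) (edgeless⇒trivial m≡0 v u)) (ℚₚ.+-inverseʳ (δ w u))
    scale (suc _) m≡k = trans
      (cong (_* (δ w u - δ w v)) (vol*c≡1 (subst (1 ℕ.≤_) (sym m≡k) (ℕ.s≤s ℕ.z≤n))))
      (ℚₚ.*-identityˡ (δ w u - δ w v))

  R≡potential : ∀ {u v} → R u v ≡ potential u v u - potential u v v
  R≡potential {u} {v} = sym (begin
    c * (hit u v - hit u u) - c * (hit v v - hit v u)
      ≡⟨ cong₂ (λ x y → c * (hit u v - x) - c * (y - hit v u)) (hit-refl u) (hit-refl v) ⟩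
    c * (hit u v - 0ℚ) - c * (0ℚ - hit v u)
      ≡⟨ lemma c (hit u v) (hit v u) ⟩
    R u v ∎)
    where
    lemma : ∀ c x y → c * (x - 0ℚ) - c * (0ℚ - y) ≡ c * (x + y)
    lemma = solve-∀ ℚ-ring

  -- Two potentials of the same unit flow differ by a harmonic function, hence by a constant, so
  -- their differences between u and v agree.
  R-unique : ∀ {u v} {ψ : Vertex H → ℚ} → (∀ w → Lap ψ w ≡ δ w u - δ w v) → R u v ≡ ψ u - ψ v
  R-unique {u} {v} {ψ} Lψ = trans R≡potential (rearrange (p u) (p v) (ψ u) (ψ v)
    (harmonic⇒const connected {f = λ w → p w - ψ w}
      (λ w → trans (Lap-sub p ψ w)
        (trans (cong₂ _-_ (Lap-potential u v w) (Lψ w)) (ℚₚ.+-inverseʳ (δ w u - δ w v))))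
      u v))
    where
    p : Vertex H → ℚ
    p = potential u v
    lemma : ∀ a b x y → (a - b) - (x - y) ≡ (a - x) - (b - y)
    lemma = solve-∀ ℚ-ring
    rearrange : ∀ a b x y → a - x ≡ b - y → a - b ≡ x - y
    rearrange a b x y eq = x-y≡0⇒x≡y (trans (lemma a b x y)
      (trans (cong (_- (b - y)) eq) (ℚₚ.+-inverseʳ (b - y))))

-- Bridges

𝟙-T : ∀ {b} → T b → 𝟙 b ≡ 1ℚ
𝟙-T {true} _ = refl

module _ (H : Graph) (x y : Vertex H) where
  open Graph H using (_≟_; adj; _~_)

  IsEnds : Vertex H → Vertex H → Set
  IsEnds u v = (u ≡ x × v ≡ y) ⊎ (v ≡ x × u ≡ y)

  private
    xy : Vertex H → Vertex H → Bool
    xy u v = does (u ≟ x) ∧ does (v ≟ y)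

    T-xy : ∀ {u v} → T (xy u v) → u ≡ x × v ≡ y
    T-xy {u} {v} t with u ≟ x | v ≟ y
    ... | yes u≡x | yes v≡y = u≡x , v≡y

    xy-T : ∀ {u v} → u ≡ x → v ≡ y → xy u v ≡ true
    xy-T {u} {v} u≡x v≡y = cong₂ _∧_ (dec-true (u ≟ x) u≡x) (dec-true (v ≟ y) v≡y)

    T-split : ∀ a p q → T (a ∧ not (p ∨ q)) → T a × ¬ T p × ¬ T q
    T-split true false false _ = _ , (λ ()) , (λ ())

    T-join : ∀ a p q → T a → ¬ T p → ¬ T q → T (a ∧ not (p ∨ q))
    T-join true true  _     _ ¬p _  = contradiction _ ¬p
    T-join true false true  _ _  ¬q = contradiction _ ¬q
    T-join true false false _ _  _  = _

    𝟙-split : ∀ a p q → (T p → T a) → (T q → T a) → ¬ (T p × T q) →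
              𝟙 a ≡ 𝟙 (a ∧ not (p ∨ q)) + (𝟙 p + 𝟙 q)
    𝟙-split _     true  true  _  _  ¬pq = contradiction _ ¬pq
    𝟙-split true  true  false _  _  _   = refl
    𝟙-split true  false true  _  _  _   = refl
    𝟙-split true  false false _  _  _   = refl
    𝟙-split false true  false p⇒ _  _   = contradiction (p⇒ _) (λ ())
    𝟙-split false false true  _  q⇒ _   = contradiction (q⇒ _) (λ ())
    𝟙-split false false false _  _  _   = refl

  deleteEdge⁻ : ∀ {u v} → Graph._~_ (deleteEdge H x y) u v → u ~ v × ¬ IsEnds u v
  deleteEdge⁻ {u} {v} e =
    let u~v , ¬p , ¬q = T-split (adj u v) (xy u v) (xy v u) e in
    u~v , λ { (inj₁ (u≡x , v≡y)) → ¬p (subst T (sym (xy-T u≡x v≡y)) _)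
            ; (inj₂ (v≡x , u≡y)) → ¬q (subst T (sym (xy-T v≡x u≡y)) _) }

  deleteEdge⁺ : ∀ {u v} → u ~ v → ¬ IsEnds u v → Graph._~_ (deleteEdge H x y) u v
  deleteEdge⁺ {u} {v} u~v ¬ends =
    T-join (adj u v) (xy u v) (xy v u) u~v (¬ends ∘ inj₁ ∘ T-xy) (¬ends ∘ inj₂ ∘ T-xy)

  module Bridge (x~y : x ~ y) (separated : ¬ Reachable (deleteEdge H x y) x y) where
    open Network H
    private
      H′ : Graph
      H′ = deleteEdge H x y
      module H′ = Network H′

    side : Vertex H → ℚ
    side u = ⟦ reachable? H′ x u ⟧

    side-x : side x ≡ 1ℚ
    side-x = ⟦⟧-yes (reachable? H′ x x) ε

    side-y : side y ≡ 0ℚ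
    side-y = ⟦⟧-no (reachable? H′ x y) separated

    side-step : ∀ {u v} → u ~ v → ¬ IsEnds u v → side u ≡ side v
    side-step {u} {v} u~v ¬ends = ⟦⟧-⇔ (reachable? H′ x u) (reachable? H′ x v)
      (_◅◅ (e ◅ ε)) (_◅◅ (subst T (Graph.adj-sym H′ u v) e ◅ ε))
      where
      e : Graph._~_ H′ u v
      e = deleteEdge⁺ u~v ¬ends

    A-split : ∀ u v → A u v ≡ H′.A u v + (δ u x * δ v y + δ u y * δ v x)
    A-split u v = begin
      A u v
        ≡⟨ 𝟙-split (adj u v) (xy u v) (xy v u)
             (λ t → let u≡x , v≡y = T-xy t in subst₂ (λ a b → T (adj a b)) (sym u≡x) (sym v≡y) x~y)
             (λ t → let v≡x , u≡y = T-xy t in subst₂ (λ a b → T (adj a b)) (sym u≡y) (sym v≡x)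
                      (subst T (Graph.adj-sym H x y) x~y))
             (λ (t , t′) → x≢y (trans (sym (proj₁ (T-xy t))) (proj₂ (T-xy t′)))) ⟩
      H′.A u v + (𝟙 (xy u v) + 𝟙 (xy v u))
        ≡⟨ cong (H′.A u v +_) (cong₂ _+_ (𝟙-∧ (does (u ≟ x)) (does (v ≟ y)))
             (trans (𝟙-∧ (does (v ≟ x)) (does (u ≟ y))) (ℚₚ.*-comm (δ v x) (δ u y)))) ⟩
      H′.A u v + (δ u x * δ v y + δ u y * δ v x) ∎
      where
      x≢y : x ≢ y
      x≢y x≡y = subst T (trans (cong (adj x) (sym x≡y)) (Graph.adj-irrefl H x)) x~y

    ∑-A-split : ∀ u (f : Vertex H → ℚ) →
      ∑ᵥ (λ v → A u v * f v) ≡ ∑ᵥ (λ v → H′.A u v * f v) + (δ u x * f y + δ u y * f x)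
    ∑-A-split u f = begin
      ∑ᵥ (λ v → A u v * f v)
        ≡⟨ ∑-cong (vertices H) (λ v → trans (cong (_* f v) (A-split u v))
             (lemma (H′.A u v) (δ u x) (δ v y) (δ u y) (δ v x) (f v))) ⟩
      ∑ᵥ (λ v → H′.A u v * f v + (δ u x * (δ v y * f v) + δ u y * (δ v x * f v)))
        ≡⟨ trans (∑-+ (vertices H) (λ v → H′.A u v * f v) (λ v → δ u x * (δ v y * f v) + δ u y * (δ v x * f v)))
             (cong (∑ᵥ (λ v → H′.A u v * f v) +_)
               (∑-+ (vertices H) (λ v → δ u x * (δ v y * f v)) (λ v → δ u y * (δ v x * f v)))) ⟩
      ∑ᵥ (λ v → H′.A u v * f v) + (∑ᵥ (λ v → δ u x * (δ v y * f v)) + ∑ᵥ (λ v → δ u y * (δ v x * f v)))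
        ≡⟨ cong (∑ᵥ (λ v → H′.A u v * f v) +_) (cong₂ _+_ (collapse (δ u x) y) (collapse (δ u y) x)) ⟩
      ∑ᵥ (λ v → H′.A u v * f v) + (δ u x * f y + δ u y * f x) ∎
      where
      lemma : ∀ a p q r s f → (a + (p * q + r * s)) * f ≡ a * f + (p * (q * f) + r * (s * f))
      lemma = solve-∀ ℚ-ring
      collapse : ∀ k w → ∑ᵥ (λ v → k * (δ v w * f v)) ≡ k * f w
      collapse k w = trans (∑-*ˡ (vertices H) k (λ v → δ v w * f v)) (cong (k *_) (∑ᵥ-δ w f))

    side-along : ∀ u v → H′.A u v * side u ≡ H′.A u v * side v
    side-along u v = 𝟙-cong (Graph.adj H′ u v) λ e →
      let u~v , ¬ends = deleteEdge⁻ e in side-step u~v ¬ends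

    -- An edge other than the bridge has both ends on one side, so only the bridge contributes: 1 at
    -- x and -1 at y.
    Lap-side : ∀ u → Lap side u ≡ δ u x - δ u y
    Lap-side u = begin
      ∑ᵥ (λ v → A u v * (side u - side v))
        ≡⟨ ∑-A-split u (λ v → side u - side v) ⟩
      ∑ᵥ (λ v → H′.A u v * (side u - side v)) + (δ u x * (side u - side y) + δ u y * (side u - side x))
        ≡⟨ cong₂ _+_ (∑-vanish (vertices H) (λ {v} _ → trans (distr (H′.A u v) (side u) (side v))
             (trans (cong (_- H′.A u v * side v) (side-along u v)) (ℚₚ.+-inverseʳ (H′.A u v * side v)))))
             (cong₂ _+_ (⟦⟧-cong (u ≟ x) λ { refl → cong₂ _-_ side-x side-y })
                        (⟦⟧-cong (u ≟ y) λ { refl → cong₂ _-_ side-y side-x })) ⟩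
      0ℚ + (δ u x * (1ℚ - 0ℚ) + δ u y * (0ℚ - 1ℚ))
        ≡⟨ lemma (δ u x) (δ u y) ⟩
      δ u x - δ u y ∎
      where
      distr : ∀ a x y → a * (x - y) ≡ a * x - a * y
      distr = solve-∀ ℚ-ring
      lemma : ∀ a b → 0ℚ + (a * (1ℚ - 0ℚ) + b * (0ℚ - 1ℚ)) ≡ a - b
      lemma = solve-∀ ℚ-ring

    fromℕ-componentSize : fromℕ (componentSize H′ x) ≡ ∑ (edges H′) (λ (u , v) → side u * side v)
    fromℕ-componentSize = trans
      (fromℕ-length (filter inside? (edges H′)))
      (trans (∑-filter inside? (edges H′) (λ _ → 1ℚ))
        (∑-cong (edges H′) λ (u , v) → trans (ℚₚ.*-identityʳ _)
          (𝟙-∧ (does (reachable? H′ x u)) (does (reachable? H′ x v)))))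
      where
      inside? = λ (u , v) → reachable? H′ x u ×-dec reachable? H′ x v

    -- The degrees on the side of x count each edge of the component twice, because an edge of `H′`
    -- with one end on that side has both there (`both`). The bridge is counted once, at x, and
    -- gives the final 1.
    vol-side : ∑ᵥ (λ u → deg u * side u) ≡ fromℕ 2 * fromℕ (componentSize H′ x) + 1ℚ
    vol-side = begin
      ∑ᵥ (λ u → deg u * side u)
        ≡⟨ ∑-cong (vertices H) (λ u → ∑-*ʳ (vertices H) (side u) (A u)) ⟨
      ∑ᵥ (λ u → ∑ᵥ (λ v → A u v * side u))
        ≡⟨ ∑-cong (vertices H) (λ u → ∑-A-split u (λ _ → side u)) ⟩
      ∑ᵥ (λ u → ∑ᵥ (λ v → H′.A u v * side u) + (δ u x * side u + δ u y * side u))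
        ≡⟨ trans (∑-+ (vertices H) (λ u → ∑ᵥ (λ v → H′.A u v * side u)) (λ u → δ u x * side u + δ u y * side u))
             (cong (∑ᵥ (λ u → ∑ᵥ (λ v → H′.A u v * side u)) +_)
               (trans (∑-+ (vertices H) (λ u → δ u x * side u) (λ u → δ u y * side u))
                 (cong₂ _+_ (trans (∑ᵥ-δ x side) side-x) (trans (∑ᵥ-δ y side) side-y)))) ⟩
      ∑ᵥ (λ u → ∑ᵥ (λ v → H′.A u v * side u)) + (1ℚ + 0ℚ)
        ≡⟨ cong (_+ 1ℚ) (∑-cong (vertices H) (λ u → ∑-cong (vertices H) (λ v → both u v))) ⟩
      ∑ᵥ (λ u → ∑ᵥ (λ v → H′.A u v * (side u * side v))) + 1ℚ
        ≡⟨ cong (_+ 1ℚ) (H′.∑-edges (λ u v → side u * side v)) ⟩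
      ∑ (edges H′) (λ (u , v) → side u * side v + side v * side u) + 1ℚ
        ≡⟨ cong (_+ 1ℚ) (trans (∑-cong (edges H′) (λ (u , v) → double (side u) (side v)))
             (trans (∑-*ˡ (edges H′) (fromℕ 2) (λ (u , v) → side u * side v))
               (cong (fromℕ 2 *_) (sym fromℕ-componentSize)))) ⟩
      fromℕ 2 * fromℕ (componentSize H′ x) + 1ℚ ∎
      where
      double : ∀ a b → a * b + b * a ≡ fromℕ 2 * (a * b)
      double = solve-∀ ℚ-ring
      both : ∀ u v → H′.A u v * side u ≡ H′.A u v * (side u * side v)
      both u v = begin
        H′.A u v * side u              ≡⟨ cong (H′.A u v *_) (𝟙-idem (does (reachable? H′ x u))) ⟨
        H′.A u v * (side u * side u)   ≡⟨ assoc (H′.A u v) (side u) (side u) ⟩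
        side u * (H′.A u v * side u)   ≡⟨ cong (side u *_) (side-along u v) ⟩
        side u * (H′.A u v * side v)   ≡⟨ assoc (H′.A u v) (side u) (side v) ⟨
        H′.A u v * (side u * side v)   ∎
        where
        assoc : ∀ a x y → a * (x * y) ≡ x * (a * y)
        assoc = solve-∀ ℚ-ring

-- In a tree the ends of an edge are separated by its deletion

lastOf : {A : Set} → A → List A → A
lastOf x []       = x
lastOf x (y ∷ ys) = lastOf y ys

∷ʳ-lastOf : {A : Set} (x : A) (xs : List A) → ∃[ ys ] x ∷ xs ≡ ys ∷ʳ lastOf x xs
∷ʳ-lastOf x []       = [] , refl
∷ʳ-lastOf x (y ∷ ys) = let zs , eq = ∷ʳ-lastOf y ys in x ∷ zs , cong (x ∷_) eq

module _ (H : Graph) where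
  open Graph H using (_≟_; _~_; adj; adj-sym; adj-irrefl)

  SimplePath : Vertex H → Vertex H → Set
  SimplePath u v = ∃[ xs ] Unique (u ∷ xs) × Linked _~_ (u ∷ xs) × lastOf u xs ≡ v

  suffix : ∀ {u w v} ((xs , _) : SimplePath w v) → u ∈ w ∷ xs → SimplePath u v
  suffix p                                       (here refl) = p
  suffix (x ∷ xs , _ ∷ uniq , _ ∷ linked , last) (there u∈)  = suffix (xs , uniq , linked , last) u∈

  -- If u already lies on the simple path from w, the loop is discarded by passing to the suffix
  -- that starts at u; otherwise u is prepended.
  loop-erase : ∀ {u v} → Reachable H u v → SimplePath u v
  loop-erase ε = [] , [] ∷ [] , [-] , refl
  loop-erase {u} (_◅_ {j = w} u~w w⇝v) with loop-erase w⇝v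
  ... | p@(xs , uniq , linked , last) with any? (u ≟_) (w ∷ xs)
  ...   | yes u∈ = suffix p u∈
  ...   | no u∉  = w ∷ xs , ¬Any⇒All¬ (w ∷ xs) u∉ ∷ uniq , u~w ∷ linked , last

-- A simple path from i to j that avoids the edge i ~ j has at least three vertices: one vertex
-- would mean a loop at i, two would mean the deleted edge itself. Closed up by i ~ j, it is a
-- cycle.
acyclic⇒separated : ∀ (H : Graph) → Acyclic H → ∀ {i j} → Graph._~_ H i j → ¬ Reachable (deleteEdge H i j) i j
acyclic⇒separated H acyclic {i} {j} i~j i⇝j with loop-erase (deleteEdge H i j) i⇝j
... | [] , _ , _ , refl = subst T (Graph.adj-irrefl H i) i~j
... | z ∷ [] , _ , e ∷ _ , refl = proj₂ (deleteEdge⁻ H i j e) (inj₁ (refl , refl))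
... | z ∷ y ∷ ys , uniq , linked , refl with ∷ʳ-lastOf y ys
...   | zs , eq = acyclic i z zs (lastOf y ys)
        (subst (λ l → Unique (i ∷ z ∷ l)) eq uniq)
        (subst (λ l → Linked (Graph._~_ H) (i ∷ z ∷ l)) eq
          (Linked.map (proj₁ ∘ deleteEdge⁻ H i j) linked))
        (subst T (Graph.adj-sym H i j) i~j)

-- The chain as a graph: sides of bridges and gates of blocks

module ChainWalk
  (𝒯 : Graph) (tree : IsTree 𝒯) (G : Vertex 𝒯 → Graph) (G-connected : ∀ i → Connected (G i))
  (at : (i j : Vertex 𝒯) → Vertex (G i))
  where

  open Chain 𝒯 G at hiding (module 𝒯; module G)
  module 𝒯 where
    open Graph 𝒯 public
    open Network 𝒯 public
  module G (i : Vertex 𝒯) where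
    open Graph (G i) public
    open Network (G i) public
  module C where
    open Graph chain public
    open Network chain public

  end : Vertex 𝒯 → Vertex 𝒯 → V
  end i j = i , at i j

  -- An inductive view of adjacency in the chain: the Boolean definition compares indices of
  -- dependent pairs, while matching on `Step` exposes the block or the bridge at once.
  data Step : V → V → Set where
    inside : ∀ {k a b} → T (G.adj k a b) → Step (k , a) (k , b)
    across : ∀ {k l} → k 𝒯.~ l → Step (end k l) (end l k)

  internal-same : ∀ k a b → internal (k , a) (k , b) ≡ G.adj k a b
  internal-same k a b with k 𝒯.≟ k
  ... | yes refl = refl
  ... | no k≢k   = contradiction refl k≢k

  internal-diff : ∀ {k l} a b → k ≢ l → internal (k , a) (l , b) ≡ false
  internal-diff {k} {l} a b k≢l with k 𝒯.≟ l
  ... | yes refl = contradiction refl k≢l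
  ... | no _     = refl

  bridge-refl : ∀ {k l} → k 𝒯.~ l → T (bridge (end k l) (end l k))
  bridge-refl {k} {l} k~l = subst T (sym (cong₂ _∧_ (T⇒≡true k~l)
    (cong₂ _∧_ (dec-true (G._≟_ k (at k l) (at k l)) refl) (dec-true (G._≟_ l (at l k) (at l k)) refl)))) _
    where
    T⇒≡true : ∀ {b} → T b → b ≡ true
    T⇒≡true {true} _ = refl

  T-∨ˡ : ∀ {a} b → T a → T (a ∨ b)
  T-∨ˡ {true} _ _ = _

  T-∨ʳ : ∀ a {b} → T b → T (a ∨ b)
  T-∨ʳ true  _ = _
  T-∨ʳ false t = t

  step⇒adj : ∀ {u v} → Step u v → u C.~ v
  step⇒adj (inside {k} {a} {b} e) =
    T-∨ˡ (bridge (k , a) (k , b)) (subst T (sym (internal-same k a b)) e)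
  step⇒adj (across {k} {l} k~l) = T-∨ʳ (internal (end k l) (end l k)) (bridge-refl k~l)

  internal⇒step : ∀ u v → T (internal u v) → Step u v
  internal⇒step (k , a) (l , b) e with k 𝒯.≟ l
  ... | yes refl = inside e
  ... | no _     = ⊥-elim e

  bridge⇒step : ∀ u v → T (bridge u v) → Step u v
  bridge⇒step (k , a) (l , b) e with 𝒯.adj k l in k~l | G._≟_ k a (at k l) | G._≟_ l b (at l k)
  ... | true | yes refl | yes refl = across (subst T (sym k~l) _)

  adj⇒step : ∀ {u v} → u C.~ v → Step u v
  adj⇒step {u} {v} e with internal u v in eq
  ... | true  = internal⇒step u v (subst T (sym eq) _)
  ... | false = bridge⇒step u v e

  inside-walk : ∀ {k a b} → Reachable (G k) a b → Reachable chain (k , a) (k , b)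
  inside-walk ε       = ε
  inside-walk (e ◅ p) = step⇒adj (inside e) ◅ inside-walk p

  inside-connected : ∀ k a b → Reachable chain (k , a) (k , b)
  inside-connected k a b = inside-walk (proj₂ (G-connected k) a b)

  lift-walk : ∀ {k l} → Reachable 𝒯 k l → ∀ a b → Reachable chain (k , a) (l , b)
  lift-walk {k} ε a b = inside-connected k a b
  lift-walk {k} (_◅_ {j = j} k~j p) a b =
    inside-connected k a (at k j) ◅◅ (step⇒adj (across k~j) ◅ lift-walk p (at j k) b)

  chain-connected : Connected chain
  chain-connected = (proj₁ (proj₁ tree) , proj₁ (G-connected _)) ,
    λ (k , a) (l , b) → lift-walk (proj₂ (proj₁ tree) k l) a b

  ¬self-adjacent : ∀ {k l} → k ≡ l → ¬ k 𝒯.~ l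
  ¬self-adjacent {k} refl k~k = subst T (𝒯.adj-irrefl k) k~k

  ~-sym : ∀ {k l} → k 𝒯.~ l → l 𝒯.~ k
  ~-sym {k} {l} = subst T (𝒯.adj-sym k l)

  inside-¬ends : ∀ {i j k a b} → i 𝒯.~ j → ¬ IsEnds chain (end i j) (end j i) (k , a) (k , b)
  inside-¬ends i~j (inj₁ (refl , eq)) = ¬self-adjacent (cong proj₁ eq) i~j
  inside-¬ends i~j (inj₂ (refl , eq)) = ¬self-adjacent (cong proj₁ eq) i~j

  -- Steps inside a block project to no step, and a bridge other than the deleted one projects to a
  -- tree edge other than i ~ j. Separation in the tree thus carries over to the chain.
  project-walk : ∀ {i j u v} → Reachable (deleteEdge chain (end i j) (end j i)) u v →
                 Reachable (deleteEdge 𝒯 i j) (proj₁ u) (proj₁ v)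
  project-walk ε = ε
  project-walk {i} {j} {u} (_◅_ {j = w} e p) =
    let u~w , ¬ends = deleteEdge⁻ chain (end i j) (end j i) e in
    project-step (adj⇒step u~w) ¬ends ◅◅ project-walk p
    where
    project-step : ∀ {u w} → Step u w → ¬ IsEnds chain (end i j) (end j i) u w →
                   Reachable (deleteEdge 𝒯 i j) (proj₁ u) (proj₁ w)
    project-step (inside _)   _     = ε
    project-step (across k~l) ¬ends = deleteEdge⁺ 𝒯 i j k~l
      (λ { (inj₁ (refl , refl)) → ¬ends (inj₁ (refl , refl))
         ; (inj₂ (refl , refl)) → ¬ends (inj₂ (refl , refl)) }) ◅ ε

  separated : ∀ {i j} → i 𝒯.~ j →
              ¬ Reachable (deleteEdge chain (end i j) (end j i)) (end i j) (end j i)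
  separated i~j p = acyclic⇒separated 𝒯 (proj₂ tree) i~j (project-walk p)

  -- S i j is the indicator of the side of (i , at i j) of the bridge of i ~ j.
  S : Vertex 𝒯 → Vertex 𝒯 → V → ℚ
  S i j u = ⟦ reachable? (deleteEdge chain (end i j) (end j i)) (end i j) u ⟧

  module _ {i j} (i~j : i 𝒯.~ j) where
    open Bridge chain (end i j) (end j i) (step⇒adj (across i~j)) (separated i~j)

    S-near : S i j (end i j) ≡ 1ℚ
    S-near = side-x

    S-far : S i j (end j i) ≡ 0ℚ
    S-far = side-y

    S-step : ∀ {u v} → Step u v → ¬ IsEnds chain (end i j) (end j i) u v → S i j u ≡ S i j v
    S-step s = side-step (step⇒adj s)

    S-inside : ∀ k a b → S i j (k , a) ≡ S i j (k , b)
    S-inside k a b = along (proj₂ (G-connected k) a b)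
      where
      along : ∀ {a b} → Reachable (G k) a b → S i j (k , a) ≡ S i j (k , b)
      along ε       = refl
      along (e ◅ p) = trans (S-step (inside e) (inside-¬ends i~j)) (along p)

    S-across : ∀ {k l} → k 𝒯.~ l → ¬ IsEnds 𝒯 i j k l → S i j (end k l) ≡ S i j (end l k)
    S-across k~l ¬ends = S-step (across k~l) λ
      { (inj₁ (p , q)) → ¬ends (inj₁ (cong proj₁ p , cong proj₁ q))
      ; (inj₂ (p , q)) → ¬ends (inj₂ (cong proj₁ p , cong proj₁ q)) }

    Lap-S : ∀ u → C.Lap (S i j) u ≡ C.δ u (end i j) - C.δ u (end j i)
    Lap-S = Lap-side

    vol-S : C.∑ᵥ (λ u → C.deg u * S i j u) ≡ fromℕ 2 * fromℕ (W i j) + 1ℚ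
    vol-S = vol-side

  -- `S i j` and `S j i` refer to deletions with exchanged ends, which are not definitionally the
  -- same graph, so complementarity is propagated along walks instead: the bridge exchanges the
  -- values 1 and 0, and any other step changes neither.
  S-opposite : ∀ {i j} → i 𝒯.~ j → ∀ u → S i j u + S j i u ≡ 1ℚ
  S-opposite {i} {j} i~j u = trans (along (proj₂ chain-connected u (end i j)))
    (cong₂ _+_ (S-near i~j) (S-far (~-sym i~j)))
    where
    total : V → ℚ
    total u = S i j u + S j i u
    step : ∀ {u v} → Step u v → total u ≡ total v
    step (inside {k} {a} {b} _) = cong₂ _+_ (S-inside i~j k a b) (S-inside (~-sym i~j) k a b)
    step (across {k} {l} k~l) with (k 𝒯.≟ i ×-dec l 𝒯.≟ j) ⊎-dec (l 𝒯.≟ i ×-dec k 𝒯.≟ j)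
    ... | yes (inj₁ (refl , refl)) = trans (cong₂ _+_ (S-near i~j) (S-far (~-sym i~j)))
            (sym (cong₂ _+_ (S-far i~j) (S-near (~-sym i~j))))
    ... | yes (inj₂ (refl , refl)) = trans (cong₂ _+_ (S-far i~j) (S-near (~-sym i~j)))
            (sym (cong₂ _+_ (S-near i~j) (S-far (~-sym i~j))))
    ... | no ¬ends = cong₂ _+_ (S-across i~j k~l ¬ends)
            (S-across (~-sym i~j) k~l (¬ends ∘ λ { (inj₁ (p , q)) → inj₂ (q , p) ; (inj₂ (p , q)) → inj₁ (q , p) }))
    along : ∀ {u v} → Reachable chain u v → total u ≡ total v
    along ε       = refl
    along (e ◅ p) = trans (step (adj⇒step e)) (along p)

  ∑-chain : ∀ (F : V → ℚ) → C.∑ᵥ F ≡ 𝒯.∑ᵥ (λ k → G.∑ᵥ k (λ a → F (k , a)))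
  ∑-chain F = trans (∑-concatMap block (vertices 𝒯) F)
    (∑-cong (vertices 𝒯) λ k → ∑-map (k ,_) (vertices (G k)) F)

  A-chain : ∀ u v → C.A u v ≡ 𝟙 (internal u v) + 𝟙 (bridge u v)
  A-chain u@(k , a) v@(l , b) = 𝟙-∨ (internal u v) (bridge u v) λ (i , br) →
    ¬self-adjacent (same i) (adjacent br)
    where
    𝟙-∨ : ∀ p q → ¬ (T p × T q) → 𝟙 (p ∨ q) ≡ 𝟙 p + 𝟙 q
    𝟙-∨ true  true  ¬pq = contradiction _ ¬pq
    𝟙-∨ true  false _   = refl
    𝟙-∨ false true  _   = refl
    𝟙-∨ false false _   = refl
    same : T (internal u v) → k ≡ l
    same e with k 𝒯.≟ l
    ... | yes k≡l = k≡l
    ... | no _    = ⊥-elim e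
    adjacent : T (bridge u v) → k 𝒯.~ l
    adjacent e with 𝒯.adj k l
    ... | true = _

  ∑-A-chain : ∀ k a (F : V → ℚ) → C.∑ᵥ (λ v → C.A (k , a) v * F v) ≡
    G.∑ᵥ k (λ b → G.A k a b * F (k , b)) + 𝒯.∑ᵥ (λ l → 𝒯.A k l * (G.δ k a (at k l) * F (end l k)))
  ∑-A-chain k a F = begin
    C.∑ᵥ (λ v → C.A (k , a) v * F v)
      ≡⟨ ∑-cong C.vertices (λ v → trans (cong (_* F v) (A-chain (k , a) v))
           (ℚₚ.*-distribʳ-+ (F v) (𝟙 (internal (k , a) v)) (𝟙 (bridge (k , a) v)))) ⟩
    C.∑ᵥ (λ v → I v + B v)
      ≡⟨ trans (∑-+ C.vertices I B) (cong₂ _+_ (∑-chain I) (∑-chain B)) ⟩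
    𝒯.∑ᵥ (λ l → G.∑ᵥ l (λ b → I (l , b))) + 𝒯.∑ᵥ (λ l → G.∑ᵥ l (λ b → B (l , b)))
      ≡⟨ cong₂ _+_
           (trans (𝒯.∑ᵥ-single k (λ {l} l≢k → ∑-vanish (vertices (G l)) λ {b} _ →
              trans (cong (λ x → 𝟙 x * F (l , b)) (internal-diff a b (l≢k ∘ sym))) (ℚₚ.*-zeroˡ (F (l , b)))))
             (∑-cong (vertices (G k)) λ b → cong (λ x → 𝟙 x * F (k , b)) (internal-same k a b)))
           (∑-cong (vertices 𝒯) across-sum) ⟩
    G.∑ᵥ k (λ b → G.A k a b * F (k , b)) + 𝒯.∑ᵥ (λ l → 𝒯.A k l * (G.δ k a (at k l) * F (end l k))) ∎
    where
    I B : V → ℚ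
    I v = 𝟙 (internal (k , a) v) * F v
    B v = 𝟙 (bridge (k , a) v) * F v
    across-sum : ∀ l → G.∑ᵥ l (λ b → B (l , b)) ≡ 𝒯.A k l * (G.δ k a (at k l) * F (end l k))
    across-sum l = begin
      G.∑ᵥ l (λ b → B (l , b))
        ≡⟨ ∑-cong (vertices (G l)) (λ b → trans (cong (_* F (l , b))
             (trans (𝟙-∧ (𝒯.adj k l) _) (cong (𝒯.A k l *_) (𝟙-∧ (does (G._≟_ k a (at k l))) _))))
             (lemma (𝒯.A k l) (G.δ k a (at k l)) (G.δ l b (at l k)) (F (l , b)))) ⟩
      G.∑ᵥ l (λ b → 𝒯.A k l * (G.δ k a (at k l) * (G.δ l b (at l k) * F (l , b))))
        ≡⟨ trans (∑-*ˡ (vertices (G l)) (𝒯.A k l) (λ b → G.δ k a (at k l) * (G.δ l b (at l k) * F (l , b))))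
             (cong (𝒯.A k l *_) (trans
               (∑-*ˡ (vertices (G l)) (G.δ k a (at k l)) (λ b → G.δ l b (at l k) * F (l , b)))
               (cong (G.δ k a (at k l) *_) (G.∑ᵥ-δ l (at l k) (λ b → F (l , b)))))) ⟩
      𝒯.A k l * (G.δ k a (at k l) * F (end l k)) ∎
      where
      lemma : ∀ x y z f → (x * (y * z)) * f ≡ x * (y * (z * f))
      lemma = solve-∀ ℚ-ring

  deg-chain : ∀ k a → C.deg (k , a) ≡ G.deg k a + 𝒯.∑ᵥ (λ l → 𝒯.A k l * G.δ k a (at k l))
  deg-chain k a = begin
    C.deg (k , a)
      ≡⟨ ∑-cong C.vertices (λ v → ℚₚ.*-identityʳ (C.A (k , a) v)) ⟨
    C.∑ᵥ (λ v → C.A (k , a) v * 1ℚ)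
      ≡⟨ ∑-A-chain k a (λ _ → 1ℚ) ⟩
    G.∑ᵥ k (λ b → G.A k a b * 1ℚ) + 𝒯.∑ᵥ (λ l → 𝒯.A k l * (G.δ k a (at k l) * 1ℚ))
      ≡⟨ cong₂ _+_ (∑-cong (vertices (G k)) λ b → ℚₚ.*-identityʳ (G.A k a b))
           (∑-cong (vertices 𝒯) λ l → cong (𝒯.A k l *_) (ℚₚ.*-identityʳ (G.δ k a (at k l)))) ⟩
    G.deg k a + 𝒯.∑ᵥ (λ l → 𝒯.A k l * G.δ k a (at k l)) ∎

  -- Functions on a block, extended to the chain along the gate of the block: every vertex of the
  -- chain outside the block i is attached to it through one of its bridges.

  local : ∀ i → (Vertex (G i) → ℚ) → V → ℚ
  local i φ (k , a) with i 𝒯.≟ k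
  ... | yes refl = φ a
  ... | no _     = 0ℚ

  local-same : ∀ i φ a → local i φ (i , a) ≡ φ a
  local-same i φ a with i 𝒯.≟ i
  ... | yes refl = refl
  ... | no i≢i   = contradiction refl i≢i

  local-diff : ∀ {i k} φ a → i ≢ k → local i φ (k , a) ≡ 0ℚ
  local-diff {i} {k} φ a i≢k with i 𝒯.≟ k
  ... | yes i≡k = contradiction i≡k i≢k
  ... | no _    = refl

  -- The value of φ at the gate of u, linear in φ. Inside block i every `S j i` is 0; elsewhere the
  -- local part is 0 and the neighbour j of i beyond whose bridge u lies contributes its end.
  lift : ∀ i → (Vertex (G i) → ℚ) → V → ℚ
  lift i φ u = local i φ u + 𝒯.∑ᵥ (λ j → 𝒯.A i j * (S j i u * φ (at i j)))

  lift-home : ∀ i φ a → lift i φ (i , a) ≡ φ a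
  lift-home i φ a = trans (cong₂ _+_ (local-same i φ a) (∑-vanish (vertices 𝒯) λ {j} _ →
    trans (𝟙-cong (𝒯.adj i j) λ i~j → trans
      (cong (_* φ (at i j)) (trans (S-inside (~-sym i~j) i a (at i j)) (S-far (~-sym i~j))))
      (ℚₚ.*-zeroˡ (φ (at i j))))
    (ℚₚ.*-zeroʳ (𝒯.A i j)))) (ℚₚ.+-identityʳ (φ a))

  lift-inside : ∀ {i k} φ a b → i ≢ k → lift i φ (k , a) ≡ lift i φ (k , b)
  lift-inside {i} {k} φ a b i≢k = cong₂ _+_
    (trans (local-diff φ a i≢k) (sym (local-diff φ b i≢k)))
    (∑-cong (vertices 𝒯) λ j → 𝟙-cong (𝒯.adj i j) λ i~j →
      cong (_* φ (at i j)) (S-inside (~-sym i~j) k a b))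

  -- The far end of the bridge i ~ l lies beyond this bridge and on the side of i for every other
  -- bridge at i, so a single term survives.
  lift-next : ∀ {i l} φ → i 𝒯.~ l → lift i φ (end l i) ≡ φ (at i l)
  lift-next {i} {l} φ i~l = begin
    local i φ (end l i) + 𝒯.∑ᵥ (λ j → 𝒯.A i j * (S j i (end l i) * φ (at i j)))
      ≡⟨ cong₂ _+_ (local-diff φ (at l i) (λ i≡l → ¬self-adjacent i≡l i~l)) (𝒯.∑ᵥ-single l off) ⟩
    0ℚ + 𝒯.A i l * (S l i (end l i) * φ (at i l))
      ≡⟨ cong₂ (λ x y → 0ℚ + x * (y * φ (at i l))) (𝟙-T i~l) (S-near (~-sym i~l)) ⟩
    0ℚ + 1ℚ * (1ℚ * φ (at i l))
      ≡⟨ lemma (φ (at i l)) ⟩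
    φ (at i l) ∎
    where
    lemma : ∀ x → 0ℚ + 1ℚ * (1ℚ * x) ≡ x
    lemma = solve-∀ ℚ-ring
    off : ∀ {j} → j ≢ l → 𝒯.A i j * (S j i (end l i) * φ (at i j)) ≡ 0ℚ
    off {j} j≢l = trans (𝟙-cong (𝒯.adj i j) λ i~j → trans (cong (_* φ (at i j)) (begin
        S j i (end l i)   ≡⟨ S-across (~-sym i~j) i~l (λ
                              { (inj₁ (i≡j , _)) → ¬self-adjacent i≡j i~j
                              ; (inj₂ (l≡j , _)) → j≢l (sym l≡j) }) ⟨
        S j i (end i l)   ≡⟨ S-inside (~-sym i~j) i (at i l) (at i j) ⟩
        S j i (end i j)   ≡⟨ S-far (~-sym i~j) ⟩
        0ℚ                ∎)) (ℚₚ.*-zeroˡ (φ (at i j))))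
      (ℚₚ.*-zeroʳ (𝒯.A i j))

  -- If the bridge is at block i, its end in that block is the gate of both ends. Otherwise it lies
  -- wholly on one side of each bridge at block i.
  lift-across : ∀ {k l} i φ → k 𝒯.~ l → lift i φ (end k l) ≡ lift i φ (end l k)
  lift-across {k} {l} i φ k~l = go (i 𝒯.≟ k) (i 𝒯.≟ l)
    where
    go : Dec (i ≡ k) → Dec (i ≡ l) → lift i φ (end k l) ≡ lift i φ (end l k)
    go (yes refl) _          = trans (lift-home i φ (at i l)) (sym (lift-next φ k~l))
    go (no _)     (yes refl) = trans (lift-next φ (~-sym k~l)) (sym (lift-home i φ (at i k)))
    go (no i≢k)   (no i≢l)   = cong₂ _+_
      (trans (local-diff φ (at k l) i≢k) (sym (local-diff φ (at l k) i≢l)))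
      (∑-cong (vertices 𝒯) λ j → 𝟙-cong (𝒯.adj i j) λ i~j →
        cong (_* φ (at i j)) (S-across (~-sym i~j) k~l λ
          { (inj₁ (_ , l≡i)) → i≢l (sym l≡i) ; (inj₂ (_ , k≡i)) → i≢k (sym k≡i) }))

  -- One p serves all φ, which determines it (take indicators for φ) and lets evaluation at p
  -- replace `lift`. It is carried along a walk that starts in block i: steps inside that block move
  -- it, all others leave it in place.
  gate : ∀ i u → ∃[ p ] (∀ φ → lift i φ u ≡ φ p)
  gate i u = along (proj₂ chain-connected (i , proj₁ (G-connected i)) u)
    (proj₁ (G-connected i) , λ φ → lift-home i φ (proj₁ (G-connected i)))
    where
    Gate : V → Set
    Gate v = ∃[ p ] (∀ φ → lift i φ v ≡ φ p)
    step : ∀ {u v} → Step u v → Gate u → Gate v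
    step (across k~l) (p , lift≡) = p , λ φ → trans (sym (lift-across i φ k~l)) (lift≡ φ)
    step (inside {k} {a} {b} _) (p , lift≡) = case i 𝒯.≟ k of λ
      { (yes refl) → b , λ φ → lift-home i φ b
      ; (no i≢k)   → p , λ φ → trans (lift-inside φ b a i≢k) (lift≡ φ) }
    along : ∀ {u v} → Reachable chain u v → Gate u → Gate v
    along ε       g = g
    along (e ◅ p) g = along p (step (adj⇒step e) g)

  p[_] : ∀ i → V → Vertex (G i)
  p[ i ] u = proj₁ (gate i u)

  lift≡ : ∀ i φ u → lift i φ u ≡ φ (p[ i ] u)
  lift≡ i φ u = proj₂ (gate i u) φ

  -- A lift agrees at the two ends of every bridge and is constant on every other block, so only
  -- edges of `G i` contribute.
  Lap-lift : ∀ i φ u → C.Lap (lift i φ) u ≡ local i (G.Lap i φ) u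
  Lap-lift i φ (k , a) = begin
    C.Lap (lift i φ) (k , a)
      ≡⟨ ∑-A-chain k a (λ v → lift i φ (k , a) - lift i φ v) ⟩
    G.∑ᵥ k (λ b → G.A k a b * (lift i φ (k , a) - lift i φ (k , b)))
      + 𝒯.∑ᵥ (λ l → 𝒯.A k l * (G.δ k a (at k l) * (lift i φ (k , a) - lift i φ (end l k))))
      ≡⟨ cong₂ _+_ inner (∑-vanish (vertices 𝒯) λ {l} _ → outer l) ⟩
    local i (G.Lap i φ) (k , a) + 0ℚ
      ≡⟨ ℚₚ.+-identityʳ _ ⟩
    local i (G.Lap i φ) (k , a) ∎
    where
    outer : ∀ l → 𝒯.A k l * (G.δ k a (at k l) * (lift i φ (k , a) - lift i φ (end l k))) ≡ 0ℚ
    outer l = trans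
      (𝟙-cong (𝒯.adj k l) λ k~l → trans
        (⟦⟧-cong (G._≟_ k a (at k l)) λ { refl → trans
          (cong (_- lift i φ (end l k)) (lift-across i φ k~l)) (ℚₚ.+-inverseʳ (lift i φ (end l k))) })
        (ℚₚ.*-zeroʳ (G.δ k a (at k l))))
      (ℚₚ.*-zeroʳ (𝒯.A k l))
    inner : G.∑ᵥ k (λ b → G.A k a b * (lift i φ (k , a) - lift i φ (k , b))) ≡ local i (G.Lap i φ) (k , a)
    inner = case i 𝒯.≟ k of λ
      { (yes refl) → trans
          (∑-cong (vertices (G k)) λ b → cong (G.A k a b *_) (cong₂ _-_ (lift-home k φ a) (lift-home k φ b)))
          (sym (local-same k (G.Lap k φ) a))
      ; (no i≢k) → trans
          (∑-vanish (vertices (G k)) λ {b} _ → trans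
            (cong (G.A k a b *_) (trans (cong (_- lift i φ (k , b)) (lift-inside φ a b i≢k))
              (ℚₚ.+-inverseʳ (lift i φ (k , b)))))
            (ℚₚ.*-zeroʳ (G.A k a b)))
          (sym (local-diff (G.Lap i φ) a i≢k)) }

-- Resistance in the chain and its sum against degrees

module ChainKemeny
  (𝒯 : Graph) (tree : IsTree 𝒯) (G : Vertex 𝒯 → Graph) (G-connected : ∀ i → Connected (G i))
  (at : (i j : Vertex 𝒯) → Vertex (G i))
  (m : MeanFirstPassage (Chain.chain 𝒯 G at)) (mᵢ : ∀ i → MeanFirstPassage (G i))
  where

  open Chain 𝒯 G at hiding (module 𝒯; module G)
  open ChainWalk 𝒯 tree G G-connected at

  module RC = RandomWalk chain chain-connected m
  module RG (i : Vertex 𝒯) = RandomWalk (G i) (G-connected i) (mᵢ i)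

  δ-chain : ∀ k a u → C.δ (k , a) u ≡ local k (λ b → G.δ k a b) u
  δ-chain k a (l , b) = case k 𝒯.≟ l of λ
    { (yes refl) → trans (⟦⟧-⇔ (C._≟_ (k , a) (k , b)) (G._≟_ k a b) (λ { refl → refl }) (λ { refl → refl }))
        (sym (local-same k (λ b → G.δ k a b) b))
    ; (no k≢l)   → trans (⟦⟧-no (C._≟_ (k , a) (l , b)) (λ { refl → k≢l refl }))
        (sym (local-diff (λ b → G.δ k a b) b k≢l)) }

  module _ (u v : V) where

    private
      s : Vertex 𝒯 → Vertex 𝒯 → ℚ
      s i j = S i j u - S i j v

      pot : ∀ i → Vertex (G i) → ℚ
      pot i = RG.potential i (p[ i ] u) (p[ i ] v)

      -- The potential of a unit flow from u to v: within each block the flow runs between the gates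
      -- of u and v, and a bridge carries the signed amount `s i j`, which is 1, -1 or 0.
      ψ₁ ψ₂ ψ : V → ℚ
      ψ₁ w = 𝒯.∑ᵥ (λ i → lift i (pot i) w)
      ψ₂ w = ∑ bridges (λ (i , j) → s i j * S i j w)
      ψ w = ψ₁ w + ψ₂ w

      s-opposite : ∀ {i j} → i 𝒯.~ j → s j i ≡ - s i j
      s-opposite {i} {j} i~j = x-y≡0⇒x≡y (begin
        (S j i u - S j i v) - - (S i j u - S i j v)
          ≡⟨ lemma (S j i u) (S j i v) (S i j u) (S i j v) ⟩
        (S i j u + S j i u) - (S i j v + S j i v)
          ≡⟨ cong₂ _-_ (S-opposite i~j u) (S-opposite i~j v) ⟩
        0ℚ ∎)
        where
        lemma : ∀ a b c d → (a - b) - - (c - d) ≡ (c + a) - (d + b)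
        lemma = solve-∀ ℚ-ring

      -- Counts the bridges attached at the vertex a of block k beyond which w lies.
      through : V → ∀ k → Vertex (G k) → ℚ
      through w k a = 𝒯.∑ᵥ (λ j → 𝒯.A k j * (S j k w * G.δ k a (at k j)))

      -- `lift≡` applied to an indicator: a is the gate of w if w is a itself or lies beyond a
      -- bridge attached at a.
      δ-gate : ∀ k a w → G.δ k a (p[ k ] w) ≡ C.δ (k , a) w + through w k a
      δ-gate k a w = trans (sym (lift≡ k (λ b → G.δ k a b) w))
        (cong (_+ through w k a) (sym (δ-chain k a w)))

      Lap-ψ₁ : ∀ k a → C.Lap ψ₁ (k , a) ≡
               (C.δ (k , a) u + through u k a) - (C.δ (k , a) v + through v k a)
      Lap-ψ₁ k a = begin
        C.Lap ψ₁ (k , a)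
          ≡⟨ C.Lap-∑ (vertices 𝒯) (λ i → lift i (pot i)) (k , a) ⟩
        𝒯.∑ᵥ (λ i → C.Lap (lift i (pot i)) (k , a))
          ≡⟨ ∑-cong (vertices 𝒯) (λ i → Lap-lift i (pot i) (k , a)) ⟩
        𝒯.∑ᵥ (λ i → local i (G.Lap i (pot i)) (k , a))
          ≡⟨ 𝒯.∑ᵥ-single k (λ {i} i≢k → local-diff (G.Lap i (pot i)) a i≢k) ⟩
        local k (G.Lap k (pot k)) (k , a)
          ≡⟨ local-same k (G.Lap k (pot k)) a ⟩
        G.Lap k (pot k) a
          ≡⟨ RG.Lap-potential k (p[ k ] u) (p[ k ] v) a ⟩
        G.δ k a (p[ k ] u) - G.δ k a (p[ k ] v)
          ≡⟨ cong₂ _-_ (δ-gate k a u) (δ-gate k a v) ⟩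
        (C.δ (k , a) u + through u k a) - (C.δ (k , a) v + through v k a) ∎

      -- A bridge is listed in one orientation, but `s-opposite` makes its contribution symmetric in
      -- its ends. The sum becomes one over ordered adjacent pairs, of which those starting at k
      -- remain.
      Lap-ψ₂ : ∀ k a → C.Lap ψ₂ (k , a) ≡ 𝒯.∑ᵥ (λ j → 𝒯.A k j * (s k j * G.δ k a (at k j)))
      Lap-ψ₂ k a = begin
        C.Lap ψ₂ (k , a)
          ≡⟨ C.Lap-∑ bridges (λ (i , j) w → s i j * S i j w) (k , a) ⟩
        ∑ bridges (λ (i , j) → C.Lap (λ w → s i j * S i j w) (k , a))
          ≡⟨ 𝒯.∑-edges-cong (λ i j → C.Lap (λ w → s i j * S i j w) (k , a)) (λ i j → f i j + f j i) edge ⟩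
        ∑ bridges (λ (i , j) → f i j + f j i)
          ≡⟨ 𝒯.∑-edges f ⟨
        𝒯.∑ᵥ (λ i → 𝒯.∑ᵥ (λ j → 𝒯.A i j * f i j))
          ≡⟨ 𝒯.∑ᵥ-single k (λ {i} i≢k → ∑-vanish (vertices 𝒯) λ {j} _ → trans
               (cong (λ x → 𝒯.A i j * (s i j * x)) (⟦⟧-no (C._≟_ (k , a) (end i j)) λ { refl → i≢k refl }))
               (vanish (𝒯.A i j) (s i j))) ⟩
        𝒯.∑ᵥ (λ j → 𝒯.A k j * f k j)
          ≡⟨ ∑-cong (vertices 𝒯) (λ j → cong (λ x → 𝒯.A k j * (s k j * x))
               (trans (δ-chain k a (end k j)) (local-same k (λ b → G.δ k a b) (at k j)))) ⟩
        𝒯.∑ᵥ (λ j → 𝒯.A k j * (s k j * G.δ k a (at k j))) ∎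
        where
        f : Vertex 𝒯 → Vertex 𝒯 → ℚ
        f i j = s i j * C.δ (k , a) (end i j)
        vanish : ∀ x y → x * (y * 0ℚ) ≡ 0ℚ
        vanish = solve-∀ ℚ-ring
        lemma : ∀ x y z → x * (y - z) ≡ x * y + (- x) * z
        lemma = solve-∀ ℚ-ring
        edge : ∀ {i j} → i 𝒯.~ j → C.Lap (λ w → s i j * S i j w) (k , a) ≡ f i j + f j i
        edge {i} {j} i~j = begin
          C.Lap (λ w → s i j * S i j w) (k , a)
            ≡⟨ trans (C.Lap-* (s i j) (S i j) (k , a)) (cong (s i j *_) (Lap-S i~j (k , a))) ⟩
          s i j * (C.δ (k , a) (end i j) - C.δ (k , a) (end j i))
            ≡⟨ lemma (s i j) (C.δ (k , a) (end i j)) (C.δ (k , a) (end j i)) ⟩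
          f i j + (- s i j) * C.δ (k , a) (end j i)
            ≡⟨ cong (λ x → f i j + x * C.δ (k , a) (end j i)) (s-opposite i~j) ⟨
          f i j + f j i ∎

      -- The block potentials leave sources and sinks at the gates of u and v; the bridge currents
      -- remove them, because s k j = -(S j k u - S j k v).
      Lap-ψ : ∀ w → C.Lap ψ w ≡ C.δ w u - C.δ w v
      Lap-ψ (k , a) = begin
        C.Lap ψ (k , a)
          ≡⟨ C.Lap-+ ψ₁ ψ₂ (k , a) ⟩
        C.Lap ψ₁ (k , a) + C.Lap ψ₂ (k , a)
          ≡⟨ cong₂ _+_ (Lap-ψ₁ k a) (Lap-ψ₂ k a) ⟩
        ((C.δ (k , a) u + through u k a) - (C.δ (k , a) v + through v k a)) + 𝒯.∑ᵥ s-term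
          ≡⟨ lemma (C.δ (k , a) u) (through u k a) (C.δ (k , a) v) (through v k a) (𝒯.∑ᵥ s-term) ⟩
        (C.δ (k , a) u - C.δ (k , a) v) + ((through u k a - through v k a) + 𝒯.∑ᵥ s-term)
          ≡⟨ cong (C.δ (k , a) u - C.δ (k , a) v +_) cancel ⟩
        (C.δ (k , a) u - C.δ (k , a) v) + 0ℚ
          ≡⟨ ℚₚ.+-identityʳ (C.δ (k , a) u - C.δ (k , a) v) ⟩
        C.δ (k , a) u - C.δ (k , a) v ∎
        where
        s-term : Vertex 𝒯 → ℚ
        s-term j = 𝒯.A k j * (s k j * G.δ k a (at k j))
        t-term : V → Vertex 𝒯 → ℚ
        t-term w j = 𝒯.A k j * (S j k w * G.δ k a (at k j))
        lemma : ∀ x t y t′ z → ((x + t) - (y + t′)) + z ≡ (x - y) + ((t - t′) + z)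
        lemma = solve-∀ ℚ-ring
        collect : ∀ A x y z d → (A * (x * d) - A * (y * d)) + A * (z * d) ≡ A * (((x - y) + z) * d)
        collect = solve-∀ ℚ-ring
        cancel : (through u k a - through v k a) + 𝒯.∑ᵥ s-term ≡ 0ℚ
        cancel = begin
          (through u k a - through v k a) + 𝒯.∑ᵥ s-term
            ≡⟨ trans (∑-+ (vertices 𝒯) (λ j → t-term u j - t-term v j) s-term)
                 (cong (_+ 𝒯.∑ᵥ s-term) (∑-sub (vertices 𝒯) (t-term u) (t-term v))) ⟨
          𝒯.∑ᵥ (λ j → (t-term u j - t-term v j) + s-term j)
            ≡⟨ ∑-vanish (vertices 𝒯) (λ {j} _ → trans
                 (collect (𝒯.A k j) (S j k u) (S j k v) (s k j) (G.δ k a (at k j)))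
                 (trans (𝟙-cong (𝒯.adj k j) λ k~j → trans
                   (cong (λ x → (x + s k j) * G.δ k a (at k j)) (s-opposite k~j))
                   (trans (cong (_* G.δ k a (at k j)) (ℚₚ.+-inverseˡ (s k j)))
                     (ℚₚ.*-zeroˡ (G.δ k a (at k j)))))
                   (ℚₚ.*-zeroʳ (𝒯.A k j)))) ⟩
          0ℚ ∎

    -- The difference of `ψ₂` multiplies each current `s i j` by itself; the square is 1 exactly
    -- when the bridge separates u from v.
    R-chain : RC.R u v ≡ 𝒯.∑ᵥ (λ i → RG.R i (p[ i ] u) (p[ i ] v))
                         + ∑ bridges (λ (i , j) → (S i j u - S i j v) * (S i j u - S i j v))
    R-chain = begin
      RC.R u v
        ≡⟨ RC.R-unique {u} {v} {ψ} Lap-ψ ⟩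
      ψ u - ψ v
        ≡⟨ lemma (ψ₁ u) (ψ₂ u) (ψ₁ v) (ψ₂ v) ⟩
      (ψ₁ u - ψ₁ v) + (ψ₂ u - ψ₂ v)
        ≡⟨ cong₂ _+_ (∑-sub (vertices 𝒯) (λ i → lift i (pot i) u) (λ i → lift i (pot i) v))
             (∑-sub bridges (λ (i , j) → s i j * S i j u) (λ (i , j) → s i j * S i j v)) ⟨
      𝒯.∑ᵥ (λ i → lift i (pot i) u - lift i (pot i) v) + ∑ bridges (λ (i , j) → s i j * S i j u - s i j * S i j v)
        ≡⟨ cong₂ _+_
             (∑-cong (vertices 𝒯) λ i → trans (cong₂ _-_ (lift≡ i (pot i) u) (lift≡ i (pot i) v))
               (sym (RG.R≡potential i)))
             (∑-cong bridges λ (i , j) → distr (s i j) (S i j u) (S i j v)) ⟩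
      𝒯.∑ᵥ (λ i → RG.R i (p[ i ] u) (p[ i ] v)) + ∑ bridges (λ (i , j) → s i j * s i j) ∎
      where
      lemma : ∀ a b c d → (a + b) - (c + d) ≡ (a - c) + (b - d)
      lemma = solve-∀ ℚ-ring
      distr : ∀ x y z → x * y - x * z ≡ x * (y - z)
      distr = solve-∀ ℚ-ring

  2W̄ : Vertex 𝒯 → Vertex 𝒯 → ℚ
  2W̄ i j = fromℕ 2 * W̄ i j

  2size : fromℕ 2 * fromℕ (size chain) ≡ C.vol
  2size = trans (sym (fromℕ-* 2 (size chain))) C.fromℕ-2*size

  vol-split : ∀ {i j} → i 𝒯.~ j →
    C.vol ≡ (fromℕ 2 * fromℕ (W i j) + 1ℚ) + (fromℕ 2 * fromℕ (W j i) + 1ℚ)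
  vol-split {i} {j} i~j = begin
    C.∑ᵥ C.deg
      ≡⟨ ∑-cong C.vertices (λ u → trans (sym (ℚₚ.*-identityʳ (C.deg u)))
           (trans (cong (C.deg u *_) (sym (S-opposite i~j u))) (ℚₚ.*-distribˡ-+ (C.deg u) (S i j u) (S j i u)))) ⟩
    C.∑ᵥ (λ u → C.deg u * S i j u + C.deg u * S j i u)
      ≡⟨ ∑-+ C.vertices (λ u → C.deg u * S i j u) (λ u → C.deg u * S j i u) ⟩
    C.∑ᵥ (λ u → C.deg u * S i j u) + C.∑ᵥ (λ u → C.deg u * S j i u)
      ≡⟨ cong₂ _+_ (vol-S i~j) (vol-S (~-sym i~j)) ⟩
    (fromℕ 2 * fromℕ (W i j) + 1ℚ) + (fromℕ 2 * fromℕ (W j i) + 1ℚ) ∎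

  -- The relation W̄_x = W_y + 1, doubled.
  vol-S≡2W̄-1 : ∀ {i j} → i 𝒯.~ j → C.∑ᵥ (λ u → C.deg u * S j i u) ≡ 2W̄ i j - 1ℚ
  vol-S≡2W̄-1 {i} {j} i~j = begin
    C.∑ᵥ (λ u → C.deg u * S j i u)
      ≡⟨ vol-S (~-sym i~j) ⟩
    fromℕ 2 * fromℕ (W j i) + 1ℚ
      ≡⟨ lemma₁ (fromℕ 2 * fromℕ (W i j)) (fromℕ 2 * fromℕ (W j i)) ⟩
    (((fromℕ 2 * fromℕ (W i j) + 1ℚ) + (fromℕ 2 * fromℕ (W j i) + 1ℚ)) - fromℕ 2 * fromℕ (W i j)) - 1ℚ
      ≡⟨ cong (λ x → (x - fromℕ 2 * fromℕ (W i j)) - 1ℚ) (trans 2size (vol-split i~j)) ⟨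
    (fromℕ 2 * fromℕ (size chain) - fromℕ 2 * fromℕ (W i j)) - 1ℚ
      ≡⟨ cong (_- 1ℚ) (lemma₂ (fromℕ 2) (fromℕ (size chain)) (fromℕ (W i j))) ⟩
    2W̄ i j - 1ℚ ∎
    where
    lemma₁ : ∀ x y → y + 1ℚ ≡ (((x + 1ℚ) + (y + 1ℚ)) - x) - 1ℚ
    lemma₁ = solve-∀ ℚ-ring
    lemma₂ : ∀ a x y → a * x - a * y ≡ a * (x - y)
    lemma₂ = solve-∀ ℚ-ring

  -- The mass 2W̄ at an end has two sources: 1 because the bridge raises the degree of its end, and
  -- 2W̄ - 1 as the volume of the far side, all of which has this end as its gate.
  pushforward : ∀ i (φ : Vertex (G i) → ℚ) → C.∑ᵥ (λ u → C.deg u * φ (p[ i ] u)) ≡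
    G.∑ᵥ i (λ a → G.deg i a * φ a) + ∑ (ends i) (λ j → 2W̄ i j * φ (at i j))
  pushforward i φ = begin
    C.∑ᵥ (λ u → C.deg u * φ (p[ i ] u))
      ≡⟨ ∑-cong C.vertices (λ u → trans (cong (C.deg u *_) (sym (lift≡ i φ u)))
           (ℚₚ.*-distribˡ-+ (C.deg u) (local i φ u) (𝒯.∑ᵥ (λ j → 𝒯.A i j * (S j i u * φ (at i j)))))) ⟩
    C.∑ᵥ (λ u → C.deg u * local i φ u + C.deg u * 𝒯.∑ᵥ (λ j → 𝒯.A i j * (S j i u * φ (at i j))))
      ≡⟨ ∑-+ C.vertices (λ u → C.deg u * local i φ u)
           (λ u → C.deg u * 𝒯.∑ᵥ (λ j → 𝒯.A i j * (S j i u * φ (at i j)))) ⟩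
    C.∑ᵥ (λ u → C.deg u * local i φ u)
      + C.∑ᵥ (λ u → C.deg u * 𝒯.∑ᵥ (λ j → 𝒯.A i j * (S j i u * φ (at i j))))
      ≡⟨ cong₂ _+_ local-part through-part ⟩
    (G.∑ᵥ i (λ a → G.deg i a * φ a) + 𝒯.∑ᵥ (λ j → 𝒯.A i j * φ (at i j)))
      + 𝒯.∑ᵥ (λ j → 𝒯.A i j * ((2W̄ i j - 1ℚ) * φ (at i j)))
      ≡⟨ ℚₚ.+-assoc (G.∑ᵥ i (λ a → G.deg i a * φ a)) (𝒯.∑ᵥ (λ j → 𝒯.A i j * φ (at i j))) _ ⟩
    G.∑ᵥ i (λ a → G.deg i a * φ a) + (𝒯.∑ᵥ (λ j → 𝒯.A i j * φ (at i j))
      + 𝒯.∑ᵥ (λ j → 𝒯.A i j * ((2W̄ i j - 1ℚ) * φ (at i j))))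
      ≡⟨ cong (G.∑ᵥ i (λ a → G.deg i a * φ a) +_) (trans
           (sym (∑-+ (vertices 𝒯) (λ j → 𝒯.A i j * φ (at i j)) (λ j → 𝒯.A i j * ((2W̄ i j - 1ℚ) * φ (at i j)))))
           (trans (∑-cong (vertices 𝒯) λ j → lemma (𝒯.A i j) (2W̄ i j) (φ (at i j)))
             (sym (𝒯.∑-neighbours i (λ j → 2W̄ i j * φ (at i j)))))) ⟩
    G.∑ᵥ i (λ a → G.deg i a * φ a) + ∑ (ends i) (λ j → 2W̄ i j * φ (at i j)) ∎
    where
    lemma : ∀ a w x → a * x + a * ((w - 1ℚ) * x) ≡ a * (w * x)
    lemma = solve-∀ ℚ-ring
    assoc₁ : ∀ a d x → (a * d) * x ≡ a * (d * x)
    assoc₁ = solve-∀ ℚ-ring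
    assoc₂ : ∀ d a s x → d * (a * (s * x)) ≡ (a * x) * (d * s)
    assoc₂ = solve-∀ ℚ-ring
    assoc₃ : ∀ a w x → (a * x) * w ≡ a * (w * x)
    assoc₃ = solve-∀ ℚ-ring
    local-part : C.∑ᵥ (λ u → C.deg u * local i φ u) ≡
                 G.∑ᵥ i (λ a → G.deg i a * φ a) + 𝒯.∑ᵥ (λ j → 𝒯.A i j * φ (at i j))
    local-part = begin
      C.∑ᵥ (λ u → C.deg u * local i φ u)
        ≡⟨ ∑-chain (λ u → C.deg u * local i φ u) ⟩
      𝒯.∑ᵥ (λ k → G.∑ᵥ k (λ a → C.deg (k , a) * local i φ (k , a)))
        ≡⟨ 𝒯.∑ᵥ-single i (λ {k} k≢i → ∑-vanish (vertices (G k)) λ {a} _ → trans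
             (cong (C.deg (k , a) *_) (local-diff φ a (k≢i ∘ sym))) (ℚₚ.*-zeroʳ (C.deg (k , a)))) ⟩
      G.∑ᵥ i (λ a → C.deg (i , a) * local i φ (i , a))
        ≡⟨ ∑-cong (vertices (G i)) (λ a → trans (cong₂ _*_ (deg-chain i a) (local-same i φ a))
             (trans (ℚₚ.*-distribʳ-+ (φ a) (G.deg i a) (𝒯.∑ᵥ (λ j → 𝒯.A i j * G.δ i a (at i j))))
               (cong (G.deg i a * φ a +_) (trans
                 (sym (∑-*ʳ (vertices 𝒯) (φ a) (λ j → 𝒯.A i j * G.δ i a (at i j))))
                 (∑-cong (vertices 𝒯) λ j → assoc₁ (𝒯.A i j) (G.δ i a (at i j)) (φ a)))))) ⟩
      G.∑ᵥ i (λ a → G.deg i a * φ a + 𝒯.∑ᵥ (λ j → 𝒯.A i j * (G.δ i a (at i j) * φ a)))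
        ≡⟨ ∑-+ (vertices (G i)) (λ a → G.deg i a * φ a) (λ a → 𝒯.∑ᵥ (λ j → 𝒯.A i j * (G.δ i a (at i j) * φ a))) ⟩
      G.∑ᵥ i (λ a → G.deg i a * φ a) + G.∑ᵥ i (λ a → 𝒯.∑ᵥ (λ j → 𝒯.A i j * (G.δ i a (at i j) * φ a)))
        ≡⟨ cong (G.∑ᵥ i (λ a → G.deg i a * φ a) +_) (trans
             (∑-swap (vertices (G i)) (vertices 𝒯) (λ a j → 𝒯.A i j * (G.δ i a (at i j) * φ a)))
             (∑-cong (vertices 𝒯) λ j → trans
               (∑-*ˡ (vertices (G i)) (𝒯.A i j) (λ a → G.δ i a (at i j) * φ a))
               (cong (𝒯.A i j *_) (G.∑ᵥ-δ i (at i j) φ)))) ⟩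
      G.∑ᵥ i (λ a → G.deg i a * φ a) + 𝒯.∑ᵥ (λ j → 𝒯.A i j * φ (at i j)) ∎
    through-part : C.∑ᵥ (λ u → C.deg u * 𝒯.∑ᵥ (λ j → 𝒯.A i j * (S j i u * φ (at i j)))) ≡
                   𝒯.∑ᵥ (λ j → 𝒯.A i j * ((2W̄ i j - 1ℚ) * φ (at i j)))
    through-part = begin
      C.∑ᵥ (λ u → C.deg u * 𝒯.∑ᵥ (λ j → 𝒯.A i j * (S j i u * φ (at i j))))
        ≡⟨ ∑-cong C.vertices (λ u → sym (∑-*ˡ (vertices 𝒯) (C.deg u) (λ j → 𝒯.A i j * (S j i u * φ (at i j))))) ⟩
      C.∑ᵥ (λ u → 𝒯.∑ᵥ (λ j → C.deg u * (𝒯.A i j * (S j i u * φ (at i j)))))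
        ≡⟨ ∑-swap C.vertices (vertices 𝒯) (λ u j → C.deg u * (𝒯.A i j * (S j i u * φ (at i j)))) ⟩
      𝒯.∑ᵥ (λ j → C.∑ᵥ (λ u → C.deg u * (𝒯.A i j * (S j i u * φ (at i j)))))
        ≡⟨ ∑-cong (vertices 𝒯) (λ j → trans
             (∑-cong C.vertices λ u → assoc₂ (C.deg u) (𝒯.A i j) (S j i u) (φ (at i j)))
             (trans (∑-*ˡ C.vertices (𝒯.A i j * φ (at i j)) (λ u → C.deg u * S j i u))
               (assoc₃ (𝒯.A i j) (C.∑ᵥ (λ u → C.deg u * S j i u)) (φ (at i j))))) ⟩
      𝒯.∑ᵥ (λ j → 𝒯.A i j * (C.∑ᵥ (λ u → C.deg u * S j i u) * φ (at i j)))
        ≡⟨ ∑-cong (vertices 𝒯) (λ j → 𝟙-cong (𝒯.adj i j) λ i~j →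
             cong (_* φ (at i j)) (vol-S≡2W̄-1 i~j)) ⟩
      𝒯.∑ᵥ (λ j → 𝒯.A i j * ((2W̄ i j - 1ℚ) * φ (at i j))) ∎

  -- The total mass of the push-forward. It turns the coefficient of κ(G_i) in `D-block` into the
  -- volume of the whole chain.
  vol-block : ∀ i → C.vol ≡ G.vol i + ∑ (ends i) (2W̄ i)
  vol-block i = begin
    C.vol
      ≡⟨ ∑-cong C.vertices (λ u → ℚₚ.*-identityʳ (C.deg u)) ⟨
    C.∑ᵥ (λ u → C.deg u * 1ℚ)
      ≡⟨ pushforward i (λ _ → 1ℚ) ⟩
    G.∑ᵥ i (λ a → G.deg i a * 1ℚ) + ∑ (ends i) (λ j → 2W̄ i j * 1ℚ)
      ≡⟨ cong₂ _+_ (∑-cong (vertices (G i)) λ a → ℚₚ.*-identityʳ (G.deg i a))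
           (∑-cong (ends i) λ j → ℚₚ.*-identityʳ (2W̄ i j)) ⟩
    G.vol i + ∑ (ends i) (2W̄ i) ∎

  -- Indicators are idempotent, so the square is a sum of two products, one for each assignment of u
  -- and v to opposite sides; each contributes the product of the two volumes.
  D-bridge : ∀ {i j} → i 𝒯.~ j → C.D (λ u v → (S i j u - S i j v) * (S i j u - S i j v)) ≡
             fromℕ 2 * ((2W̄ i j - 1ℚ) * (2W̄ j i - 1ℚ))
  D-bridge {i} {j} i~j = begin
    C.D (λ u v → (S i j u - S i j v) * (S i j u - S i j v))
      ≡⟨ C.D-cong separate ⟩
    C.D (λ u v → S i j u * S j i v + S j i u * S i j v)
      ≡⟨ C.D-+ (λ u v → S i j u * S j i v) (λ u v → S j i u * S i j v) ⟩
    C.D (λ u v → S i j u * S j i v) + C.D (λ u v → S j i u * S i j v)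
      ≡⟨ cong₂ _+_ (C.D-⊗ (S i j) (S j i)) (C.D-⊗ (S j i) (S i j)) ⟩
    C.∑ᵥ (λ u → C.deg u * S i j u) * C.∑ᵥ (λ u → C.deg u * S j i u)
      + C.∑ᵥ (λ u → C.deg u * S j i u) * C.∑ᵥ (λ u → C.deg u * S i j u)
      ≡⟨ cong₂ (λ x y → x * y + y * x) (vol-S≡2W̄-1 (~-sym i~j)) (vol-S≡2W̄-1 i~j) ⟩
    (2W̄ j i - 1ℚ) * (2W̄ i j - 1ℚ) + (2W̄ i j - 1ℚ) * (2W̄ j i - 1ℚ)
      ≡⟨ double (2W̄ j i - 1ℚ) (2W̄ i j - 1ℚ) ⟩
    fromℕ 2 * ((2W̄ i j - 1ℚ) * (2W̄ j i - 1ℚ)) ∎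
    where
    double : ∀ x y → x * y + y * x ≡ fromℕ 2 * (y * x)
    double = solve-∀ ℚ-ring
    expand : ∀ x y → (x - y) * (x - y) ≡ (x * x + y * y) - fromℕ 2 * (x * y)
    expand = solve-∀ ℚ-ring
    regroup : ∀ x y → (x + y) - fromℕ 2 * (x * y) ≡ x * (1ℚ - y) + (1ℚ - x) * y
    regroup = solve-∀ ℚ-ring
    cancel : ∀ x y → (x + y) - x ≡ y
    cancel = solve-∀ ℚ-ring
    opposite : ∀ u → 1ℚ - S i j u ≡ S j i u
    opposite u = trans (cong (_- S i j u) (sym (S-opposite i~j u))) (cancel (S i j u) (S j i u))
    separate : ∀ u v → (S i j u - S i j v) * (S i j u - S i j v) ≡ S i j u * S j i v + S j i u * S i j v
    separate u v = begin
      (S i j u - S i j v) * (S i j u - S i j v)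
        ≡⟨ expand (S i j u) (S i j v) ⟩
      (S i j u * S i j u + S i j v * S i j v) - fromℕ 2 * (S i j u * S i j v)
        ≡⟨ cong₂ (λ x y → (x + y) - fromℕ 2 * (S i j u * S i j v)) (𝟙-idem (does (reachable? H′ (end i j) u)))
             (𝟙-idem (does (reachable? H′ (end i j) v))) ⟩
      (S i j u + S i j v) - fromℕ 2 * (S i j u * S i j v)
        ≡⟨ regroup (S i j u) (S i j v) ⟩
      S i j u * (1ℚ - S i j v) + (1ℚ - S i j u) * S i j v
        ≡⟨ cong₂ (λ x y → S i j u * x + y * S i j v) (opposite v) (opposite u) ⟩
      S i j u * S j i v + S j i u * S i j v ∎
      where
      H′ = deleteEdge chain (end i j) (end j i)

  α κ : ∀ i → Vertex (G i) → ℚ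
  α i = accessibility (G i) (mᵢ i)
  κ i = kemeny (G i) (mᵢ i)

  -- Pushing forward in both arguments tests R against d_i plus point masses. The part with d_i
  -- twice gives 2·vol·κ, each of the two mixed parts gives accessibility plus κ at the ends by
  -- `∑-deg-R`, and the point masses give the double sum. The κ terms combine through `vol-block`.
  D-block : ∀ i o → C.D (λ u v → RG.R i (p[ i ] u) (p[ i ] v)) ≡
    fromℕ 2 * (C.vol * κ i o) + (fromℕ 2 * ∑ (ends i) (λ j → 2W̄ i j * α i (at i j))
      + ∑ (ends i) (λ j₁ → ∑ (ends i) (λ j₂ → 2W̄ i j₁ * 2W̄ i j₂ * RG.R i (at i j₁) (at i j₂))))
  D-block i o = begin
    C.∑ᵥ (λ v → C.deg v * C.∑ᵥ (λ u → C.deg u * R (p[ i ] u) (p[ i ] v)))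
      ≡⟨ ∑-cong C.vertices (λ v → cong (C.deg v *_) (pushforward i (λ a → R a (p[ i ] v)))) ⟩
    C.∑ᵥ (λ v → C.deg v * (Σ-R (p[ i ] v) + E-R (p[ i ] v)))
      ≡⟨ pushforward i (λ b → Σ-R b + E-R b) ⟩
    G.∑ᵥ i (λ b → G.deg i b * (Σ-R b + E-R b)) + ∑ (ends i) (λ j → 2W̄ i j * (Σ-R (at i j) + E-R (at i j)))
      ≡⟨ cong₂ _+_
           (trans (∑-cong (vertices (G i)) λ b → ℚₚ.*-distribˡ-+ (G.deg i b) (Σ-R b) (E-R b))
             (∑-+ (vertices (G i)) (λ b → G.deg i b * Σ-R b) (λ b → G.deg i b * E-R b)))
           (trans (∑-cong (ends i) λ j → ℚₚ.*-distribˡ-+ (2W̄ i j) (Σ-R (at i j)) (E-R (at i j)))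
             (∑-+ (ends i) (λ j → 2W̄ i j * Σ-R (at i j)) (λ j → 2W̄ i j * E-R (at i j)))) ⟩
    (G.∑ᵥ i (λ b → G.deg i b * Σ-R b) + G.∑ᵥ i (λ b → G.deg i b * E-R b))
      + (∑ (ends i) (λ j → 2W̄ i j * Σ-R (at i j)) + ∑ (ends i) (λ j → 2W̄ i j * E-R (at i j)))
      ≡⟨ cong₂ _+_ (cong₂ _+_ (RG.∑∑-deg-R i o) (trans mixed ends-Σ)) (cong₂ _+_ ends-Σ ends-E) ⟩
    (fromℕ 2 * (G.vol i * κ i o) + (Wα + Wₜ * κ i o)) + ((Wα + Wₜ * κ i o) + WWR)
      ≡⟨ lemma (G.vol i) Wₜ (κ i o) Wα WWR ⟩
    fromℕ 2 * ((G.vol i + Wₜ) * κ i o) + (fromℕ 2 * Wα + WWR)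
      ≡⟨ cong (λ x → fromℕ 2 * (x * κ i o) + (fromℕ 2 * Wα + WWR)) (vol-block i) ⟨
    fromℕ 2 * (C.vol * κ i o) + (fromℕ 2 * Wα + WWR) ∎
    where
    R : Vertex (G i) → Vertex (G i) → ℚ
    R = RG.R i
    Σ-R E-R : Vertex (G i) → ℚ
    Σ-R b = G.∑ᵥ i (λ a → G.deg i a * R a b)
    E-R b = ∑ (ends i) (λ j → 2W̄ i j * R (at i j) b)
    Wₜ Wα WWR : ℚ
    Wₜ  = ∑ (ends i) (2W̄ i)
    Wα  = ∑ (ends i) (λ j → 2W̄ i j * α i (at i j))
    WWR = ∑ (ends i) (λ j₁ → ∑ (ends i) (λ j₂ → 2W̄ i j₁ * 2W̄ i j₂ * R (at i j₁) (at i j₂)))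
    lemma : ∀ n w k a r → (fromℕ 2 * (n * k) + (a + w * k)) + ((a + w * k) + r)
                          ≡ fromℕ 2 * ((n + w) * k) + (fromℕ 2 * a + r)
    lemma = solve-∀ ℚ-ring
    swap : ∀ x y z → x * (y * z) ≡ y * (x * z)
    swap = solve-∀ ℚ-ring
    mixed : G.∑ᵥ i (λ b → G.deg i b * E-R b) ≡ ∑ (ends i) (λ j → 2W̄ i j * Σ-R (at i j))
    mixed = begin
      G.∑ᵥ i (λ b → G.deg i b * E-R b)
        ≡⟨ ∑-cong (vertices (G i)) (λ b → ∑-*ˡ (ends i) (G.deg i b) (λ j → 2W̄ i j * R (at i j) b)) ⟨
      G.∑ᵥ i (λ b → ∑ (ends i) (λ j → G.deg i b * (2W̄ i j * R (at i j) b)))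
        ≡⟨ ∑-swap (vertices (G i)) (ends i) (λ b j → G.deg i b * (2W̄ i j * R (at i j) b)) ⟩
      ∑ (ends i) (λ j → G.∑ᵥ i (λ b → G.deg i b * (2W̄ i j * R (at i j) b)))
        ≡⟨ ∑-cong (ends i) (λ j → trans
             (∑-cong (vertices (G i)) λ b → trans (swap (G.deg i b) (2W̄ i j) (R (at i j) b))
               (cong (λ x → 2W̄ i j * (G.deg i b * x)) (RG.R-sym i (at i j) b)))
             (∑-*ˡ (vertices (G i)) (2W̄ i j) (λ b → G.deg i b * R b (at i j)))) ⟩
      ∑ (ends i) (λ j → 2W̄ i j * Σ-R (at i j)) ∎
    ends-Σ : ∑ (ends i) (λ j → 2W̄ i j * Σ-R (at i j)) ≡ Wα + Wₜ * κ i o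
    ends-Σ = begin
      ∑ (ends i) (λ j → 2W̄ i j * Σ-R (at i j))
        ≡⟨ ∑-cong (ends i) (λ j → trans
             (cong (2W̄ i j *_) (trans (RG.∑-deg-R i (at i j)) (cong (α i (at i j) +_) (RG.kemeny-const i (at i j) o))))
             (ℚₚ.*-distribˡ-+ (2W̄ i j) (α i (at i j)) (κ i o))) ⟩
      ∑ (ends i) (λ j → 2W̄ i j * α i (at i j) + 2W̄ i j * κ i o)
        ≡⟨ ∑-+ (ends i) (λ j → 2W̄ i j * α i (at i j)) (λ j → 2W̄ i j * κ i o) ⟩
      Wα + ∑ (ends i) (λ j → 2W̄ i j * κ i o)
        ≡⟨ cong (Wα +_) (∑-*ʳ (ends i) (κ i o) (2W̄ i)) ⟩
      Wα + Wₜ * κ i o ∎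
    ends-E : ∑ (ends i) (λ j → 2W̄ i j * E-R (at i j)) ≡ WWR
    ends-E = ∑-cong (ends i) λ j₁ → trans
      (sym (∑-*ˡ (ends i) (2W̄ i j₁) (λ j₂ → 2W̄ i j₂ * R (at i j₂) (at i j₁))))
      (∑-cong (ends i) λ j₂ → trans
        (sym (ℚₚ.*-assoc (2W̄ i j₁) (2W̄ i j₂) (R (at i j₂) (at i j₁))))
        (cong (2W̄ i j₁ * 2W̄ i j₂ *_) (RG.R-sym i (at i j₂) (at i j₁))))

-- The formula for Kemeny's constant of a chain

theorem3p15 :
    (𝒯 : Graph) → IsTree 𝒯 →
    (G : Vertex 𝒯 → Graph) → (∀ i → Connected (G i)) →
    (at : (i j : Vertex 𝒯) → Vertex (G i)) →
    let open Chain 𝒯 G at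
        mG = size chain
    in
    1 ℕ.≤ mG →
    (m : MeanFirstPassage chain) →
    (mᵢ : ∀ i → MeanFirstPassage (G i)) →
    (o : Vertex chain) →
    (oᵢ : ∀ i → Vertex (G i)) →
    kemeny chain m o
      ≡ ∑ (vertices 𝒯) (λ i → kemeny (G i) (mᵢ i) (oᵢ i))
      + ∑ bridges (λ (i , j) →
          (W̄ i j ÷ℕ mG) * accessibility (G i) (mᵢ i) (at i j)
          + (W̄ j i ÷ℕ mG) * accessibility (G j) (mᵢ j) (at j i))
      + ∑ (vertices 𝒯) (λ i → ∑ (ends i) (λ j₁ → ∑ (ends i) (λ j₂ →
          let z₁ = at i j₁
              z₂ = at i j₂
          in if does (Graph._≟_ (G i) z₁ z₂)
             then 0ℚ
             else ((W̄ i j₁ * W̄ i j₂) ÷ℕ (2 ℕ.* mG ℕ.* size (G i)))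
                  * (time (mᵢ i) z₁ z₂ + time (mᵢ i) z₂ z₁))))
      + ∑ bridges (λ (i , j) →
          ((fromℕ 2 * W̄ i j - 1ℚ) * (fromℕ 2 * W̄ j i - 1ℚ)) ÷ℕ (2 ℕ.* mG))
theorem3p15 𝒯 tree G G-connected at 1≤mG m mᵢ o oᵢ = begin
  kemeny chain m o
    ≡⟨ trans (sym (ℚₚ.*-identityˡ (kemeny chain m o)))
         (trans (cong (_* kemeny chain m o) (sym (RC.vol*c≡1 1≤mG))) (unfold RC.c C.vol (kemeny chain m o))) ⟩
  h * (fromℕ 2 * (C.vol * kemeny chain m o))
    ≡⟨ cong (h *_) (RC.∑∑-deg-R o) ⟨
  h * C.D RC.R
    ≡⟨ cong (h *_) (trans (C.D-cong R-chain) (C.D-+ (λ u v → 𝒯.∑ᵥ (λ i → block i u v))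
         (λ u v → ∑ bridges (λ (i , j) → cut i j u v)))) ⟩
  h * (C.D (λ u v → 𝒯.∑ᵥ (λ i → block i u v)) + C.D (λ u v → ∑ bridges (λ (i , j) → cut i j u v)))
    ≡⟨ cong (h *_) (cong₂ _+_ (C.D-∑ (vertices 𝒯) block) (C.D-∑ bridges (λ (i , j) → cut i j))) ⟩
  h * (𝒯.∑ᵥ (λ i → C.D (block i)) + ∑ bridges (λ (i , j) → C.D (cut i j)))
    ≡⟨ trans (ℚₚ.*-distribˡ-+ h (𝒯.∑ᵥ (λ i → C.D (block i))) (∑ bridges (λ (i , j) → C.D (cut i j))))
         (cong₂ _+_ (sym (∑-*ˡ (vertices 𝒯) h (λ i → C.D (block i))))
           (sym (∑-*ˡ bridges h (λ (i , j) → C.D (cut i j))))) ⟩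
  𝒯.∑ᵥ (λ i → h * C.D (block i)) + ∑ bridges (λ (i , j) → h * C.D (cut i j))
    ≡⟨ cong₂ _+_ (∑-cong (vertices 𝒯) scaled-block)
         (𝒯.∑-edges-cong (λ i j → h * C.D (cut i j)) bridge-term scaled-cut) ⟩
  𝒯.∑ᵥ (λ i → (κ i (oᵢ i) + ∑ (ends i) (access-term i)) + pair-terms i) + E
    ≡⟨ cong (_+ E) (trans (∑-+ (vertices 𝒯) (λ i → κ i (oᵢ i) + ∑ (ends i) (access-term i)) pair-terms)
         (cong (_+ 𝒯.∑ᵥ pair-terms)
           (∑-+ (vertices 𝒯) (λ i → κ i (oᵢ i)) (λ i → ∑ (ends i) (access-term i))))) ⟩
  𝒯.∑ᵥ (λ i → κ i (oᵢ i)) + 𝒯.∑ᵥ (λ i → ∑ (ends i) (access-term i)) + 𝒯.∑ᵥ pair-terms + E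
    -- The ends, taken over all blocks, are the ordered adjacent pairs of the tree; joining the two
    -- orientations gives a sum over bridges.
    ≡⟨ cong (λ x → 𝒯.∑ᵥ (λ i → κ i (oᵢ i)) + x + 𝒯.∑ᵥ pair-terms + E)
         (trans (∑-cong (vertices 𝒯) λ i → 𝒯.∑-neighbours i (access-term i)) (𝒯.∑-edges access-term)) ⟩
  𝒯.∑ᵥ (λ i → κ i (oᵢ i)) + ∑ bridges (λ (i , j) → access-term i j + access-term j i)
    + 𝒯.∑ᵥ pair-terms + E ∎
  where
  open Chain 𝒯 G at hiding (module 𝒯; module G; block)
  open ChainWalk 𝒯 tree G G-connected at
  open ChainKemeny 𝒯 tree G G-connected at m mᵢ

  mG : ℕ
  mG = size chain

  -- 1/(4 m_G), the inverse of the factor in ∑∑ deg u deg v R(u,v) = 4 m_G κ.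
  h : ℚ
  h = RC.c * ½

  block : Vertex 𝒯 → V → V → ℚ
  block i u v = RG.R i (p[ i ] u) (p[ i ] v)

  cut : Vertex 𝒯 → Vertex 𝒯 → V → V → ℚ
  cut i j u v = (S i j u - S i j v) * (S i j u - S i j v)

  access-term bridge-term : Vertex 𝒯 → Vertex 𝒯 → ℚ
  access-term i j = (W̄ i j ÷ℕ mG) * α i (at i j)
  bridge-term i j = ((fromℕ 2 * W̄ i j - 1ℚ) * (fromℕ 2 * W̄ j i - 1ℚ)) ÷ℕ (2 ℕ.* mG)

  pair-term : ∀ i (j₁ j₂ : Vertex 𝒯) → ℚ
  pair-term i j₁ j₂ = if does (Graph._≟_ (G i) (at i j₁) (at i j₂)) then 0ℚ
    else ((W̄ i j₁ * W̄ i j₂) ÷ℕ (2 ℕ.* mG ℕ.* size (G i)))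
         * (time (mᵢ i) (at i j₁) (at i j₂) + time (mᵢ i) (at i j₂) (at i j₁))

  pair-terms : Vertex 𝒯 → ℚ
  pair-terms i = ∑ (ends i) (λ j₁ → ∑ (ends i) (pair-term i j₁))

  E : ℚ
  E = ∑ bridges (λ (i , j) → bridge-term i j)

  unfold : ∀ c v k → (v * c) * k ≡ (c * ½) * (fromℕ 2 * (v * k))
  unfold = solve-∀ ℚ-ring

  scaled-cut : ∀ {i j} → i 𝒯.~ j → h * C.D (cut i j) ≡ bridge-term i j
  scaled-cut {i} {j} i~j = begin
    h * C.D (cut i j)
      ≡⟨ cong (h *_) (D-bridge i~j) ⟩
    h * (fromℕ 2 * ((2W̄ i j - 1ℚ) * (2W̄ j i - 1ℚ)))
      ≡⟨ lemma RC.c ((2W̄ i j - 1ℚ) * (2W̄ j i - 1ℚ)) ⟩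
    ((2W̄ i j - 1ℚ) * (2W̄ j i - 1ℚ)) * RC.c
      ≡⟨ ÷ℕ-* ((2W̄ i j - 1ℚ) * (2W̄ j i - 1ℚ)) (2 ℕ.* mG) ⟨
    bridge-term i j ∎
    where
    lemma : ∀ c x → (c * ½) * (fromℕ 2 * x) ≡ x * c
    lemma = solve-∀ ℚ-ring

  scaled-access : ∀ i j → RC.c * (2W̄ i j * α i (at i j)) ≡ access-term i j
  scaled-access i j = begin
    RC.c * (2W̄ i j * α i (at i j))
      ≡⟨ cong (_* (2W̄ i j * α i (at i j))) (1÷ℕ-* 2 mG) ⟩
    (½ * (1ℚ ÷ℕ mG)) * (2W̄ i j * α i (at i j))
      ≡⟨ lemma (1ℚ ÷ℕ mG) (W̄ i j) (α i (at i j)) ⟩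
    (W̄ i j * (1ℚ ÷ℕ mG)) * α i (at i j)
      ≡⟨ cong (_* α i (at i j)) (÷ℕ-* (W̄ i j) mG) ⟨
    access-term i j ∎
    where
    lemma : ∀ n w a → (½ * n) * ((fromℕ 2 * w) * a) ≡ (w * n) * a
    lemma = solve-∀ ℚ-ring

  -- The weights combine as 1/(4 m_G) · 4 W̄ W̄ · 1/(2 m_{G_i}), the last factor coming from R. At
  -- equal ends R is 0, matching the convention for the diagonal.
  scaled-pair : ∀ i j₁ j₂ → h * (2W̄ i j₁ * 2W̄ i j₂ * RG.R i (at i j₁) (at i j₂)) ≡ pair-term i j₁ j₂
  scaled-pair i j₁ j₂ = go (Graph._≟_ (G i) z₁ z₂)
    where
    z₁ z₂ : Vertex (G i)
    z₁ = at i j₁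
    z₂ = at i j₂
    t : ℚ
    t = time (mᵢ i) z₁ z₂ + time (mᵢ i) z₂ z₁
    lemma₀ : ∀ h x → h * (x * 0ℚ) ≡ 0ℚ
    lemma₀ = solve-∀ ℚ-ring
    lemma : ∀ c n x y s → (c * ½) * ((fromℕ 2 * x) * (fromℕ 2 * y) * ((½ * n) * s)) ≡ ((x * y) * (c * n)) * s
    lemma = solve-∀ ℚ-ring
    term : Bool → ℚ
    term b = if b then 0ℚ else ((W̄ i j₁ * W̄ i j₂) ÷ℕ (2 ℕ.* mG ℕ.* size (G i))) * t
    go : (d : Dec (z₁ ≡ z₂)) → h * (2W̄ i j₁ * 2W̄ i j₂ * RG.R i z₁ z₂) ≡ pair-term i j₁ j₂
    go (yes z₁≡z₂) = begin
      h * (2W̄ i j₁ * 2W̄ i j₂ * RG.R i z₁ z₂)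
        ≡⟨ cong (λ x → h * (2W̄ i j₁ * 2W̄ i j₂ * x)) (trans (cong (λ z → RG.R i z z₂) z₁≡z₂) (RG.R-refl i z₂)) ⟩
      h * (2W̄ i j₁ * 2W̄ i j₂ * 0ℚ)
        ≡⟨ lemma₀ h (2W̄ i j₁ * 2W̄ i j₂) ⟩
      0ℚ
        ≡⟨ cong term (dec-true (Graph._≟_ (G i) z₁ z₂) z₁≡z₂) ⟨
      pair-term i j₁ j₂ ∎
    go (no z₁≢z₂) = begin
      h * (2W̄ i j₁ * 2W̄ i j₂ * RG.R i z₁ z₂)
        ≡⟨ cong₂ (λ x y → h * (2W̄ i j₁ * 2W̄ i j₂ * (x * y))) (1÷ℕ-* 2 (size (G i)))
             (cong₂ _+_ (RG.hit-≢ i z₁≢z₂) (RG.hit-≢ i (z₁≢z₂ ∘ sym))) ⟩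
      h * (2W̄ i j₁ * 2W̄ i j₂ * ((½ * (1ℚ ÷ℕ size (G i))) * t))
        ≡⟨ lemma RC.c (1ℚ ÷ℕ size (G i)) (W̄ i j₁) (W̄ i j₂) t ⟩
      ((W̄ i j₁ * W̄ i j₂) * (RC.c * (1ℚ ÷ℕ size (G i)))) * t
        ≡⟨ cong (_* t) (trans (÷ℕ-* (W̄ i j₁ * W̄ i j₂) (2 ℕ.* mG ℕ.* size (G i)))
             (cong (W̄ i j₁ * W̄ i j₂ *_) (1÷ℕ-* (2 ℕ.* mG) (size (G i))))) ⟨
      ((W̄ i j₁ * W̄ i j₂) ÷ℕ (2 ℕ.* mG ℕ.* size (G i))) * t
        ≡⟨ cong term (dec-false (Graph._≟_ (G i) z₁ z₂) z₁≢z₂) ⟨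
      pair-term i j₁ j₂ ∎

  scaled-block : ∀ i → h * C.D (block i) ≡ (κ i (oᵢ i) + ∑ (ends i) (access-term i)) + pair-terms i
  scaled-block i = begin
    h * C.D (block i)
      ≡⟨ cong (h *_) (D-block i (oᵢ i)) ⟩
    h * (fromℕ 2 * (C.vol * κ i (oᵢ i)) + (fromℕ 2 * Wα + WWR))
      ≡⟨ lemma RC.c C.vol (κ i (oᵢ i)) Wα WWR ⟩
    ((C.vol * RC.c) * κ i (oᵢ i) + RC.c * Wα) + h * WWR
      ≡⟨ cong₂ _+_
           (cong₂ _+_ (trans (cong (_* κ i (oᵢ i)) (RC.vol*c≡1 1≤mG)) (ℚₚ.*-identityˡ (κ i (oᵢ i))))
             (trans (sym (∑-*ˡ (ends i) RC.c (λ j → 2W̄ i j * α i (at i j))))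
               (∑-cong (ends i) (scaled-access i))))
           (trans (sym (∑-*ˡ (ends i) h (λ j₁ → ∑ (ends i) (WWR-term j₁))))
             (∑-cong (ends i) λ j₁ → trans (sym (∑-*ˡ (ends i) h (WWR-term j₁)))
               (∑-cong (ends i) (scaled-pair i j₁)))) ⟩
    (κ i (oᵢ i) + ∑ (ends i) (access-term i)) + pair-terms i ∎
    where
    WWR-term : Vertex 𝒯 → Vertex 𝒯 → ℚ
    WWR-term j₁ j₂ = 2W̄ i j₁ * 2W̄ i j₂ * RG.R i (at i j₁) (at i j₂)
    Wα WWR : ℚ
    Wα  = ∑ (ends i) (λ j → 2W̄ i j * α i (at i j))
    WWR = ∑ (ends i) (λ j₁ → ∑ (ends i) (WWR-term j₁))
    lemma : ∀ c v k a r → (c * ½) * (fromℕ 2 * (v * k) + (fromℕ 2 * a + r))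
                          ≡ ((v * c) * k + c * a) + (c * ½) * r
    lemma = solve-∀ ℚ-ring
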